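{- Let $R_1(x)=1$, $R_2(x)=2x$, $R_{n+2}(x)=x(nx+2)R_{n+1}(x)+x(1-x^2)\frac{d}{dx}R_{n+1}(x)$. Define $t_0(x)=1$, $t_1(x)=x$ and $t_n(x)=\frac12(1+x)R_n(x)$ for $n\ge 2$. Define also $(M_n(x))_{n\ge 1}$ by $M_1(x)=1+x$ and $$M_{n+1}(x)=(nx^2+1)M_n(x)+x(1-x^2)\,\frac{d}{dx}M_n(x).$$ Then the Turán expressions $(t_{n+1}(x))^2-t_{n+2}(x)t_n(x)$ ($n\ge 0$) and $(M_{n+1}(x))^2-M_{n+2}(x)M_n(x)$ ($n\ge 1$) are all Hurwitz stable.
   Context: A polynomial $f\in\mathbb{C}[x]$ is Hurwitz stable if it is identically zero or $f(x)\ne0$ whenever $\Re(x)>0$. Combinatorially (not needed for the statement): the coefficient of $x^k$ in $t_n(x)$ counts permutations of $\{1,\dots,n\}$ whose longest alternating subsequence ($\pi_{i_1}>\pi_{i_2}<\pi_{i_3}>\cdots$) has length $k$, and $t_n(x)$ is also the up-down runs polynomial; $M_n(x)=xW_n(x^2)+\widetilde W_n(x^2)$, where $W_n$ and $\widetilde W_n$ are the generating polynomials of permutations of $\{1,\dots,n\}$ by number of interior peaks and left peaks, respectively. -}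

module Defs where

open import Algebra.Bundles using (RawRing)
open import Data.Integer using (+_)
open import Data.List using (List; []; _∷_; map)
open import Data.List.Relation.Unary.All using (All)
open import Data.Nat as ℕ using (ℕ; zero; suc)
import Data.Nat.Properties as ℕ
open import Data.Product using (∃-syntax; _×_; _,_; proj₁; proj₂)
open import Data.Rational as ℚ using (ℚ; 0ℚ; 1ℚ; ½; _/_; ∣_∣)
import Data.Rational.Properties as ℚ
open import Data.Rational.Solver using (module +-*-Solver)
open import Data.Sum using (_⊎_)
open import Level using (0ℓ)
open import Relation.Binary.PropositionalEquality
open import Relation.Nullary using (¬_)

-- A list a₀ ∷ a₁ ∷ … ∷ [] stands for a₀ + a₁ x + ….  Trailing zeros are
-- allowed, so a polynomial is zero iff all listed coefficients are.
module Polynomial {c ℓ} (K : RawRing c ℓ) where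
  open RawRing K using (Carrier; _≈_; _+_; _*_; -_; 0#; 1#)

  infix  8 -ₚ_
  infixl 7 _*ₚ_
  infixl 6 _+ₚ_ _-ₚ_

  Poly : Set c
  Poly = List Carrier

  const : Carrier → Poly
  const a = a ∷ []

  X : Poly
  X = 0# ∷ 1# ∷ []

  _+ₚ_ : Poly → Poly → Poly
  []      +ₚ q       = q
  (a ∷ p) +ₚ []      = a ∷ p
  (a ∷ p) +ₚ (b ∷ q) = (a + b) ∷ (p +ₚ q)

  -ₚ_ : Poly → Poly
  -ₚ p = map -_ p

  _-ₚ_ : Poly → Poly → Poly
  p -ₚ q = p +ₚ (-ₚ q)

  _*ₚ_ : Poly → Poly → Poly
  []      *ₚ q = []
  (a ∷ p) *ₚ q = map (a *_) q +ₚ (0# ∷ (p *ₚ q))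

  -- (a + x p)′ = p + x p′
  deriv : Poly → Poly
  deriv []      = []
  deriv (a ∷ p) = p +ₚ (0# ∷ deriv p)

  eval : Poly → Carrier → Carrier
  eval []      z = 0#
  eval (a ∷ p) z = a + z * eval p z

  IsZero : Poly → Set _
  IsZero p = All (_≈ 0#) p

-- ℝ is the setoid of Cauchy sequences of rationals under pointwise operations.
Cauchy : (ℕ → ℚ) → Set
Cauchy x = ∀ ε → 0ℚ ℚ.< ε →
  ∃[ N ] (∀ m n → N ℕ.≤ m → N ℕ.≤ n → ∣ x m ℚ.- x n ∣ ℚ.< ε)

module CauchyProperties where
  module Identities where
    open +-*-Solver

    +-diff : ∀ a b c d → (a ℚ.+ b) ℚ.- (c ℚ.+ d) ≡ (a ℚ.- c) ℚ.+ (b ℚ.- d)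
    +-diff = solve 4
      (λ a b c d → (a :+ b) :- (c :+ d) := (a :- c) :+ (b :- d)) refl

    *-diff : ∀ a b c d →
      a ℚ.* b ℚ.- c ℚ.* d ≡ a ℚ.* (b ℚ.- d) ℚ.+ d ℚ.* (a ℚ.- c)
    *-diff = solve 4
      (λ a b c d → a :* b :- c :* d := a :* (b :- d) :+ d :* (a :- c)) refl

    neg-diff : ∀ a b → (ℚ.- a) ℚ.- (ℚ.- b) ≡ ℚ.- (a ℚ.- b)
    neg-diff = solve 2 (λ a b → (:- a) :- (:- b) := :- (a :- b)) refl

    sub-add : ∀ a b → a ≡ (a ℚ.- b) ℚ.+ b
    sub-add = solve 2 (λ a b → a := (a :- b) :+ b) refl

  open Identities

  half-pos : ∀ {ε} → 0ℚ ℚ.< ε → 0ℚ ℚ.< ½ ℚ.* ε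
  half-pos {ε} 0<ε = ℚ.positive⁻¹ (½ ℚ.* ε)
    {{ℚ.pos*pos⇒pos ½ ε {{ℚ.positive 0<ε}}}}

  half+half : ∀ ε → ½ ℚ.* ε ℚ.+ ½ ℚ.* ε ≡ ε
  half+half ε = trans (sym (ℚ.*-distribʳ-+ ε ½ ½)) (ℚ.*-identityˡ ε)

  ∣a-a∣≡0 : ∀ a → ∣ a ℚ.- a ∣ ≡ 0ℚ
  ∣a-a∣≡0 a = cong ∣_∣ (ℚ.+-inverseʳ a)

  const-cauchy : ∀ a → Cauchy (λ _ → a)
  const-cauchy a ε 0<ε = 0 , λ _ _ _ _ → subst (ℚ._< ε) (sym (∣a-a∣≡0 a)) 0<ε

  +-cauchy : ∀ {x y} → Cauchy x → Cauchy y → Cauchy (λ n → x n ℚ.+ y n)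
  +-cauchy {x} {y} cx cy ε 0<ε = N₁ ℕ.⊔ N₂ , λ m n N≤m N≤n → begin-strict
    ∣ (x m ℚ.+ y m) ℚ.- (x n ℚ.+ y n) ∣
      ≡⟨ cong ∣_∣ (+-diff (x m) (y m) (x n) (y n)) ⟩
    ∣ (x m ℚ.- x n) ℚ.+ (y m ℚ.- y n) ∣
      ≤⟨ ℚ.∣p+q∣≤∣p∣+∣q∣ (x m ℚ.- x n) (y m ℚ.- y n) ⟩
    ∣ x m ℚ.- x n ∣ ℚ.+ ∣ y m ℚ.- y n ∣
      <⟨ ℚ.+-mono-< (p₁ m n (ℕ.m⊔n≤o⇒m≤o N₁ N₂ N≤m) (ℕ.m⊔n≤o⇒m≤o N₁ N₂ N≤n))
                    (p₂ m n (ℕ.m⊔n≤o⇒n≤o N₁ N₂ N≤m) (ℕ.m⊔n≤o⇒n≤o N₁ N₂ N≤n)) ⟩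
    ½ ℚ.* ε ℚ.+ ½ ℚ.* ε
      ≡⟨ half+half ε ⟩
    ε ∎
    where
    open ℚ.≤-Reasoning
    N₁ = proj₁ (cx (½ ℚ.* ε) (half-pos 0<ε))
    p₁ = proj₂ (cx (½ ℚ.* ε) (half-pos 0<ε))
    N₂ = proj₁ (cy (½ ℚ.* ε) (half-pos 0<ε))
    p₂ = proj₂ (cy (½ ℚ.* ε) (half-pos 0<ε))

  neg-cauchy : ∀ {x} → Cauchy x → Cauchy (λ n → ℚ.- x n)
  neg-cauchy {x} cx ε 0<ε = proj₁ (cx ε 0<ε) , λ m n N≤m N≤n →
    subst (ℚ._< ε) (sym (eq m n)) (proj₂ (cx ε 0<ε) m n N≤m N≤n)
    where
    eq : ∀ m n → ∣ (ℚ.- x m) ℚ.- (ℚ.- x n) ∣ ≡ ∣ x m ℚ.- x n ∣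
    eq m n = trans
      (cong ∣_∣ (neg-diff (x m) (x n)))
      (ℚ.∣-p∣≡∣p∣ (x m ℚ.- x n))

  eventually-bounded : ∀ {x} → Cauchy x →
    ∃[ B ] (0ℚ ℚ.< B) × (∃[ N ] (∀ n → N ℕ.≤ n → ∣ x n ∣ ℚ.≤ B))
  eventually-bounded {x} cx = 1ℚ ℚ.+ ∣ x N ∣ , 0<B , N , λ n N≤n → begin
    ∣ x n ∣
      ≡⟨ cong ∣_∣ (sub-add (x n) (x N)) ⟩
    ∣ (x n ℚ.- x N) ℚ.+ x N ∣
      ≤⟨ ℚ.∣p+q∣≤∣p∣+∣q∣ (x n ℚ.- x N) (x N) ⟩
    ∣ x n ℚ.- x N ∣ ℚ.+ ∣ x N ∣
      ≤⟨ ℚ.+-monoˡ-≤ ∣ x N ∣ (ℚ.<⇒≤ (proj₂ c n N N≤n ℕ.≤-refl)) ⟩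
    1ℚ ℚ.+ ∣ x N ∣ ∎
    where
    open ℚ.≤-Reasoning
    c = cx 1ℚ (ℚ.positive⁻¹ 1ℚ)
    N = proj₁ c
    0<B : 0ℚ ℚ.< 1ℚ ℚ.+ ∣ x N ∣
    0<B = ℚ.+-mono-<-≤ {0ℚ} {1ℚ} {0ℚ} (ℚ.positive⁻¹ 1ℚ) (ℚ.0≤∣p∣ (x N))

  shrink : ∀ B ε → 0ℚ ℚ.< B → 0ℚ ℚ.< ε → ∃[ δ ] (0ℚ ℚ.< δ) × (B ℚ.* δ ≡ ε)
  shrink B ε 0<B 0<ε = δ , 0<δ , eq
    where
    instance
      B-pos = ℚ.positive 0<B
      B-nz  = ℚ.pos⇒nonZero B
      ε-pos = ℚ.positive 0<ε
      r-pos = ℚ.1/pos⇒pos B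
    δ = ℚ.1/ B ℚ.* ε
    0<δ : 0ℚ ℚ.< δ
    0<δ = ℚ.positive⁻¹ δ {{ℚ.pos*pos⇒pos (ℚ.1/ B) ε}}
    eq : B ℚ.* δ ≡ ε
    eq = trans (sym (ℚ.*-assoc B (ℚ.1/ B) ε))
        (trans (cong (ℚ._* ε) (ℚ.*-inverseʳ B)) (ℚ.*-identityˡ ε))

  *-mono-< : ∀ {B} a {δ} u → 0ℚ ℚ.< B → ∣ a ∣ ℚ.≤ B → ∣ u ∣ ℚ.< δ →
             ∣ a ℚ.* u ∣ ℚ.< B ℚ.* δ
  *-mono-< {B} a {δ} u 0<B a≤B u<δ = begin-strict
    ∣ a ℚ.* u ∣       ≡⟨ ℚ.∣p*q∣≡∣p∣*∣q∣ a u ⟩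
    ∣ a ∣ ℚ.* ∣ u ∣   ≤⟨ ℚ.*-monoʳ-≤-nonNeg ∣ u ∣ {{ℚ.nonNegative (ℚ.0≤∣p∣ u)}} a≤B ⟩
    B ℚ.* ∣ u ∣       <⟨ ℚ.*-monoʳ-<-pos B {{ℚ.positive 0<B}} u<δ ⟩
    B ℚ.* δ           ∎
    where open ℚ.≤-Reasoning

  *-close : ∀ a b c d {B C δ η ε} → 0ℚ ℚ.< B → 0ℚ ℚ.< C →
    B ℚ.* δ ≡ ½ ℚ.* ε → C ℚ.* η ≡ ½ ℚ.* ε →
    ∣ a ∣ ℚ.≤ B → ∣ d ∣ ℚ.≤ C → ∣ b ℚ.- d ∣ ℚ.< δ → ∣ a ℚ.- c ∣ ℚ.< η →
    ∣ a ℚ.* b ℚ.- c ℚ.* d ∣ ℚ.< ε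
  *-close a b c d {B} {C} {δ} {η} {ε} 0<B 0<C Bδ Cη a≤B d≤C b-d<δ a-c<η = begin-strict
    ∣ a ℚ.* b ℚ.- c ℚ.* d ∣
      ≡⟨ cong ∣_∣ (*-diff a b c d) ⟩
    ∣ a ℚ.* (b ℚ.- d) ℚ.+ d ℚ.* (a ℚ.- c) ∣
      ≤⟨ ℚ.∣p+q∣≤∣p∣+∣q∣ (a ℚ.* (b ℚ.- d)) (d ℚ.* (a ℚ.- c)) ⟩
    ∣ a ℚ.* (b ℚ.- d) ∣ ℚ.+ ∣ d ℚ.* (a ℚ.- c) ∣
      <⟨ ℚ.+-mono-< (*-mono-< a (b ℚ.- d) 0<B a≤B b-d<δ)
                    (*-mono-< d (a ℚ.- c) 0<C d≤C a-c<η) ⟩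
    B ℚ.* δ ℚ.+ C ℚ.* η
      ≡⟨ cong₂ ℚ._+_ Bδ Cη ⟩
    ½ ℚ.* ε ℚ.+ ½ ℚ.* ε
      ≡⟨ half+half ε ⟩
    ε ∎
    where open ℚ.≤-Reasoning

  *-cauchy : ∀ {x y} → Cauchy x → Cauchy y → Cauchy (λ n → x n ℚ.* y n)
  *-cauchy {x} {y} cx cy ε 0<ε =
    let B , 0<B , K , x≤B = eventually-bounded cx
        C , 0<C , L , y≤C = eventually-bounded cy
        δ , 0<δ , Bδ      = shrink B (½ ℚ.* ε) 0<B (half-pos 0<ε)
        η , 0<η , Cη      = shrink C (½ ℚ.* ε) 0<C (half-pos 0<ε)
        N₁ , p₁           = cy δ 0<δ
        N₂ , p₂           = cx η 0<η
    in (K ℕ.⊔ L) ℕ.⊔ (N₁ ℕ.⊔ N₂) , λ m n N≤m N≤n →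
      let KL≤m = ℕ.m⊔n≤o⇒m≤o (K ℕ.⊔ L) (N₁ ℕ.⊔ N₂) N≤m
          KL≤n = ℕ.m⊔n≤o⇒m≤o (K ℕ.⊔ L) (N₁ ℕ.⊔ N₂) N≤n
          NN≤m = ℕ.m⊔n≤o⇒n≤o (K ℕ.⊔ L) (N₁ ℕ.⊔ N₂) N≤m
          NN≤n = ℕ.m⊔n≤o⇒n≤o (K ℕ.⊔ L) (N₁ ℕ.⊔ N₂) N≤n
      in *-close (x m) (y m) (x n) (y n) 0<B 0<C Bδ Cη
           (x≤B m (ℕ.m⊔n≤o⇒m≤o K L KL≤m)) (y≤C n (ℕ.m⊔n≤o⇒n≤o K L KL≤n))
           (p₁ m n (ℕ.m⊔n≤o⇒m≤o N₁ N₂ NN≤m) (ℕ.m⊔n≤o⇒m≤o N₁ N₂ NN≤n))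
           (p₂ m n (ℕ.m⊔n≤o⇒n≤o N₁ N₂ NN≤m) (ℕ.m⊔n≤o⇒n≤o N₁ N₂ NN≤n))

open CauchyProperties using (const-cauchy; +-cauchy; neg-cauchy; *-cauchy)

record ℝ : Set where
  constructor mkℝ
  field
    seq    : ℕ → ℚ
    cauchy : Cauchy seq
open ℝ public

infix  8 -ᵣ_
infixl 7 _*ᵣ_
infixl 6 _+ᵣ_
infix  4 _≃ᵣ_

_≃ᵣ_ : ℝ → ℝ → Set
x ≃ᵣ y = ∀ ε → 0ℚ ℚ.< ε →
  ∃[ N ] (∀ n → N ℕ.≤ n → ∣ seq x n ℚ.- seq y n ∣ ℚ.< ε)

Positive : ℝ → Set
Positive x = ∃[ ε ] (0ℚ ℚ.< ε) × (∃[ N ] (∀ n → N ℕ.≤ n → ε ℚ.< seq x n))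

fromℚ : ℚ → ℝ
fromℚ a = mkℝ (λ _ → a) (const-cauchy a)

_+ᵣ_ : ℝ → ℝ → ℝ
x +ᵣ y = mkℝ (λ n → seq x n ℚ.+ seq y n) (+-cauchy {seq x} {seq y} (cauchy x) (cauchy y))

-ᵣ_ : ℝ → ℝ
-ᵣ x = mkℝ (λ n → ℚ.- seq x n) (neg-cauchy {seq x} (cauchy x))

_*ᵣ_ : ℝ → ℝ → ℝ
x *ᵣ y = mkℝ (λ n → seq x n ℚ.* seq y n) (*-cauchy {seq x} {seq y} (cauchy x) (cauchy y))

record ℂ : Set where
  constructor _+i_
  field
    re : ℝ
    im : ℝ
open ℂ public

ℚ⇒ℂ : ℚ → ℂ
ℚ⇒ℂ a = fromℚ a +i fromℚ 0ℚ

ℂ-rawRing : RawRing 0ℓ 0ℓ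
ℂ-rawRing = record
  { Carrier = ℂ
  ; _≈_     = λ z w → (re z ≃ᵣ re w) × (im z ≃ᵣ im w)
  ; _+_     = λ z w → (re z +ᵣ re w) +i (im z +ᵣ im w)
  ; _*_     = λ z w → (re z *ᵣ re w +ᵣ -ᵣ (im z *ᵣ im w))
                      +i (re z *ᵣ im w +ᵣ im z *ᵣ re w)
  ; -_      = λ z → (-ᵣ re z) +i (-ᵣ im z)
  ; 0#      = ℚ⇒ℂ 0ℚ
  ; 1#      = ℚ⇒ℂ 1ℚ
  }

module ℂ[x] = Polynomial ℂ-rawRing
module ℚ[x] = Polynomial ℚ.+-*-rawRing

HurwitzStable : ℂ[x].Poly → Set
HurwitzStable f =
  ℂ[x].IsZero f ⊎ (∀ z → Positive (re z) → ¬ (ℂ[x].eval f z ≈ 0#))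
  where open RawRing ℂ-rawRing using (_≈_; 0#)

complexify : ℚ[x].Poly → ℂ[x].Poly
complexify = map ℚ⇒ℂ

open ℚ[x]

nat : ℕ → Poly
nat n = const (+ n / 1)

-- R starts at index 1; R 0 is a dummy value that is never used.
R : ℕ → Poly
R 0 = []
R 1 = nat 1
R 2 = nat 2 *ₚ X
R (suc (suc n@(suc _))) =
  X *ₚ (nat n *ₚ X +ₚ nat 2) *ₚ R (suc n)
  +ₚ X *ₚ (nat 1 -ₚ X *ₚ X) *ₚ deriv (R (suc n))

t : ℕ → Poly
t 0 = nat 1
t 1 = X
t n@(suc (suc _)) = const ½ *ₚ (nat 1 +ₚ X) *ₚ R n

-- M starts at index 1; M 0 is a dummy value.
M : ℕ → Poly
M 0 = []
M 1 = nat 1 +ₚ X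
M (suc n@(suc _)) =
  (nat n *ₚ (X *ₚ X) +ₚ nat 1) *ₚ M n
  +ₚ X *ₚ (nat 1 -ₚ X *ₚ X) *ₚ deriv (M n)

turán : (ℕ → Poly) → ℕ → Poly
turán p n = p (suc n) *ₚ p (suc n) -ₚ p (suc (suc n)) *ₚ p n

{-# OPTIONS --safe #-}

-- Put Op n p = (n x² + x) p + x (1 - x²) p′.  Then t (n + 1) = Op n (t n) and
-- (1 + x) t n = x M n, so it suffices to treat t.  Suppose p is a product of factors
-- (1 + x)(x + a) with 0 ≤ a ≤ 1, and possibly of x, with n = deg p.  Then
-- H = Op n p / ((1 + x) p) is a nonnegative combination of functions x / (x + a), the Turán
-- expression of p is -x (1 + x) p² (H + (1 - x²) H′), and for Re x ≥ 0 every summand of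
-- H + (1 - x²) H′ has nonnegative real part after multiplication by x (1 + x̄).
-- Moreover, Op n p without its trivial factors x and 1 + x alternates in sign at the distinct
-- roots of p (and at -1 for even n), so its other roots interlace them; locating these by
-- bisection exhibits every t n as a limit of products of this form with rational a, which
-- makes the bounds available at Gaussian rationals.
-- If the Turán expression tends to 0 along the Gaussian rationals z k approximating a point
-- with Re z > 0, then so does t n (z k); since Re H is bounded below there, so do t (n - 1),
-- t (n - 2), …, down to t 0 = 1, which is absurd.

module Submission where

open import Defs
open import Algebra.Bundles using (CommutativeRing)
import Algebra.Solver.Ring as RingSolver
import Algebra.Solver.Ring.AlmostCommutativeRing as ACR
open import Data.Integer as ℤ using (+_; -[1+_])
import Data.Integer.Properties as ℤ
open import Data.List using (List; []; _∷_; map; length; _++_)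
open import Data.List.Properties using (length-map; length-++)
open import Data.List.Relation.Unary.All as All using (All; []; _∷_)
import Data.List.Relation.Unary.All.Properties as All
open import Data.List.Relation.Unary.AllPairs as AllPairs using (AllPairs; []; _∷_)
import Data.List.Relation.Unary.AllPairs.Properties as AllPairs
open import Data.Maybe using (Maybe; just; nothing)
open import Data.Nat as ℕ using (ℕ; zero; suc; _≤_)
import Data.Nat.Properties as ℕ
open import Data.Product using (∃-syntax; _×_; _,_; proj₁; proj₂)
open import Data.Rational as ℚ using (ℚ; 0ℚ; 1ℚ; ½; ∣_∣; mkℚ)
import Data.Rational.Properties as ℚ
open import Data.Rational.Solver using (module +-*-Solver)
import Data.Rational.Unnormalised as ℚᵘ
import Data.Rational.Unnormalised.Properties as ℚᵘ
open import Data.Sum using (inj₁; inj₂)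
open import Data.Unit using (⊤; tt)
open import Level using (0ℓ)
open import Relation.Binary.PropositionalEquality hiding (setoid)
open import Relation.Binary.Structures using (IsEquivalence)
open import Relation.Nullary using (¬_; yes; no; contradiction)
open import Relation.Nullary.Decidable using (from-yes)
open ℚ[x]
open CauchyProperties using (shrink; half-pos; half+half; *-mono-<; eventually-bounded)

-- Polynomials over ℚ

-- The roots of `t n` need not be rational, and root finding yields only approximations. So no step
-- names an exact root or divides by a value of a polynomial: every bound is multiplied out with
-- conjugates, proved exactly at Gaussian rationals for products with rational roots, and only then
-- carried over with an error tending to 0. Each root is paired with a factor 1 + x because this
-- gives the simplest increment: raising n by 2 and inserting (1 + x)(x + a) adds exactly (1 + a) x
-- / (x + a) to H. The product 1 starts with H = x / (1 + x), the product x with H = 1. As H ↦ H +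
-- (1 - x²) H′ is linear, one sign computation per root suffices, and it uses both 0 ≤ a and a ≤ 1.
-- The quantitative part comes from the two starting products alone, which already supply the margin
-- Re x / |1 + x|²; further pairs only add something nonnegative. The margin is therefore the same
-- for all approximations, which is what lets it survive the limit.

coeff : Poly → ℕ → ℚ
coeff []      _       = 0ℚ
coeff (a ∷ p) zero    = a
coeff (a ∷ p) (suc i) = coeff p i

-- Equality of polynomials, as opposed to equality of coefficient lists.
infix 4 _≋_
record _≋_ (p q : Poly) : Set where
  constructor mk≋
  field at : ∀ i → coeff p i ≡ coeff q i
open _≋_

≋-refl : ∀ {p} → p ≋ p
≋-refl = mk≋ λ _ → refl

≋-sym : ∀ {p q} → p ≋ q → q ≋ p
≋-sym e = mk≋ λ i → sym (at e i)

≋-trans : ∀ {p q r} → p ≋ q → q ≋ r → p ≋ r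
≋-trans e f = mk≋ λ i → trans (at e i) (at f i)

≋-isEquivalence : IsEquivalence _≋_
≋-isEquivalence = record { refl = ≋-refl ; sym = ≋-sym ; trans = ≋-trans }

≋-tail : ∀ {a b p q} → (a ∷ p) ≋ (b ∷ q) → p ≋ q
≋-tail e = mk≋ λ i → at e (suc i)

≋-tail-[] : ∀ {b q} → [] ≋ (b ∷ q) → [] ≋ q
≋-tail-[] e = mk≋ λ i → at e (suc i)

∷-cong : ∀ {a b p q} → a ≡ b → p ≋ q → (a ∷ p) ≋ (b ∷ q)
∷-cong a≡b e = mk≋ λ { zero → a≡b ; (suc i) → at e i }

0∷[]≋[] : (0ℚ ∷ []) ≋ []
0∷[]≋[] = mk≋ λ { zero → refl ; (suc i) → refl }

coeff-+ : ∀ p q i → coeff (p +ₚ q) i ≡ coeff p i ℚ.+ coeff q i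
coeff-+ []      q       i       = sym (ℚ.+-identityˡ _)
coeff-+ (a ∷ p) []      i       = sym (ℚ.+-identityʳ _)
coeff-+ (a ∷ p) (b ∷ q) zero    = refl
coeff-+ (a ∷ p) (b ∷ q) (suc i) = coeff-+ p q i

coeff-scale : ∀ c p i → coeff (map (c ℚ.*_) p) i ≡ c ℚ.* coeff p i
coeff-scale c []      i       = sym (ℚ.*-zeroʳ c)
coeff-scale c (a ∷ p) zero    = refl
coeff-scale c (a ∷ p) (suc i) = coeff-scale c p i

coeff-neg : ∀ p i → coeff (-ₚ p) i ≡ ℚ.- coeff p i
coeff-neg []      i       = refl
coeff-neg (a ∷ p) zero    = refl
coeff-neg (a ∷ p) (suc i) = coeff-neg p i

+ₚ-cong : ∀ {p p′ q q′} → p ≋ p′ → q ≋ q′ → p +ₚ q ≋ p′ +ₚ q′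
+ₚ-cong {p} {p′} {q} {q′} e f = mk≋ λ i →
  trans (coeff-+ p q i) (trans (cong₂ ℚ._+_ (at e i) (at f i)) (sym (coeff-+ p′ q′ i)))

scale-cong : ∀ c {p q} → p ≋ q → map (c ℚ.*_) p ≋ map (c ℚ.*_) q
scale-cong c {p} {q} e = mk≋ λ i →
  trans (coeff-scale c p i) (trans (cong (c ℚ.*_) (at e i)) (sym (coeff-scale c q i)))

-ₚ-cong : ∀ {p q} → p ≋ q → -ₚ p ≋ -ₚ q
-ₚ-cong {p} {q} e = mk≋ λ i →
  trans (coeff-neg p i) (trans (cong ℚ.-_ (at e i)) (sym (coeff-neg q i)))

+ₚ-assoc : ∀ p q r → (p +ₚ q) +ₚ r ≋ p +ₚ (q +ₚ r)
+ₚ-assoc p q r = mk≋ λ i → begin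
  coeff ((p +ₚ q) +ₚ r) i                      ≡⟨ coeff-+ (p +ₚ q) r i ⟩
  coeff (p +ₚ q) i ℚ.+ coeff r i               ≡⟨ cong (ℚ._+ coeff r i) (coeff-+ p q i) ⟩
  (coeff p i ℚ.+ coeff q i) ℚ.+ coeff r i      ≡⟨ ℚ.+-assoc (coeff p i) (coeff q i) (coeff r i) ⟩
  coeff p i ℚ.+ (coeff q i ℚ.+ coeff r i)      ≡⟨ cong (coeff p i ℚ.+_) (coeff-+ q r i) ⟨
  coeff p i ℚ.+ coeff (q +ₚ r) i               ≡⟨ coeff-+ p (q +ₚ r) i ⟨
  coeff (p +ₚ (q +ₚ r)) i ∎
  where open ≡-Reasoning

+ₚ-comm : ∀ p q → p +ₚ q ≋ q +ₚ p
+ₚ-comm p q = mk≋ λ i →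
  trans (coeff-+ p q i) (trans (ℚ.+-comm (coeff p i) (coeff q i)) (sym (coeff-+ q p i)))

+ₚ-identityʳ : ∀ p → p +ₚ [] ≋ p
+ₚ-identityʳ []      = ≋-refl
+ₚ-identityʳ (a ∷ p) = ≋-refl

+ₚ-inverseʳ : ∀ p → p +ₚ -ₚ p ≋ []
+ₚ-inverseʳ p = mk≋ λ i →
  trans (coeff-+ p (-ₚ p) i)
        (trans (cong (coeff p i ℚ.+_) (coeff-neg p i)) (ℚ.+-inverseʳ (coeff p i)))

+ₚ-interchange : ∀ p q r s → (p +ₚ q) +ₚ (r +ₚ s) ≋ (p +ₚ r) +ₚ (q +ₚ s)
+ₚ-interchange p q r s = mk≋ λ i → begin
  coeff ((p +ₚ q) +ₚ (r +ₚ s)) i ≡⟨ coeff-+ (p +ₚ q) (r +ₚ s) i ⟩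
  coeff (p +ₚ q) i ℚ.+ coeff (r +ₚ s) i ≡⟨ cong₂ ℚ._+_ (coeff-+ p q i) (coeff-+ r s i) ⟩
  (coeff p i ℚ.+ coeff q i) ℚ.+ (coeff r i ℚ.+ coeff s i)
    ≡⟨ solve 4 (λ a b c d → (a :+ b) :+ (c :+ d) := (a :+ c) :+ (b :+ d)) refl
         (coeff p i) (coeff q i) (coeff r i) (coeff s i) ⟩
  (coeff p i ℚ.+ coeff r i) ℚ.+ (coeff q i ℚ.+ coeff s i)
    ≡⟨ cong₂ ℚ._+_ (coeff-+ p r i) (coeff-+ q s i) ⟨
  coeff (p +ₚ r) i ℚ.+ coeff (q +ₚ s) i ≡⟨ coeff-+ (p +ₚ r) (q +ₚ s) i ⟨
  coeff ((p +ₚ r) +ₚ (q +ₚ s)) i ∎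
  where open ≡-Reasoning; open +-*-Solver

scale-+ₚ : ∀ c p q → map (c ℚ.*_) (p +ₚ q) ≋ map (c ℚ.*_) p +ₚ map (c ℚ.*_) q
scale-+ₚ c p q = mk≋ λ i → begin
  coeff (map (c ℚ.*_) (p +ₚ q)) i ≡⟨ coeff-scale c (p +ₚ q) i ⟩
  c ℚ.* coeff (p +ₚ q) i ≡⟨ cong (c ℚ.*_) (coeff-+ p q i) ⟩
  c ℚ.* (coeff p i ℚ.+ coeff q i) ≡⟨ ℚ.*-distribˡ-+ c (coeff p i) (coeff q i) ⟩
  c ℚ.* coeff p i ℚ.+ c ℚ.* coeff q i ≡⟨ cong₂ ℚ._+_ (coeff-scale c p i) (coeff-scale c q i) ⟨
  coeff (map (c ℚ.*_) p) i ℚ.+ coeff (map (c ℚ.*_) q) i ≡⟨ coeff-+ (map (c ℚ.*_) p) _ i ⟨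
  coeff (map (c ℚ.*_) p +ₚ map (c ℚ.*_) q) i ∎
  where open ≡-Reasoning

+-scale : ∀ c d p → map ((c ℚ.+ d) ℚ.*_) p ≋ map (c ℚ.*_) p +ₚ map (d ℚ.*_) p
+-scale c d p = mk≋ λ i → begin
  coeff (map ((c ℚ.+ d) ℚ.*_) p) i ≡⟨ coeff-scale (c ℚ.+ d) p i ⟩
  (c ℚ.+ d) ℚ.* coeff p i ≡⟨ ℚ.*-distribʳ-+ (coeff p i) c d ⟩
  c ℚ.* coeff p i ℚ.+ d ℚ.* coeff p i ≡⟨ cong₂ ℚ._+_ (coeff-scale c p i) (coeff-scale d p i) ⟨
  coeff (map (c ℚ.*_) p) i ℚ.+ coeff (map (d ℚ.*_) p) i ≡⟨ coeff-+ (map (c ℚ.*_) p) _ i ⟨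
  coeff (map (c ℚ.*_) p +ₚ map (d ℚ.*_) p) i ∎
  where open ≡-Reasoning

scale-scale : ∀ c d p → map ((c ℚ.* d) ℚ.*_) p ≋ map (c ℚ.*_) (map (d ℚ.*_) p)
scale-scale c d p = mk≋ λ i → begin
  coeff (map ((c ℚ.* d) ℚ.*_) p) i ≡⟨ coeff-scale (c ℚ.* d) p i ⟩
  (c ℚ.* d) ℚ.* coeff p i ≡⟨ ℚ.*-assoc c d (coeff p i) ⟩
  c ℚ.* (d ℚ.* coeff p i) ≡⟨ cong (c ℚ.*_) (coeff-scale d p i) ⟨
  c ℚ.* coeff (map (d ℚ.*_) p) i ≡⟨ coeff-scale c (map (d ℚ.*_) p) i ⟨
  coeff (map (c ℚ.*_) (map (d ℚ.*_) p)) i ∎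
  where open ≡-Reasoning

scale-identity : ∀ p → map (1ℚ ℚ.*_) p ≋ p
scale-identity p = mk≋ λ i → trans (coeff-scale 1ℚ p i) (ℚ.*-identityˡ (coeff p i))

0∷-cong : ∀ {p q} → p ≋ q → (0ℚ ∷ p) ≋ (0ℚ ∷ q)
0∷-cong = ∷-cong refl

scale-0∷ : ∀ c p → map (c ℚ.*_) (0ℚ ∷ p) ≋ (0ℚ ∷ map (c ℚ.*_) p)
scale-0∷ c p = ∷-cong (ℚ.*-zeroʳ c) ≋-refl

*ₚ-congʳ : ∀ p {q q′} → q ≋ q′ → p *ₚ q ≋ p *ₚ q′
*ₚ-congʳ []      e = ≋-refl
*ₚ-congʳ (a ∷ p) e = +ₚ-cong (scale-cong a e) (0∷-cong (*ₚ-congʳ p e))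

*ₚ-[] : ∀ p → p *ₚ [] ≋ []
*ₚ-[] []      = ≋-refl
*ₚ-[] (a ∷ p) = ≋-trans (0∷-cong (*ₚ-[] p)) 0∷[]≋[]

*ₚ-0∷ : ∀ p q → p *ₚ (0ℚ ∷ q) ≋ (0ℚ ∷ p *ₚ q)
*ₚ-0∷ []      q = ≋-sym 0∷[]≋[]
*ₚ-0∷ (a ∷ p) q =
  +ₚ-cong (scale-0∷ a q) (0∷-cong (*ₚ-0∷ p q))

*ₚ-distribʳ : ∀ p q r → (p +ₚ q) *ₚ r ≋ p *ₚ r +ₚ q *ₚ r
*ₚ-distribʳ []      q       r = ≋-refl
*ₚ-distribʳ (a ∷ p) []      r = ≋-sym (+ₚ-identityʳ _)
*ₚ-distribʳ (a ∷ p) (b ∷ q) r = ≋-trans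
  (+ₚ-cong (+-scale a b r) (0∷-cong (*ₚ-distribʳ p q r)))
  (+ₚ-interchange (map (a ℚ.*_) r) (map (b ℚ.*_) r) (0ℚ ∷ p *ₚ r) (0ℚ ∷ q *ₚ r))

*ₚ-distribˡ : ∀ p q r → p *ₚ (q +ₚ r) ≋ p *ₚ q +ₚ p *ₚ r
*ₚ-distribˡ []      q r = ≋-refl
*ₚ-distribˡ (a ∷ p) q r = ≋-trans
  (+ₚ-cong (scale-+ₚ a q r) (0∷-cong (*ₚ-distribˡ p q r)))
  (+ₚ-interchange (map (a ℚ.*_) q) (map (a ℚ.*_) r) (0ℚ ∷ p *ₚ q) (0ℚ ∷ p *ₚ r))

∷-split : ∀ a p → (a ∷ p) ≋ const a +ₚ (0ℚ ∷ p)
∷-split a p = ∷-cong (sym (ℚ.+-identityʳ a)) ≋-refl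

*ₚ-const : ∀ p b → p *ₚ const b ≋ map (b ℚ.*_) p
*ₚ-const []      b = ≋-refl
*ₚ-const (a ∷ p) b = ∷-cong (trans (ℚ.+-identityʳ _) (ℚ.*-comm a b)) (*ₚ-const p b)

*ₚ-comm : ∀ p q → p *ₚ q ≋ q *ₚ p
*ₚ-comm []      q = ≋-sym (*ₚ-[] q)
*ₚ-comm (a ∷ p) q = ≋-sym (≋-trans (*ₚ-congʳ q (∷-split a p)) (≋-trans
  (*ₚ-distribˡ q (const a) (0ℚ ∷ p))
  (+ₚ-cong (*ₚ-const q a) (≋-trans (*ₚ-0∷ q p) (0∷-cong (*ₚ-comm q p))))))

*ₚ-cong : ∀ {p p′ q q′} → p ≋ p′ → q ≋ q′ → p *ₚ q ≋ p′ *ₚ q′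
*ₚ-cong {p} {p′} {q} {q′} e f = ≋-trans (*ₚ-congʳ p f)
  (≋-trans (*ₚ-comm p q′) (≋-trans (*ₚ-congʳ q′ e) (*ₚ-comm q′ p′)))

scale-*ₚ : ∀ c p q → map (c ℚ.*_) p *ₚ q ≋ map (c ℚ.*_) (p *ₚ q)
scale-*ₚ c []      q = ≋-refl
scale-*ₚ c (a ∷ p) q = ≋-trans
  (+ₚ-cong (scale-scale c a q)
           (≋-trans (0∷-cong (scale-*ₚ c p q)) (≋-sym (scale-0∷ c _))))
  (≋-sym (scale-+ₚ c (map (a ℚ.*_) q) _))

scale-zero : ∀ q → map (0ℚ ℚ.*_) q ≋ []
scale-zero q = mk≋ λ i → trans (coeff-scale 0ℚ q i) (ℚ.*-zeroˡ (coeff q i))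

0∷-*ₚ : ∀ p q → (0ℚ ∷ p) *ₚ q ≋ (0ℚ ∷ p *ₚ q)
0∷-*ₚ p q = +ₚ-cong (scale-zero q) ≋-refl

*ₚ-assoc : ∀ p q r → (p *ₚ q) *ₚ r ≋ p *ₚ (q *ₚ r)
*ₚ-assoc []      q r = ≋-refl
*ₚ-assoc (a ∷ p) q r = ≋-trans (*ₚ-distribʳ (map (a ℚ.*_) q) (0ℚ ∷ p *ₚ q) r)
  (+ₚ-cong (scale-*ₚ a q r) (≋-trans (0∷-*ₚ (p *ₚ q) r) (0∷-cong (*ₚ-assoc p q r))))

*ₚ-identityˡ : ∀ p → const 1ℚ *ₚ p ≋ p
*ₚ-identityˡ p = ≋-trans (+ₚ-cong (scale-identity p) 0∷[]≋[]) (+ₚ-identityʳ p)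

ℚ[x]-commutativeRing : CommutativeRing 0ℓ 0ℓ
ℚ[x]-commutativeRing = record
  { Carrier = Poly ; _≈_ = _≋_ ; _+_ = _+ₚ_ ; _*_ = _*ₚ_ ; -_ = -ₚ_
  ; 0# = [] ; 1# = const 1ℚ
  ; isCommutativeRing = record
    { isRing = record
      { +-isAbelianGroup = record
        { isGroup = record
          { isMonoid = record
            { isSemigroup = record
              { isMagma = record { isEquivalence = ≋-isEquivalence ; ∙-cong = +ₚ-cong }
              ; assoc = +ₚ-assoc }
            ; identity = (λ p → ≋-refl) , +ₚ-identityʳ }
          ; inverse = (λ p → ≋-trans (+ₚ-comm (-ₚ p) p) (+ₚ-inverseʳ p)) , +ₚ-inverseʳ
          ; ⁻¹-cong = -ₚ-cong }
        ; comm = +ₚ-comm }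
      ; *-cong = *ₚ-cong
      ; *-assoc = *ₚ-assoc
      ; *-identity = *ₚ-identityˡ , λ p → ≋-trans (*ₚ-comm p (const 1ℚ)) (*ₚ-identityˡ p)
      ; distrib = *ₚ-distribˡ , λ r p q → *ₚ-distribʳ p q r
      }
    ; *-comm = *ₚ-comm
    }
  }

-- Formal differentiation

deriv-zero : ∀ {q} → [] ≋ q → [] ≋ deriv q
deriv-zero {[]}    e = ≋-refl
deriv-zero {b ∷ q} e = ≋-trans (≋-sym 0∷[]≋[])
  (+ₚ-cong (≋-tail-[] e) (0∷-cong (deriv-zero (≋-tail-[] e))))

deriv-cong : ∀ {p q} → p ≋ q → deriv p ≋ deriv q
deriv-cong {[]}    {q}     e = deriv-zero e
deriv-cong {a ∷ p} {[]}    e = ≋-sym (deriv-zero (≋-sym e))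
deriv-cong {a ∷ p} {b ∷ q} e =
  +ₚ-cong (≋-tail e) (0∷-cong (deriv-cong (≋-tail e)))

deriv-+ₚ : ∀ p q → deriv (p +ₚ q) ≋ deriv p +ₚ deriv q
deriv-+ₚ []      q       = ≋-refl
deriv-+ₚ (a ∷ p) []      = ≋-sym (+ₚ-identityʳ _)
deriv-+ₚ (a ∷ p) (b ∷ q) = ≋-trans
  (+ₚ-cong (≋-refl {p +ₚ q}) (0∷-cong (deriv-+ₚ p q)))
  (+ₚ-interchange p q (0ℚ ∷ deriv p) (0ℚ ∷ deriv q))

deriv-scale : ∀ c p → deriv (map (c ℚ.*_) p) ≋ map (c ℚ.*_) (deriv p)
deriv-scale c []      = ≋-refl
deriv-scale c (a ∷ p) = ≋-sym (≋-trans (scale-+ₚ c p _)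
  (+ₚ-cong (≋-refl {map (c ℚ.*_) p}) (≋-trans (scale-0∷ c _) (0∷-cong (≋-sym (deriv-scale c p))))))

deriv-*ₚ : ∀ p q → deriv (p *ₚ q) ≋ deriv p *ₚ q +ₚ p *ₚ deriv q
deriv-*ₚ []      q = ≋-refl
deriv-*ₚ (a ∷ p) q = begin
  deriv (map (a ℚ.*_) q +ₚ (0ℚ ∷ p *ₚ q))
    ≈⟨ deriv-+ₚ (map (a ℚ.*_) q) _ ⟩
  deriv (map (a ℚ.*_) q) +ₚ (p *ₚ q +ₚ (0ℚ ∷ deriv (p *ₚ q)))
    ≈⟨ +ₚ-cong (deriv-scale a q) (+ₚ-cong (≋-refl {p *ₚ q}) (0∷-cong (deriv-*ₚ p q))) ⟩
  map (a ℚ.*_) (deriv q) +ₚ (p *ₚ q +ₚ ((0ℚ ∷ deriv p *ₚ q) +ₚ (0ℚ ∷ p *ₚ deriv q)))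
    ≈⟨ rearrange (map (a ℚ.*_) (deriv q)) (p *ₚ q) (0ℚ ∷ deriv p *ₚ q) (0ℚ ∷ p *ₚ deriv q) ⟩
  (p *ₚ q +ₚ (0ℚ ∷ deriv p *ₚ q)) +ₚ (map (a ℚ.*_) (deriv q) +ₚ (0ℚ ∷ p *ₚ deriv q))
    ≈⟨ +ₚ-cong (≋-trans (*ₚ-distribʳ p (0ℚ ∷ deriv p) q)
                        (+ₚ-cong (≋-refl {p *ₚ q}) (0∷-*ₚ (deriv p) q)))
               (≋-refl {map (a ℚ.*_) (deriv q) +ₚ (0ℚ ∷ p *ₚ deriv q)}) ⟨
  (p +ₚ (0ℚ ∷ deriv p)) *ₚ q +ₚ (map (a ℚ.*_) (deriv q) +ₚ (0ℚ ∷ p *ₚ deriv q)) ∎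
  where
  open import Relation.Binary.Reasoning.Setoid (CommutativeRing.setoid ℚ[x]-commutativeRing)
  rearrange : ∀ u v w z → u +ₚ (v +ₚ (w +ₚ z)) ≋ (v +ₚ w) +ₚ (u +ₚ z)
  rearrange u v w z = ≋-trans (+ₚ-cong (≋-refl {u}) (≋-sym (+ₚ-assoc v w z)))
    (≋-trans (≋-sym (+ₚ-assoc u (v +ₚ w) z))
    (≋-trans (+ₚ-cong (+ₚ-comm u (v +ₚ w)) (≋-refl {z})) (+ₚ-assoc (v +ₚ w) u z)))

-- Algebras over ℚ, normalization of identities, evaluation

record Algebra : Set₁ where
  field
    ring   : CommutativeRing 0ℓ 0ℓ
  open CommutativeRing ring public
    hiding (ring) renaming (refl to ≈-refl; sym to ≈-sym; trans to ≈-trans)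
  field
    ι      : ℚ → Carrier
    ι-+    : ∀ a b → ι (a ℚ.+ b) ≈ ι a + ι b
    ι-*    : ∀ a b → ι (a ℚ.* b) ≈ ι a * ι b
    ι-neg  : ∀ a → ι (ℚ.- a) ≈ - ι a
    ι-0    : ι 0ℚ ≈ 0#
    ι-1    : ι 1ℚ ≈ 1#

-- Coefficients are rationals transported by `ι`, so constants such as ½ are computed in ℚ instead
-- of being treated as atoms.
module AlgebraSolver (A : Algebra) where
  open Algebra A
  private
    morphism : ℚ.+-*-rawRing ACR.-Raw-AlmostCommutative⟶ ACR.fromCommutativeRing ring
    morphism = record
      { ⟦_⟧ = ι ; +-homo = ι-+ ; *-homo = ι-* ; -‿homo = ι-neg ; 0-homo = ι-0 ; 1-homo = ι-1 }
    ι≟ : ∀ a b → Maybe (ι a ≈ ι b)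
    ι≟ a b with a ℚ.≟ b
    ... | yes refl = just (≈-refl)
    ... | no _     = nothing
  open RingSolver ℚ.+-*-rawRing (ACR.fromCommutativeRing ring) morphism ι≟ public
    using (solve; _:=_; _:+_; _:*_; _:-_; :-_; con)

ℚ[x]-algebra : Algebra
ℚ[x]-algebra = record
  { ring = ℚ[x]-commutativeRing
  ; ι = const
  ; ι-+ = λ a b → ≋-refl
  ; ι-* = λ a b → ∷-cong (sym (ℚ.+-identityʳ _)) ≋-refl
  ; ι-neg = λ a → ≋-refl
  ; ι-0 = 0∷[]≋[]
  ; ι-1 = ≋-refl
  }

ℚ-algebra : Algebra
ℚ-algebra = record
  { ring = ℚ.+-*-commutativeRing ; ι = λ a → a
  ; ι-+ = λ _ _ → refl ; ι-* = λ _ _ → refl ; ι-neg = λ _ → refl ; ι-0 = refl ; ι-1 = refl }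

-- Used twice: over ℚ to detect sign changes, over ℚ[i] for the bounds in the half-plane.
module Evaluation (A : Algebra) where
  open Algebra A
  open AlgebraSolver A using (solve; _:=_; _:+_; _:*_; :-_)
  open import Algebra.Properties.Ring (CommutativeRing.ring ring) using (-0#≈0#)
  open import Relation.Binary.Reasoning.Setoid setoid

  ev : Poly → Carrier → Carrier
  ev []      x = 0#
  ev (a ∷ p) x = ι a + x * ev p x

  ev-zero : ∀ {p} → [] ≋ p → ∀ x → 0# ≈ ev p x
  ev-zero {[]}    e x = ≈-refl
  ev-zero {a ∷ p} e x = begin
    0#              ≈⟨ +-identityˡ 0# ⟨
    0# + 0#         ≈⟨ +-cong (≈-trans (≈-sym ι-0) (reflexive (cong ι (at e 0)))) (≈-sym (zeroʳ x)) ⟩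
    ι a + x * 0#    ≈⟨ +-congˡ (*-congˡ (ev-zero (≋-tail-[] e) x)) ⟩
    ι a + x * ev p x ∎

  ev-cong : ∀ {p q} → p ≋ q → ∀ x → ev p x ≈ ev q x
  ev-cong {[]}    {q}     e x = ev-zero e x
  ev-cong {a ∷ p} {[]}    e x = ≈-sym (ev-zero (≋-sym e) x)
  ev-cong {a ∷ p} {b ∷ q} e x =
    +-cong (reflexive (cong ι (at e 0))) (*-congˡ (ev-cong (≋-tail e) x))

  ev-+ : ∀ p q x → ev (p +ₚ q) x ≈ ev p x + ev q x
  ev-+ []      q       x = ≈-sym (+-identityˡ _)
  ev-+ (a ∷ p) []      x = ≈-sym (+-identityʳ _)
  ev-+ (a ∷ p) (b ∷ q) x = begin
    ι (a ℚ.+ b) + x * ev (p +ₚ q) x         ≈⟨ +-cong (ι-+ a b) (*-congˡ (ev-+ p q x)) ⟩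
    ι a + ι b + x * (ev p x + ev q x)
      ≈⟨ solve 5 (λ a b x p q → a :+ b :+ x :* (p :+ q) := (a :+ x :* p) :+ (b :+ x :* q))
           (≈-refl) (ι a) (ι b) x (ev p x) (ev q x) ⟩
    (ι a + x * ev p x) + (ι b + x * ev q x) ∎

  ev-scale : ∀ c p x → ev (map (c ℚ.*_) p) x ≈ ι c * ev p x
  ev-scale c []      x = ≈-sym (zeroʳ (ι c))
  ev-scale c (a ∷ p) x = begin
    ι (c ℚ.* a) + x * ev (map (c ℚ.*_) p) x ≈⟨ +-cong (ι-* c a) (*-congˡ (ev-scale c p x)) ⟩
    ι c * ι a + x * (ι c * ev p x)
      ≈⟨ solve 4 (λ c a x p → c :* a :+ x :* (c :* p) := c :* (a :+ x :* p))
           (≈-refl) (ι c) (ι a) x (ev p x) ⟩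
    ι c * (ι a + x * ev p x) ∎

  ev-* : ∀ p q x → ev (p *ₚ q) x ≈ ev p x * ev q x
  ev-* []      q x = ≈-sym (zeroˡ _)
  ev-* (a ∷ p) q x = begin
    ev (map (a ℚ.*_) q +ₚ (0ℚ ∷ p *ₚ q)) x ≈⟨ ev-+ (map (a ℚ.*_) q) _ x ⟩
    ev (map (a ℚ.*_) q) x + (ι 0ℚ + x * ev (p *ₚ q) x)
      ≈⟨ +-cong (ev-scale a q x) (+-cong ι-0 (*-congˡ (ev-* p q x))) ⟩
    ι a * ev q x + (0# + x * (ev p x * ev q x)) ≈⟨ +-congˡ (+-identityˡ _) ⟩
    ι a * ev q x + x * (ev p x * ev q x)
      ≈⟨ solve 4 (λ a q x p → a :* q :+ x :* (p :* q) := (a :+ x :* p) :* q)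
           (≈-refl) (ι a) (ev q x) x (ev p x) ⟩
    (ι a + x * ev p x) * ev q x ∎

  ev-neg : ∀ p x → ev (-ₚ p) x ≈ - ev p x
  ev-neg []      x = ≈-sym -0#≈0#
  ev-neg (a ∷ p) x = begin
    ι (ℚ.- a) + x * ev (-ₚ p) x ≈⟨ +-cong (ι-neg a) (*-congˡ (ev-neg p x)) ⟩
    - ι a + x * (- ev p x)
      ≈⟨ solve 3 (λ a x p → :- a :+ x :* (:- p) := :- (a :+ x :* p))
           (≈-refl) (ι a) x (ev p x) ⟩
    - (ι a + x * ev p x) ∎

  ev-const : ∀ c x → ev (const c) x ≈ ι c
  ev-const c x = ≈-trans (+-congˡ (zeroʳ x)) (+-identityʳ (ι c))

  ev-X : ∀ x → ev X x ≈ x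
  ev-X x = begin
    ι 0ℚ + x * (ι 1ℚ + x * 0#) ≈⟨ +-cong ι-0 (*-congˡ (+-cong ι-1 (zeroʳ x))) ⟩
    0# + x * (1# + 0#) ≈⟨ +-identityˡ _ ⟩
    x * (1# + 0#) ≈⟨ *-congˡ (+-identityʳ 1#) ⟩
    x * 1# ≈⟨ *-identityʳ x ⟩
    x ∎

-- The recurrences for t and M

module ℚ[x]-Solver = AlgebraSolver ℚ[x]-algebra
module ≋-Reasoning where
  open import Relation.Binary.Reasoning.Setoid
    (CommutativeRing.setoid ℚ[x]-commutativeRing) public

natℚ : ℕ → ℚ
natℚ n = + n ℚ./ 1

natℚ-suc : ∀ n → natℚ (suc n) ≡ 1ℚ ℚ.+ natℚ n
natℚ-suc n = ℚ.toℚᵘ-injective (begin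
  ℚ.toℚᵘ (natℚ (suc n))              ≈⟨ ℚ.toℚᵘ-fromℚᵘ (ℚᵘ.mkℚᵘ (+ suc n) 0) ⟩
  ℚᵘ.mkℚᵘ (+ suc n) 0                ≈⟨ ℚᵘ.*≡* (cong (λ i → (+ 1 ℤ.+ i) ℤ.* + 1) (sym (ℤ.*-identityʳ (+ n)))) ⟩
  ℚᵘ.1ℚᵘ ℚᵘ.+ ℚᵘ.mkℚᵘ (+ n) 0        ≈⟨ ℚᵘ.+-congʳ ℚᵘ.1ℚᵘ (ℚ.toℚᵘ-fromℚᵘ (ℚᵘ.mkℚᵘ (+ n) 0)) ⟨
  ℚᵘ.1ℚᵘ ℚᵘ.+ ℚ.toℚᵘ (natℚ n)        ≈⟨ ℚ.toℚᵘ-homo-+ 1ℚ (natℚ n) ⟨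
  ℚ.toℚᵘ (1ℚ ℚ.+ natℚ n) ∎)
  where
  open ℚᵘ.≃-Reasoning

Op : ℚ → Poly → Poly
Op ν p = (const ν *ₚ X *ₚ X +ₚ X) *ₚ p +ₚ X *ₚ (nat 1 -ₚ X *ₚ X) *ₚ deriv p

Op-cong : ∀ ν {p q} → p ≋ q → Op ν p ≋ Op ν q
Op-cong ν e = +ₚ-cong (*ₚ-congʳ (const ν *ₚ X *ₚ X +ₚ X) e)
                      (*ₚ-congʳ (X *ₚ (nat 1 -ₚ X *ₚ X)) (deriv-cong e))

module _ where
  open ℚ[x]-Solver
  open ≋-Reasoning

  Op-+ₚ : ∀ ν p q → Op ν (p +ₚ q) ≋ Op ν p +ₚ Op ν q
  Op-+ₚ ν p q = begin
    l *ₚ (p +ₚ q) +ₚ m *ₚ deriv (p +ₚ q)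
      ≈⟨ +ₚ-cong (≋-refl {l *ₚ (p +ₚ q)}) (*ₚ-congʳ m (deriv-+ₚ p q)) ⟩
    l *ₚ (p +ₚ q) +ₚ m *ₚ (deriv p +ₚ deriv q)
      ≈⟨ solve 6 (λ l m p q p′ q′ → l :* (p :+ q) :+ m :* (p′ :+ q′) :=
                     (l :* p :+ m :* p′) :+ (l :* q :+ m :* q′))
           ≋-refl l m p q (deriv p) (deriv q) ⟩
    Op ν p +ₚ Op ν q ∎
    where
    l = const ν *ₚ X *ₚ X +ₚ X
    m = X *ₚ (nat 1 -ₚ X *ₚ X)

  -- `Op ν` is a multiplication plus the derivation x (1 - x²) d/dx, and only the derivation notices
  -- the factor q.
  Op-*ₚ : ∀ ν q p → Op ν (q *ₚ p) ≋ q *ₚ Op ν p +ₚ X *ₚ (nat 1 -ₚ X *ₚ X) *ₚ (deriv q *ₚ p)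
  Op-*ₚ ν q p = begin
    l *ₚ (q *ₚ p) +ₚ m *ₚ deriv (q *ₚ p)
      ≈⟨ +ₚ-cong (≋-refl {l *ₚ (q *ₚ p)}) (*ₚ-congʳ m (deriv-*ₚ q p)) ⟩
    l *ₚ (q *ₚ p) +ₚ m *ₚ (deriv q *ₚ p +ₚ q *ₚ deriv p)
      ≈⟨ solve 6 (λ l m p q p′ q′ → l :* (q :* p) :+ m :* (q′ :* p :+ q :* p′) :=
                     q :* (l :* p :+ m :* p′) :+ m :* (q′ :* p))
           ≋-refl l m p q (deriv p) (deriv q) ⟩
    q *ₚ Op ν p +ₚ m *ₚ (deriv q *ₚ p) ∎
    where
    l = const ν *ₚ X *ₚ X +ₚ X
    m = X *ₚ (nat 1 -ₚ X *ₚ X)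

  Op-const* : ∀ ν c p → Op ν (const c *ₚ p) ≋ const c *ₚ Op ν p
  Op-const* ν c p = begin
    Op ν (const c *ₚ p) ≈⟨ Op-*ₚ ν (const c) p ⟩
    const c *ₚ Op ν p +ₚ X *ₚ (nat 1 -ₚ X *ₚ X) *ₚ (deriv (const c) *ₚ p)
      ≈⟨ +ₚ-cong (≋-refl {const c *ₚ Op ν p})
           (*ₚ-congʳ (X *ₚ (nat 1 -ₚ X *ₚ X)) (*ₚ-cong {q = p} 0∷[]≋[] ≋-refl)) ⟩
    const c *ₚ Op ν p +ₚ X *ₚ (nat 1 -ₚ X *ₚ X) *ₚ []
      ≈⟨ +ₚ-cong (≋-refl {const c *ₚ Op ν p}) (*ₚ-[] (X *ₚ (nat 1 -ₚ X *ₚ X))) ⟩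
    const c *ₚ Op ν p +ₚ []
      ≈⟨ +ₚ-identityʳ (const c *ₚ Op ν p) ⟩
    const c *ₚ Op ν p ∎

  deriv-1+X : deriv (nat 1 +ₚ X) ≋ nat 1
  deriv-1+X = mk≋ λ { 0 → refl ; 1 → refl ; (suc (suc i)) → refl }

  deriv-X : deriv X ≋ nat 1
  deriv-X = mk≋ λ { 0 → refl ; 1 → refl ; (suc (suc i)) → refl }

  -- For n ≥ 2, differentiating the factor (1 + x)/2 contributes x (1 - x) times the product, and
  -- with n = 1 + μ one has (1 + μ) x² + x + x (1 - x) = x (μ x + 2), the coefficient in the
  -- recurrence of `R`.
  t-suc : ∀ n → t (suc n) ≋ Op (natℚ n) (t n)
  t-suc 0 = mk≋ λ { 0 → refl ; 1 → refl ; 2 → refl ; 3 → refl ; (suc (suc (suc (suc i)))) → refl }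
  t-suc 1 = mk≋ λ { 0 → refl ; 1 → refl ; 2 → refl ; 3 → refl ; 4 → refl
                  ; (suc (suc (suc (suc (suc i))))) → refl }
  t-suc (suc (suc k)) = begin
    c *ₚ r′
      ≈⟨ solve 4 (λ m X r d → con ½ :* (con 1ℚ :+ X) :*
             (X :* (m :* X :+ con two) :* r :+ X :* (con 1ℚ :- X :* X) :* d) :=
           ((con 1ℚ :+ m) :* X :* X :+ X) :* (con ½ :* (con 1ℚ :+ X) :* r)
           :+ X :* (con 1ℚ :- X :* X) :* (con ½ :* r :+ con ½ :* (con 1ℚ :+ X) :* d))
           ≋-refl (const μ) X r (deriv r) ⟩
    l′ *ₚ (c *ₚ r) +ₚ m *ₚ (const ½ *ₚ r +ₚ c *ₚ deriv r)
      ≈⟨ +ₚ-cong (≋-refl {l′ *ₚ (c *ₚ r)}) (*ₚ-congʳ m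
           (+ₚ-cong {q = c *ₚ deriv r} (*ₚ-cong {q = r} deriv-c ≋-refl) ≋-refl)) ⟨
    l′ *ₚ (c *ₚ r) +ₚ m *ₚ (deriv c *ₚ r +ₚ c *ₚ deriv r)
      ≈⟨ +ₚ-cong (≋-refl {l′ *ₚ (c *ₚ r)}) (*ₚ-congʳ m (deriv-*ₚ c r)) ⟨
    Op (1ℚ ℚ.+ μ) (c *ₚ r)
      ≡⟨ cong (λ ν → Op ν (c *ₚ r)) (natℚ-suc (suc k)) ⟨
    Op (natℚ (suc (suc k))) (c *ₚ r) ∎
    where
    two = 1ℚ ℚ.+ 1ℚ
    μ = natℚ (suc k)
    c = const ½ *ₚ (nat 1 +ₚ X)
    r = R (suc (suc k))
    r′ = R (suc (suc (suc k)))
    l′ = const (1ℚ ℚ.+ μ) *ₚ X *ₚ X +ₚ X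
    m = X *ₚ (nat 1 -ₚ X *ₚ X)
    deriv-c : deriv c ≋ const ½
    deriv-c = mk≋ λ { 0 → refl ; 1 → refl ; (suc (suc i)) → refl }

  -- Both sides evolve by the same operator, `Op ν` minus multiplication by x (1 - x): on the left
  -- the subtracted term undoes the derivative of 1 + x, on the right it turns ν x² + x + (1 - x²)
  -- into ν x² + 1.
  X*M : ∀ n → (nat 1 +ₚ X) *ₚ t (suc n) ≋ X *ₚ M (suc n)
  X*M zero    = *ₚ-comm (nat 1 +ₚ X) X
  X*M (suc n) = begin
    (nat 1 +ₚ X) *ₚ t (suc (suc n))
      ≈⟨ *ₚ-congʳ (nat 1 +ₚ X) (t-suc (suc n)) ⟩
    (nat 1 +ₚ X) *ₚ Op ν u
      ≈⟨ solve 4 (λ ν X u u′ → (con 1ℚ :+ X) :*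
             ((ν :* X :* X :+ X) :* u :+ X :* (con 1ℚ :- X :* X) :* u′) :=
           (ν :* X :* X :+ X) :* ((con 1ℚ :+ X) :* u)
           :+ X :* (con 1ℚ :- X :* X) :* (con 1ℚ :* u :+ (con 1ℚ :+ X) :* u′)
           :- X :* (con 1ℚ :- X) :* ((con 1ℚ :+ X) :* u))
           ≋-refl (const ν) X u (deriv u) ⟩
    l *ₚ ((nat 1 +ₚ X) *ₚ u) +ₚ m *ₚ (nat 1 *ₚ u +ₚ (nat 1 +ₚ X) *ₚ deriv u)
      -ₚ m′ *ₚ ((nat 1 +ₚ X) *ₚ u)
      ≈⟨ +ₚ-cong (+ₚ-cong (*ₚ-congʳ l (X*M n)) (*ₚ-congʳ m E′))
                 (-ₚ-cong (*ₚ-congʳ m′ (X*M n))) ⟩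
    l *ₚ (X *ₚ v) +ₚ m *ₚ (nat 1 *ₚ v +ₚ X *ₚ deriv v) -ₚ m′ *ₚ (X *ₚ v)
      ≈⟨ solve 4 (λ ν X v v′ → (ν :* X :* X :+ X) :* (X :* v)
           :+ X :* (con 1ℚ :- X :* X) :* (con 1ℚ :* v :+ X :* v′)
           :- X :* (con 1ℚ :- X) :* (X :* v) :=
           X :* ((ν :* (X :* X) :+ con 1ℚ) :* v :+ X :* (con 1ℚ :- X :* X) :* v′))
           ≋-refl (const ν) X v (deriv v) ⟩
    X *ₚ M (suc (suc n)) ∎
    where
    ν = natℚ (suc n)
    u = t (suc n)
    v = M (suc n)
    l = const ν *ₚ X *ₚ X +ₚ X
    m = X *ₚ (nat 1 -ₚ X *ₚ X)
    m′ = X *ₚ (nat 1 -ₚ X)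
    E′ : nat 1 *ₚ u +ₚ (nat 1 +ₚ X) *ₚ deriv u ≋ nat 1 *ₚ v +ₚ X *ₚ deriv v
    E′ = begin
      nat 1 *ₚ u +ₚ (nat 1 +ₚ X) *ₚ deriv u
        ≈⟨ +ₚ-cong {q = (nat 1 +ₚ X) *ₚ deriv u} (*ₚ-cong {q = u} deriv-1+X ≋-refl) ≋-refl ⟨
      deriv (nat 1 +ₚ X) *ₚ u +ₚ (nat 1 +ₚ X) *ₚ deriv u ≈⟨ deriv-*ₚ (nat 1 +ₚ X) u ⟨
      deriv ((nat 1 +ₚ X) *ₚ u) ≈⟨ deriv-cong (X*M n) ⟩
      deriv (X *ₚ v) ≈⟨ deriv-*ₚ X v ⟩
      deriv X *ₚ v +ₚ X *ₚ deriv v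
        ≈⟨ +ₚ-cong {q = X *ₚ deriv v} (*ₚ-cong {q = v} deriv-X ≋-refl) ≋-refl ⟩
      nat 1 *ₚ v +ₚ X *ₚ deriv v ∎

-- The action of `Op` on paired factors

2ℚ : ℚ
2ℚ = 1ℚ ℚ.+ 1ℚ

pair : ℚ → Poly
pair a = (nat 1 +ₚ X) *ₚ (X +ₚ const a)

-- The polynomial 2 x² `pair a` + x (1 - x²) (`pair a`)′ in factored form; the 2 is the degree of
-- `pair a`.
κ : ℚ → Poly
κ a = const (1ℚ ℚ.+ a) *ₚ X *ₚ ((nat 1 +ₚ X) *ₚ (nat 1 +ₚ X))

module _ where
  open ℚ[x]-Solver
  open ≋-Reasoning

  deriv-pair : ∀ a → deriv (pair a) ≋ nat 1 *ₚ (X +ₚ const a) +ₚ (nat 1 +ₚ X) *ₚ nat 1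
  deriv-pair a = begin
    deriv (pair a) ≈⟨ deriv-*ₚ (nat 1 +ₚ X) (X +ₚ const a) ⟩
    deriv (nat 1 +ₚ X) *ₚ (X +ₚ const a) +ₚ (nat 1 +ₚ X) *ₚ deriv (X +ₚ const a)
      ≈⟨ +ₚ-cong (*ₚ-cong {q = X +ₚ const a} deriv-1+X ≋-refl)
                 (*ₚ-congʳ (nat 1 +ₚ X) deriv-X+a) ⟩
    nat 1 *ₚ (X +ₚ const a) +ₚ (nat 1 +ₚ X) *ₚ nat 1 ∎
    where
    deriv-X+a : deriv (X +ₚ const a) ≋ nat 1
    deriv-X+a = mk≋ λ { 0 → refl ; 1 → refl ; (suc (suc i)) → refl }

  -- Dividing by (1 + x) `pair a` p shows the increment of H, since `κ a` / ((1 + x) `pair a`) = (1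
  -- + a) x / (x + a).
  Op-pair : ∀ ν a p →
    Op (1ℚ ℚ.+ (1ℚ ℚ.+ ν)) (pair a *ₚ p) ≋ pair a *ₚ Op ν p +ₚ κ a *ₚ p
  Op-pair ν a p = begin
    Op (1ℚ ℚ.+ (1ℚ ℚ.+ ν)) (pair a *ₚ p)
      ≈⟨ Op-*ₚ (1ℚ ℚ.+ (1ℚ ℚ.+ ν)) (pair a) p ⟩
    pair a *ₚ Op (1ℚ ℚ.+ (1ℚ ℚ.+ ν)) p +ₚ m *ₚ (deriv (pair a) *ₚ p)
      ≈⟨ +ₚ-cong (≋-refl {pair a *ₚ Op (1ℚ ℚ.+ (1ℚ ℚ.+ ν)) p})
           (*ₚ-congʳ m (*ₚ-cong {q = p} (deriv-pair a) ≋-refl)) ⟩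
    pair a *ₚ Op (1ℚ ℚ.+ (1ℚ ℚ.+ ν)) p
      +ₚ m *ₚ ((nat 1 *ₚ (X +ₚ const a) +ₚ (nat 1 +ₚ X) *ₚ nat 1) *ₚ p)
      ≈⟨ solve 5 (λ ν a X p d →
           (con 1ℚ :+ X) :* (X :+ a)
             :* (((con 1ℚ :+ (con 1ℚ :+ ν)) :* X :* X :+ X) :* p :+ X :* (con 1ℚ :- X :* X) :* d)
           :+ X :* (con 1ℚ :- X :* X)
             :* ((con 1ℚ :* (X :+ a) :+ (con 1ℚ :+ X) :* con 1ℚ) :* p) :=
           (con 1ℚ :+ X) :* (X :+ a)
             :* ((ν :* X :* X :+ X) :* p :+ X :* (con 1ℚ :- X :* X) :* d)
           :+ (con 1ℚ :+ a) :* X :* ((con 1ℚ :+ X) :* (con 1ℚ :+ X)) :* p)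
           ≋-refl (const ν) (const a) X p (deriv p) ⟩
    pair a *ₚ Op ν p +ₚ κ a *ₚ p ∎
    where m = X *ₚ (nat 1 -ₚ X *ₚ X)

  deriv-1+X² : deriv ((nat 1 +ₚ X) *ₚ (nat 1 +ₚ X)) ≋ const 2ℚ *ₚ (nat 1 +ₚ X)
  deriv-1+X² = mk≋ λ { 0 → refl ; 1 → refl ; 2 → refl ; (suc (suc (suc i))) → refl }

  deriv-κ : ∀ a → deriv (κ a) ≋
    (nat 1 *ₚ const (1ℚ ℚ.+ a)) *ₚ ((nat 1 +ₚ X) *ₚ (nat 1 +ₚ X))
    +ₚ const (1ℚ ℚ.+ a) *ₚ X *ₚ (const 2ℚ *ₚ (nat 1 +ₚ X))
  deriv-κ a = begin
    deriv (κ a) ≈⟨ deriv-*ₚ (const (1ℚ ℚ.+ a) *ₚ X) ((nat 1 +ₚ X) *ₚ (nat 1 +ₚ X)) ⟩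
    deriv (const (1ℚ ℚ.+ a) *ₚ X) *ₚ ((nat 1 +ₚ X) *ₚ (nat 1 +ₚ X))
    +ₚ const (1ℚ ℚ.+ a) *ₚ X *ₚ deriv ((nat 1 +ₚ X) *ₚ (nat 1 +ₚ X))
      ≈⟨ +ₚ-cong (*ₚ-cong {q = (nat 1 +ₚ X) *ₚ (nat 1 +ₚ X)} deriv-cX ≋-refl)
                 (*ₚ-congʳ (const (1ℚ ℚ.+ a) *ₚ X) deriv-1+X²) ⟩
    (nat 1 *ₚ const (1ℚ ℚ.+ a)) *ₚ ((nat 1 +ₚ X) *ₚ (nat 1 +ₚ X))
    +ₚ const (1ℚ ℚ.+ a) *ₚ X *ₚ (const 2ℚ *ₚ (nat 1 +ₚ X)) ∎
    where
    deriv-cX : deriv (const (1ℚ ℚ.+ a) *ₚ X) ≋ nat 1 *ₚ const (1ℚ ℚ.+ a)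
    deriv-cX = begin
      deriv (const (1ℚ ℚ.+ a) *ₚ X) ≈⟨ deriv-*ₚ (const (1ℚ ℚ.+ a)) X ⟩
      (0ℚ ∷ []) *ₚ X +ₚ const (1ℚ ℚ.+ a) *ₚ deriv X
        ≈⟨ +ₚ-cong (*ₚ-cong {q = X} (≋-refl {0ℚ ∷ []}) ≋-refl)
                   (*ₚ-congʳ (const (1ℚ ℚ.+ a)) deriv-X) ⟩
      (0ℚ ∷ []) *ₚ X +ₚ const (1ℚ ℚ.+ a) *ₚ nat 1
        ≈⟨ solve 2 (λ c X → con 0ℚ :* X :+ c :* con 1ℚ := con 1ℚ :* c) ≋-refl (const (1ℚ ℚ.+ a)) X ⟩
      nat 1 *ₚ const (1ℚ ℚ.+ a) ∎

  -- The logarithmic derivative of `κ a` is 1/x + 2/(1 + x), and 3 x² + x (1 - x²) (1/x + 2/(1 + x))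
  -- = 1 + 2 x.
  Op-κ : ∀ ν a p →
    Op (1ℚ ℚ.+ (1ℚ ℚ.+ (1ℚ ℚ.+ ν))) (κ a *ₚ p)
      ≋ κ a *ₚ Op ν p +ₚ κ a *ₚ ((nat 1 +ₚ (X +ₚ X)) *ₚ p)
  Op-κ ν a p = begin
    Op ν₃ (κ a *ₚ p)
      ≈⟨ Op-*ₚ ν₃ (κ a) p ⟩
    κ a *ₚ Op ν₃ p +ₚ m *ₚ (deriv (κ a) *ₚ p)
      ≈⟨ +ₚ-cong (≋-refl {κ a *ₚ Op ν₃ p})
           (*ₚ-congʳ m (*ₚ-cong {q = p} (deriv-κ a) ≋-refl)) ⟩
    κ a *ₚ Op ν₃ p
      +ₚ m *ₚ (((nat 1 *ₚ const (1ℚ ℚ.+ a)) *ₚ ((nat 1 +ₚ X) *ₚ (nat 1 +ₚ X))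
                +ₚ const (1ℚ ℚ.+ a) *ₚ X *ₚ (const 2ℚ *ₚ (nat 1 +ₚ X))) *ₚ p)
      ≈⟨ solve 5 (λ ν a X p d →
           (con 1ℚ :+ a) :* X :* ((con 1ℚ :+ X) :* (con 1ℚ :+ X))
             :* (((con 1ℚ :+ (con 1ℚ :+ (con 1ℚ :+ ν))) :* X :* X :+ X) :* p
                 :+ X :* (con 1ℚ :- X :* X) :* d)
           :+ X :* (con 1ℚ :- X :* X)
             :* (((con 1ℚ :* (con 1ℚ :+ a)) :* ((con 1ℚ :+ X) :* (con 1ℚ :+ X))
                  :+ (con 1ℚ :+ a) :* X :* (con 2ℚ :* (con 1ℚ :+ X))) :* p) :=
           (con 1ℚ :+ a) :* X :* ((con 1ℚ :+ X) :* (con 1ℚ :+ X))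
             :* ((ν :* X :* X :+ X) :* p :+ X :* (con 1ℚ :- X :* X) :* d)
           :+ (con 1ℚ :+ a) :* X :* ((con 1ℚ :+ X) :* (con 1ℚ :+ X))
             :* ((con 1ℚ :+ (X :+ X)) :* p))
           ≋-refl (const ν) (const a) X p (deriv p) ⟩
    κ a *ₚ Op ν p +ₚ κ a *ₚ ((nat 1 +ₚ (X +ₚ X)) *ₚ p) ∎
    where
    m = X *ₚ (nat 1 -ₚ X *ₚ X)
    ν₃ = 1ℚ ℚ.+ (1ℚ ℚ.+ (1ℚ ℚ.+ ν))

  Op² : ℚ → Poly → Poly
  Op² ν p = Op (1ℚ ℚ.+ ν) (Op ν p)

  Op²-pair : ∀ ν a p → Op² (1ℚ ℚ.+ (1ℚ ℚ.+ ν)) (pair a *ₚ p) ≋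
    (pair a *ₚ Op² ν p +ₚ κ a *ₚ Op ν p)
    +ₚ (κ a *ₚ Op ν p +ₚ κ a *ₚ ((nat 1 +ₚ (X +ₚ X)) *ₚ p))
  Op²-pair ν a p = begin
    Op² (1ℚ ℚ.+ (1ℚ ℚ.+ ν)) (pair a *ₚ p)
      ≈⟨ Op-cong (1ℚ ℚ.+ (1ℚ ℚ.+ (1ℚ ℚ.+ ν))) (Op-pair ν a p) ⟩
    Op (1ℚ ℚ.+ (1ℚ ℚ.+ (1ℚ ℚ.+ ν))) (pair a *ₚ Op ν p +ₚ κ a *ₚ p)
      ≈⟨ Op-+ₚ (1ℚ ℚ.+ (1ℚ ℚ.+ (1ℚ ℚ.+ ν))) (pair a *ₚ Op ν p) (κ a *ₚ p) ⟩
    Op (1ℚ ℚ.+ (1ℚ ℚ.+ (1ℚ ℚ.+ ν))) (pair a *ₚ Op ν p)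
    +ₚ Op (1ℚ ℚ.+ (1ℚ ℚ.+ (1ℚ ℚ.+ ν))) (κ a *ₚ p)
      ≈⟨ +ₚ-cong (Op-pair (1ℚ ℚ.+ ν) a (Op ν p)) (Op-κ ν a p) ⟩
    (pair a *ₚ Op² ν p +ₚ κ a *ₚ Op ν p)
    +ₚ (κ a *ₚ Op ν p +ₚ κ a *ₚ ((nat 1 +ₚ (X +ₚ X)) *ₚ p)) ∎

data Parity : Set where
  even odd : Parity

base : Parity → Poly
base even = nat 1
base odd  = X

-- t n is divisible by (1 + x)^⌊n/2⌋; each of these factors is paired with another root -b.
rooted : Parity → List ℚ → Poly
rooted π []       = base π
rooted π (b ∷ bs) = pair b *ₚ rooted π bs

-- The degree of the product, built by the increments in which `Op-pair` raises ν.
index : Parity → List ℚ → ℚ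
index even []       = 0ℚ
index odd  []       = 1ℚ
index π    (b ∷ bs) = 1ℚ ℚ.+ (1ℚ ℚ.+ index π bs)

-- Without η, sums and products of variables do not unfold into coordinates.
record ℚ[i] : Set where
  no-eta-equality
  pattern
  constructor _⊹_
  field
    real imag : ℚ
open ℚ[i]

infixl 6 _+ᵢ_
infixl 7 _*ᵢ_
_+ᵢ_ _*ᵢ_ : ℚ[i] → ℚ[i] → ℚ[i]
(a ⊹ b) +ᵢ (c ⊹ d) = (a ℚ.+ c) ⊹ (b ℚ.+ d)
(a ⊹ b) *ᵢ (c ⊹ d) = (a ℚ.* c ℚ.+ ℚ.- (b ℚ.* d)) ⊹ (a ℚ.* d ℚ.+ b ℚ.* c)

-ᵢ_ conj : ℚ[i] → ℚ[i]
-ᵢ (a ⊹ b) = (ℚ.- a) ⊹ (ℚ.- b)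
conj (a ⊹ b) = a ⊹ (ℚ.- b)

ιᵢ : ℚ → ℚ[i]
ιᵢ a = a ⊹ 0ℚ

module _ where
  open +-*-Solver

  ℚ[i]-commutativeRing : CommutativeRing 0ℓ 0ℓ
  ℚ[i]-commutativeRing = record
    { Carrier = ℚ[i] ; _≈_ = _≡_ ; _+_ = _+ᵢ_ ; _*_ = _*ᵢ_ ; -_ = -ᵢ_
    ; 0# = ιᵢ 0ℚ ; 1# = ιᵢ 1ℚ
    ; isCommutativeRing = record
      { isRing = record
        { +-isAbelianGroup = record
          { isGroup = record
            { isMonoid = record
              { isSemigroup = record
                { isMagma = record { isEquivalence = isEquivalence ; ∙-cong = cong₂ _+ᵢ_ }
                ; assoc = λ { (a ⊹ b) (c ⊹ d) (e ⊹ f) → cong₂ _⊹_ (ℚ.+-assoc a c e) (ℚ.+-assoc b d f) } }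
              ; identity = (λ { (a ⊹ b) → cong₂ _⊹_ (ℚ.+-identityˡ a) (ℚ.+-identityˡ b) })
                         , (λ { (a ⊹ b) → cong₂ _⊹_ (ℚ.+-identityʳ a) (ℚ.+-identityʳ b) }) }
            ; inverse = (λ { (a ⊹ b) → cong₂ _⊹_ (ℚ.+-inverseˡ a) (ℚ.+-inverseˡ b) })
                      , (λ { (a ⊹ b) → cong₂ _⊹_ (ℚ.+-inverseʳ a) (ℚ.+-inverseʳ b) })
            ; ⁻¹-cong = cong -ᵢ_ }
          ; comm = λ { (a ⊹ b) (c ⊹ d) → cong₂ _⊹_ (ℚ.+-comm a c) (ℚ.+-comm b d) } }
        ; *-cong = cong₂ _*ᵢ_
        ; *-assoc = λ { (a ⊹ b) (c ⊹ d) (e ⊹ f) → cong₂ _⊹_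
            (solve 6 (λ a b c d e f →
              (a :* c :+ :- (b :* d)) :* e :+ :- ((a :* d :+ b :* c) :* f) :=
              a :* (c :* e :+ :- (d :* f)) :+ :- (b :* (c :* f :+ d :* e))) refl a b c d e f)
            (solve 6 (λ a b c d e f →
              (a :* c :+ :- (b :* d)) :* f :+ (a :* d :+ b :* c) :* e :=
              a :* (c :* f :+ d :* e) :+ b :* (c :* e :+ :- (d :* f))) refl a b c d e f) }
        ; *-identity =
            (λ { (a ⊹ b) → cong₂ _⊹_
              (solve 2 (λ a b → con 1ℚ :* a :+ :- (con 0ℚ :* b) := a) refl a b)
              (solve 2 (λ a b → con 1ℚ :* b :+ con 0ℚ :* a := b) refl a b) })
          , (λ { (a ⊹ b) → cong₂ _⊹_
              (solve 2 (λ a b → a :* con 1ℚ :+ :- (b :* con 0ℚ) := a) refl a b)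
              (solve 2 (λ a b → a :* con 0ℚ :+ b :* con 1ℚ := b) refl a b) })
        ; distrib =
            (λ { (a ⊹ b) (c ⊹ d) (e ⊹ f) → cong₂ _⊹_
              (solve 6 (λ a b c d e f →
                a :* (c :+ e) :+ :- (b :* (d :+ f)) :=
                (a :* c :+ :- (b :* d)) :+ (a :* e :+ :- (b :* f))) refl a b c d e f)
              (solve 6 (λ a b c d e f →
                a :* (d :+ f) :+ b :* (c :+ e) :=
                (a :* d :+ b :* c) :+ (a :* f :+ b :* e)) refl a b c d e f) })
          , (λ { (a ⊹ b) (c ⊹ d) (e ⊹ f) → cong₂ _⊹_
              (solve 6 (λ a b c d e f →
                (c :+ e) :* a :+ :- ((d :+ f) :* b) :=
                (c :* a :+ :- (d :* b)) :+ (e :* a :+ :- (f :* b))) refl a b c d e f)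
              (solve 6 (λ a b c d e f →
                (c :+ e) :* b :+ (d :+ f) :* a :=
                (c :* b :+ d :* a) :+ (e :* b :+ f :* a)) refl a b c d e f) })
        }
      ; *-comm = λ { (a ⊹ b) (c ⊹ d) → cong₂ _⊹_
          (solve 4 (λ a b c d → a :* c :+ :- (b :* d) := c :* a :+ :- (d :* b)) refl a b c d)
          (solve 4 (λ a b c d → a :* d :+ b :* c := c :* b :+ d :* a) refl a b c d) }
      }
    }

  ℚ[i]-algebra : Algebra
  ℚ[i]-algebra = record
    { ring = ℚ[i]-commutativeRing
    ; ι = ιᵢ
    ; ι-+ = λ a b → refl
    ; ι-* = λ a b → cong₂ _⊹_
        (solve 2 (λ a b → a :* b := a :* b :+ :- (con 0ℚ :* con 0ℚ)) refl a b)
        (solve 2 (λ a b → con 0ℚ := a :* con 0ℚ :+ con 0ℚ :* b) refl a b)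
    ; ι-neg = λ a → refl
    ; ι-0 = refl
    ; ι-1 = refl
    }

-- Bounds in the right half-plane

infixl 6 _⊞_
infixl 7 _⊠_
_⊞_ : ∀ {a b} → 0ℚ ℚ.≤ a → 0ℚ ℚ.≤ b → 0ℚ ℚ.≤ a ℚ.+ b
_⊞_ = ℚ.+-mono-≤ {0ℚ} {_} {0ℚ}

_⊠_ : ∀ {a b} → 0ℚ ℚ.≤ a → 0ℚ ℚ.≤ b → 0ℚ ℚ.≤ a ℚ.* b
_⊠_ {a} {b} 0≤a 0≤b = ℚ.nonNegative⁻¹ (a ℚ.* b)
  {{ℚ.nonNeg*nonNeg⇒nonNeg a {{ℚ.nonNegative 0≤a}} b {{ℚ.nonNegative 0≤b}}}}

0≤x² : ∀ a → 0ℚ ℚ.≤ a ℚ.* a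
0≤x² a with ℚ.≤-total 0ℚ a
... | inj₁ 0≤a = 0≤a ⊠ 0≤a
... | inj₂ a≤0 = subst (0ℚ ℚ.≤_) (solve 1 (λ a → :- a :* :- a := a :* a) refl a)
                   (ℚ.neg-antimono-≤ a≤0 ⊠ ℚ.neg-antimono-≤ a≤0)
  where open +-*-Solver

0≤1 : 0ℚ ℚ.≤ 1ℚ
0≤1 = from-yes (0ℚ ℚ.≤? 1ℚ)

0≤2 : 0ℚ ℚ.≤ 2ℚ
0≤2 = 0≤1 ⊞ 0≤1

≤-from-diff : ∀ {a b d} → b ≡ a ℚ.+ d → 0ℚ ℚ.≤ d → a ℚ.≤ b
≤-from-diff {a} {b} {d} b≡a+d 0≤d = subst₂ ℚ._≤_ (ℚ.+-identityʳ a) (sym b≡a+d) (ℚ.+-monoʳ-≤ a 0≤d)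

diff-nonneg : ∀ {a b} → a ℚ.≤ b → 0ℚ ℚ.≤ b ℚ.- a
diff-nonneg {a} {b} a≤b = subst (ℚ._≤ b ℚ.- a) (ℚ.+-inverseʳ a) (ℚ.+-monoˡ-≤ (ℚ.- a) a≤b)

normsq : ℚ[i] → ℚ
normsq z = real z ℚ.* real z ℚ.+ imag z ℚ.* imag z

0≤normsq : ∀ z → 0ℚ ℚ.≤ normsq z
0≤normsq z = 0≤x² (real z) ⊞ 0≤x² (imag z)

1ᵢ : ℚ[i]
1ᵢ = ιᵢ 1ℚ

module _ where
  open +-*-Solver

  *-conj : ∀ z → z *ᵢ conj z ≡ ιᵢ (normsq z)
  *-conj (a ⊹ b) = cong₂ _⊹_
    (solve 2 (λ a b → a :* a :+ :- (b :* :- b) := a :* a :+ b :* b) refl a b)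
    (solve 2 (λ a b → a :* :- b :+ b :* a := con 0ℚ) refl a b)

  conj-* : ∀ z w → conj (z *ᵢ w) ≡ conj z *ᵢ conj w
  conj-* (a ⊹ b) (c ⊹ d) = cong₂ _⊹_
    (solve 4 (λ a b c d → a :* c :+ :- (b :* d) := a :* c :+ :- (:- b :* :- d)) refl a b c d)
    (solve 4 (λ a b c d → :- (a :* d :+ b :* c) := a :* :- d :+ :- b :* c) refl a b c d)

  real-+ : ∀ z w → real (z +ᵢ w) ≡ real z ℚ.+ real w
  real-+ (a ⊹ b) (c ⊹ d) = refl

  real-ι* : ∀ r z → real (ιᵢ r *ᵢ z) ≡ r ℚ.* real z
  real-ι* r (a ⊹ b) = solve 3 (λ r a b → r :* a :+ :- (con 0ℚ :* b) := r :* a) refl r a b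

  normsq-* : ∀ z w → normsq (z *ᵢ w) ≡ normsq z ℚ.* normsq w
  normsq-* (a ⊹ b) (c ⊹ d) = solve 4 (λ a b c d →
    (a :* c :+ :- (b :* d)) :* (a :* c :+ :- (b :* d))
    :+ (a :* d :+ b :* c) :* (a :* d :+ b :* c) :=
    (a :* a :+ b :* b) :* (c :* c :+ d :* d)) refl a b c d

-- The numerator of H + (1 - x²)H′ for H = x/(x + a), whose denominator is (x + a)².
numer : ℚ → ℚ[i] → ℚ[i]
numer a x = x *ᵢ x +ᵢ ιᵢ a *ᵢ x +ᵢ ιᵢ a +ᵢ -ᵢ (ιᵢ a *ᵢ (x *ᵢ x))

module _ where
  open +-*-Solver

  -- Real and imaginary parts as formal polynomials over ℚ. The real part of a complex product can
  -- then be written as a product and is expanded by the solver.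
  ComplexPolynomial : ℕ → Set
  ComplexPolynomial k = Polynomial k × Polynomial k

  _⊗_ _⊕_ : ∀ {k} → ComplexPolynomial k → ComplexPolynomial k → ComplexPolynomial k
  (a , b) ⊗ (c , d) = (a :* c :+ :- (b :* d)) , (a :* d :+ b :* c)
  (a , b) ⊕ (c , d) = (a :+ c) , (b :+ d)

  -- Apart from the factor |x + a|⁴, this is the summand of the overview for H = x / (x + a): the
  -- conjugates replace division by (x + a)². The restriction a ≤ 1 is forced, since the leading
  -- term in Re x is (1 - a) (Re x)⁶.
  0≤core : ∀ a x → 0ℚ ℚ.≤ a → 0ℚ ℚ.≤ 1ℚ ℚ.- a → 0ℚ ℚ.≤ real x →
    0ℚ ℚ.≤ real (x *ᵢ conj (1ᵢ +ᵢ x) *ᵢ numer a x *ᵢ (conj (x +ᵢ ιᵢ a) *ᵢ conj (x +ᵢ ιᵢ a)))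
  0≤core a (p ⊹ q) a≥0 s≥0 p≥0 = subst (0ℚ ℚ.≤_) (sym identity) nonneg
    where
    s = 1ℚ ℚ.- a
    Q = q ℚ.* q
    Q≥0 = 0≤x² q
    3≥0 = 0≤1 ⊞ 0≤2
    4≥0 = 0≤2 ⊞ 0≤2
    5≥0 = 0≤2 ⊞ 3≥0
    -- The expansion in powers of p = Re x: its coefficients are nonnegative, the constant
    -- one after completing a square.
    nonneg = Q≥0 ⊠ (s≥0 ⊠ 0≤x² (Q ℚ.- a) ⊞ (a≥0 ⊠ a≥0 ⊞ a≥0 ⊠ a≥0 ⊠ a≥0) ⊠ (Q≥0 ⊞ 0≤1))
      ⊞ p≥0 ⊠ (a≥0 ⊠ a≥0 ⊠ a≥0 ⊞ (a≥0 ⊞ a≥0 ⊠ a≥0 ⊞ 4≥0 ⊠ (a≥0 ⊠ a≥0 ⊠ a≥0)) ⊠ Q≥0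
                ⊞ (0≤1 ⊞ 0≤2 ⊠ a≥0 ⊠ s≥0) ⊠ (Q≥0 ⊠ Q≥0)
      ⊞ p≥0 ⊠ (0≤2 ⊠ (a≥0 ⊠ a≥0) ⊞ 0≤2 ⊠ (a≥0 ⊠ a≥0 ⊠ a≥0)
                ⊞ (0≤2 ⊠ a≥0 ⊞ 4≥0 ⊠ (a≥0 ⊠ a≥0)) ⊠ Q≥0 ⊞ 3≥0 ⊠ s≥0 ⊠ (Q≥0 ⊠ Q≥0)
      ⊞ p≥0 ⊠ (a≥0 ⊞ 5≥0 ⊠ (a≥0 ⊠ a≥0) ⊞ (0≤2 ⊞ 4≥0 ⊠ a≥0 ⊠ s≥0) ⊠ Q≥0
      ⊞ p≥0 ⊠ (4≥0 ⊠ a≥0 ⊞ a≥0 ⊠ a≥0 ⊠ s≥0 ⊞ 3≥0 ⊠ s≥0 ⊠ Q≥0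
      ⊞ p≥0 ⊠ (0≤1 ⊞ 0≤2 ⊠ a≥0 ⊠ s≥0 ⊞ p≥0 ⊠ s≥0)))))
    identity : real ((p ⊹ q) *ᵢ conj (1ᵢ +ᵢ (p ⊹ q)) *ᵢ numer a (p ⊹ q)
                     *ᵢ (conj ((p ⊹ q) +ᵢ ιᵢ a) *ᵢ conj ((p ⊹ q) +ᵢ ιᵢ a))) ≡ _
    identity = solve 3 (λ p q a →
      let x  = p , q
          α  = a , con 0ℚ
          u  = (p :+ a) , (:- (q :+ con 0ℚ))
          xx = x ⊗ x
          axx = α ⊗ xx
          n  = ((xx ⊕ (α ⊗ x)) ⊕ α) ⊕ ((:- proj₁ axx) , (:- proj₂ axx))
          s  = con 1ℚ :- a
          Q  = q :* q
          k2 = con 1ℚ :+ con 1ℚ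
          k3 = con 1ℚ :+ k2
          k4 = k2 :+ k2
          k5 = k2 :+ k3
      in proj₁ (((x ⊗ ((con 1ℚ :+ p) , (:- (con 0ℚ :+ q)))) ⊗ n) ⊗ (u ⊗ u)) :=
         Q :* (s :* ((Q :- a) :* (Q :- a)) :+ (a :* a :+ a :* a :* a) :* (Q :+ con 1ℚ))
         :+ p :* (a :* a :* a :+ (a :+ a :* a :+ k4 :* (a :* a :* a)) :* Q
                  :+ (con 1ℚ :+ k2 :* a :* s) :* (Q :* Q)
         :+ p :* (k2 :* (a :* a) :+ k2 :* (a :* a :* a)
                  :+ (k2 :* a :+ k4 :* (a :* a)) :* Q :+ k3 :* s :* (Q :* Q)
         :+ p :* (a :+ k5 :* (a :* a) :+ (k2 :+ k4 :* a :* s) :* Q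
         :+ p :* (k4 :* a :+ a :* a :* s :+ k3 :* s :* Q
         :+ p :* (con 1ℚ :+ k2 :* a :* s :+ p :* s))))))
      refl p q a

  -- The real part is |x|² + a Re x. It gives the sign of Re (x / (x + a)).
  0≤real-x*conj : ∀ a x → 0ℚ ℚ.≤ a → 0ℚ ℚ.≤ real x → 0ℚ ℚ.≤ real (x *ᵢ conj (x +ᵢ ιᵢ a))
  0≤real-x*conj a (p ⊹ q) 0≤a 0≤p = subst (0ℚ ℚ.≤_)
    (solve 3 (λ p q a → p :* p :+ q :* q :+ p :* a :=
       p :* (p :+ a) :+ :- (q :* :- (q :+ con 0ℚ))) refl p q a)
    (0≤x² p ⊞ 0≤x² q ⊞ 0≤p ⊠ 0≤a)

open Evaluation ℚ[i]-algebra public using () renaming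
  ( ev to evᵢ; ev-cong to evᵢ-cong; ev-+ to evᵢ-+; ev-* to evᵢ-*; ev-neg to evᵢ-neg
  ; ev-const to evᵢ-const; ev-X to evᵢ-X )
module ℚ[i]-Solver = AlgebraSolver ℚ[i]-algebra

evᵢ-1+X : ∀ x → evᵢ (nat 1 +ₚ X) x ≡ 1ᵢ +ᵢ x
evᵢ-1+X x = trans (evᵢ-+ (nat 1) X x) (cong₂ _+ᵢ_ (evᵢ-const 1ℚ x) (evᵢ-X x))

pairᵢ κᵢ : ℚ → ℚ[i] → ℚ[i]
pairᵢ a x = (1ᵢ +ᵢ x) *ᵢ (x +ᵢ ιᵢ a)
κᵢ a x = ιᵢ (1ℚ ℚ.+ a) *ᵢ x *ᵢ ((1ᵢ +ᵢ x) *ᵢ (1ᵢ +ᵢ x))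

evᵢ-pair : ∀ a x → evᵢ (pair a) x ≡ pairᵢ a x
evᵢ-pair a x = trans (evᵢ-* (nat 1 +ₚ X) (X +ₚ const a) x)
  (cong₂ _*ᵢ_ (evᵢ-1+X x) (trans (evᵢ-+ X (const a) x) (cong₂ _+ᵢ_ (evᵢ-X x) (evᵢ-const a x))))

evᵢ-κ : ∀ a x → evᵢ (κ a) x ≡ κᵢ a x
evᵢ-κ a x = trans (evᵢ-* (const (1ℚ ℚ.+ a) *ₚ X) ((nat 1 +ₚ X) *ₚ (nat 1 +ₚ X)) x)
  (cong₂ _*ᵢ_
    (trans (evᵢ-* (const (1ℚ ℚ.+ a)) X x) (cong₂ _*ᵢ_ (evᵢ-const (1ℚ ℚ.+ a) x) (evᵢ-X x)))
    (trans (evᵢ-* (nat 1 +ₚ X) (nat 1 +ₚ X) x) (cong₂ _*ᵢ_ (evᵢ-1+X x) (evᵢ-1+X x))))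

-- With h = o / f, this says Re (h / (1 + x)) ≥ Re x / |1 + x|².
RatioBound : (x f o : ℚ[i]) → Set
RatioBound x f o = normsq f ℚ.* real x ℚ.≤ real (o *ᵢ conj ((1ᵢ +ᵢ x) *ᵢ f))

-- After division by |f|⁴ |1 + x|⁴ this reads Re (-τ / (f (1 + x))²) ≥ Re x / |1 + x|². For the
-- Turán expression τ of a product with value f the quotient is x / (1 + x) times H + (1 - x²) H′.
TuránBound : (x f τ : ℚ[i]) → Set
TuránBound x f τ =
  normsq (1ᵢ +ᵢ x) ℚ.* (normsq f ℚ.* normsq f) ℚ.* real x
    ℚ.≤ real (-ᵢ τ *ᵢ ((conj f *ᵢ conj f) *ᵢ (conj (1ᵢ +ᵢ x) *ᵢ conj (1ᵢ +ᵢ x))))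

ιᵢ-* : ∀ a b → ιᵢ (a ℚ.* b) ≡ ιᵢ a *ᵢ ιᵢ b
ιᵢ-* = Algebra.ι-* ℚ[i]-algebra

module _ (a : ℚ) (x f : ℚ[i]) where
  open ≡-Reasoning
  open ℚ[i]-Solver
  private
    ρ = pairᵢ a x
    s = 1ᵢ +ᵢ x
    u = x +ᵢ ιᵢ a
    c = ιᵢ (1ℚ ℚ.+ a)

  -- The additivity of H with denominators cleared: the last term is (1 + a) x / (x + a) times |s|²
  -- |ρ f|², because ρ = s u.
  ratio-pair : ∀ o →
    (ρ *ᵢ o +ᵢ κᵢ a x *ᵢ f) *ᵢ conj (s *ᵢ (ρ *ᵢ f)) ≡
    ιᵢ (normsq ρ) *ᵢ (o *ᵢ conj (s *ᵢ f))
    +ᵢ ιᵢ ((1ℚ ℚ.+ a) ℚ.* (normsq f ℚ.* (normsq s ℚ.* normsq s))) *ᵢ (x *ᵢ conj u)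
  ratio-pair o = begin
    (ρ *ᵢ o +ᵢ c *ᵢ x *ᵢ (s *ᵢ s) *ᵢ f) *ᵢ conj (s *ᵢ (ρ *ᵢ f))
      ≡⟨ cong ((ρ *ᵢ o +ᵢ c *ᵢ x *ᵢ (s *ᵢ s) *ᵢ f) *ᵢ_)
          (trans (conj-* s (ρ *ᵢ f)) (cong (conj s *ᵢ_) (conj-* ρ f))) ⟩
    (ρ *ᵢ o +ᵢ c *ᵢ x *ᵢ (s *ᵢ s) *ᵢ f) *ᵢ (conj s *ᵢ (conj ρ *ᵢ conj f))
      ≡⟨ solve 9 (λ ρ o c x s f S P F →
           (ρ :* o :+ c :* x :* (s :* s) :* f) :* (S :* (P :* F)) :=
           (ρ :* P) :* (o :* (S :* F)) :+ (c :* ((f :* F) :* ((s :* S) :* s))) :* (x :* P))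
           refl ρ o c x s f (conj s) (conj ρ) (conj f) ⟩
    (ρ *ᵢ conj ρ) *ᵢ (o *ᵢ (conj s *ᵢ conj f))
      +ᵢ (c *ᵢ ((f *ᵢ conj f) *ᵢ ((s *ᵢ conj s) *ᵢ s))) *ᵢ (x *ᵢ conj ρ)
      ≡⟨ cong₂ (λ y z → (ρ *ᵢ conj ρ) *ᵢ (o *ᵢ y)
            +ᵢ (c *ᵢ ((f *ᵢ conj f) *ᵢ ((s *ᵢ conj s) *ᵢ s))) *ᵢ (x *ᵢ z))
            (sym (conj-* s f)) (conj-* s u) ⟩
    (ρ *ᵢ conj ρ) *ᵢ (o *ᵢ conj (s *ᵢ f))
      +ᵢ (c *ᵢ ((f *ᵢ conj f) *ᵢ ((s *ᵢ conj s) *ᵢ s))) *ᵢ (x *ᵢ (conj s *ᵢ conj u))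
      ≡⟨ cong ((ρ *ᵢ conj ρ) *ᵢ (o *ᵢ conj (s *ᵢ f)) +ᵢ_) (solve 6 (λ c n s S x U →
            (c :* (n :* ((s :* S) :* s))) :* (x :* (S :* U)) :=
            (c :* (n :* ((s :* S) :* (s :* S)))) :* (x :* U))
            refl c (f *ᵢ conj f) s (conj s) x (conj u)) ⟩
    (ρ *ᵢ conj ρ) *ᵢ (o *ᵢ conj (s *ᵢ f))
      +ᵢ (c *ᵢ ((f *ᵢ conj f) *ᵢ ((s *ᵢ conj s) *ᵢ (s *ᵢ conj s)))) *ᵢ (x *ᵢ conj u)
      ≡⟨ cong₂ (λ y z → y *ᵢ (o *ᵢ conj (s *ᵢ f)) +ᵢ z *ᵢ (x *ᵢ conj u)) (*-conj ρ) weight ⟩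
    ιᵢ (normsq ρ) *ᵢ (o *ᵢ conj (s *ᵢ f))
    +ᵢ ιᵢ ((1ℚ ℚ.+ a) ℚ.* (normsq f ℚ.* (normsq s ℚ.* normsq s))) *ᵢ (x *ᵢ conj u) ∎
    where
    weight : c *ᵢ ((f *ᵢ conj f) *ᵢ ((s *ᵢ conj s) *ᵢ (s *ᵢ conj s)))
             ≡ ιᵢ ((1ℚ ℚ.+ a) ℚ.* (normsq f ℚ.* (normsq s ℚ.* normsq s)))
    weight = trans (cong₂ (λ y z → c *ᵢ (y *ᵢ (z *ᵢ z))) (*-conj f) (*-conj s))
      (trans (cong (λ y → c *ᵢ (ιᵢ (normsq f) *ᵢ y)) (sym (ιᵢ-* (normsq s) (normsq s))))
      (trans (cong (c *ᵢ_) (sym (ιᵢ-* (normsq f) (normsq s ℚ.* normsq s))))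
             (sym (ιᵢ-* (1ℚ ℚ.+ a) (normsq f ℚ.* (normsq s ℚ.* normsq s))))))

  -- The Turán expression divided by the square of the product is linear in H, so a new pair adds
  -- one term, the one of (1 + a) x / (x + a). The denominator (x + a)² cancels against ρ², leaving
  -- s² of it.
  turán-pair : ∀ o₀ o₂ →
    let O₀ = ρ *ᵢ o₀ +ᵢ κᵢ a x *ᵢ f
        O₂ = (ρ *ᵢ o₂ +ᵢ κᵢ a x *ᵢ o₀) +ᵢ (κᵢ a x *ᵢ o₀ +ᵢ κᵢ a x *ᵢ ((1ᵢ +ᵢ (x +ᵢ x)) *ᵢ f)) in
    -ᵢ (O₀ *ᵢ O₀ +ᵢ -ᵢ (O₂ *ᵢ (ρ *ᵢ f))) ≡
    (ρ *ᵢ ρ) *ᵢ -ᵢ (o₀ *ᵢ o₀ +ᵢ -ᵢ (o₂ *ᵢ f))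
    +ᵢ c *ᵢ (x *ᵢ (s *ᵢ (s *ᵢ s))) *ᵢ numer a x *ᵢ (f *ᵢ f)
  turán-pair o₀ o₂ = solve 5 (λ a x f o₀ o₂ →
    let s = con 1ℚ :+ x
        ρ = s :* (x :+ a)
        k = (con 1ℚ :+ a) :* x :* (s :* s)
        O₀ = ρ :* o₀ :+ k :* f
        O₂ = (ρ :* o₂ :+ k :* o₀) :+ (k :* o₀ :+ k :* ((con 1ℚ :+ (x :+ x)) :* f)) in
    :- (O₀ :* O₀ :+ :- (O₂ :* (ρ :* f))) :=
    (ρ :* ρ) :* :- (o₀ :* o₀ :+ :- (o₂ :* f))
    :+ (con 1ℚ :+ a) :* (x :* (s :* (s :* s)))
       :* (x :* x :+ a :* x :+ a :+ :- (a :* (x :* x))) :* (f :* f))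
    refl (ιᵢ a) x f o₀ o₂

  -- Multiplication by the conjugates turns both terms into a nonnegative rational weight times a
  -- quantity of known sign: the old bound and the expression of `0≤core`.
  turánBound-pair : ∀ τ →
    ((ρ *ᵢ ρ) *ᵢ -ᵢ τ +ᵢ c *ᵢ (x *ᵢ (s *ᵢ (s *ᵢ s))) *ᵢ numer a x *ᵢ (f *ᵢ f))
      *ᵢ ((conj (ρ *ᵢ f) *ᵢ conj (ρ *ᵢ f)) *ᵢ (conj s *ᵢ conj s)) ≡
    ιᵢ (normsq ρ ℚ.* normsq ρ) *ᵢ (-ᵢ τ *ᵢ ((conj f *ᵢ conj f) *ᵢ (conj s *ᵢ conj s)))
    +ᵢ ιᵢ ((1ℚ ℚ.+ a) ℚ.* ((normsq f ℚ.* normsq f) ℚ.* (normsq s ℚ.* (normsq s ℚ.* normsq s))))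
       *ᵢ (x *ᵢ conj s *ᵢ numer a x *ᵢ (conj u *ᵢ conj u))
  turánBound-pair τ = begin
    ((ρ *ᵢ ρ) *ᵢ -ᵢ τ +ᵢ c *ᵢ (x *ᵢ (s *ᵢ (s *ᵢ s))) *ᵢ n *ᵢ (f *ᵢ f))
      *ᵢ ((conj (ρ *ᵢ f) *ᵢ conj (ρ *ᵢ f)) *ᵢ (conj s *ᵢ conj s))
      ≡⟨ cong (λ y → ((ρ *ᵢ ρ) *ᵢ -ᵢ τ +ᵢ c *ᵢ (x *ᵢ (s *ᵢ (s *ᵢ s))) *ᵢ n *ᵢ (f *ᵢ f))
                       *ᵢ ((y *ᵢ y) *ᵢ (conj s *ᵢ conj s))) (conj-* ρ f) ⟩
    ((ρ *ᵢ ρ) *ᵢ -ᵢ τ +ᵢ c *ᵢ (x *ᵢ (s *ᵢ (s *ᵢ s))) *ᵢ n *ᵢ (f *ᵢ f))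
      *ᵢ ((conj ρ *ᵢ conj f *ᵢ (conj ρ *ᵢ conj f)) *ᵢ (conj s *ᵢ conj s))
      ≡⟨ solve 10 (λ ρ P τ c x s S n f F →
           ((ρ :* ρ) :* τ :+ c :* (x :* (s :* (s :* s))) :* n :* (f :* f))
             :* ((P :* F :* (P :* F)) :* (S :* S)) :=
           ((ρ :* P) :* (ρ :* P)) :* (τ :* ((F :* F) :* (S :* S)))
           :+ (c :* (((f :* F) :* (f :* F)) :* (s :* ((s :* S) :* (s :* S)))))
              :* (x :* n :* (P :* P)))
           refl ρ (conj ρ) (-ᵢ τ) c x s (conj s) n f (conj f) ⟩
    ((ρ *ᵢ conj ρ) *ᵢ (ρ *ᵢ conj ρ)) *ᵢ B
    +ᵢ (c *ᵢ (((f *ᵢ conj f) *ᵢ (f *ᵢ conj f)) *ᵢ (s *ᵢ ((s *ᵢ conj s) *ᵢ (s *ᵢ conj s)))))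
       *ᵢ (x *ᵢ n *ᵢ (conj ρ *ᵢ conj ρ))
      ≡⟨ cong (λ y → ((ρ *ᵢ conj ρ) *ᵢ (ρ *ᵢ conj ρ)) *ᵢ B
         +ᵢ (c *ᵢ (((f *ᵢ conj f) *ᵢ (f *ᵢ conj f)) *ᵢ (s *ᵢ ((s *ᵢ conj s) *ᵢ (s *ᵢ conj s)))))
            *ᵢ (x *ᵢ n *ᵢ (y *ᵢ y))) (conj-* s u) ⟩
    ((ρ *ᵢ conj ρ) *ᵢ (ρ *ᵢ conj ρ)) *ᵢ B
    +ᵢ (c *ᵢ (((f *ᵢ conj f) *ᵢ (f *ᵢ conj f)) *ᵢ (s *ᵢ ((s *ᵢ conj s) *ᵢ (s *ᵢ conj s)))))
       *ᵢ (x *ᵢ n *ᵢ (conj s *ᵢ conj u *ᵢ (conj s *ᵢ conj u)))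
      ≡⟨ cong (((ρ *ᵢ conj ρ) *ᵢ (ρ *ᵢ conj ρ)) *ᵢ B +ᵢ_) (solve 7 (λ c m s S x n U →
           (c :* (m :* (s :* ((s :* S) :* (s :* S))))) :* (x :* n :* (S :* U :* (S :* U))) :=
           (c :* (m :* ((s :* S) :* ((s :* S) :* (s :* S))))) :* (x :* S :* n :* (U :* U)))
           refl c ((f *ᵢ conj f) *ᵢ (f *ᵢ conj f)) s (conj s) x n (conj u)) ⟩
    ((ρ *ᵢ conj ρ) *ᵢ (ρ *ᵢ conj ρ)) *ᵢ B
    +ᵢ (c *ᵢ (((f *ᵢ conj f) *ᵢ (f *ᵢ conj f))
              *ᵢ ((s *ᵢ conj s) *ᵢ ((s *ᵢ conj s) *ᵢ (s *ᵢ conj s))))) *ᵢ A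
      ≡⟨ cong₂ (λ y z → y *ᵢ B +ᵢ z *ᵢ A)
           (trans (cong (λ y → y *ᵢ y) (*-conj ρ)) (sym (ιᵢ-* (normsq ρ) (normsq ρ)))) weight ⟩
    ιᵢ (normsq ρ ℚ.* normsq ρ) *ᵢ B
    +ᵢ ιᵢ ((1ℚ ℚ.+ a) ℚ.* ((normsq f ℚ.* normsq f) ℚ.* (normsq s ℚ.* (normsq s ℚ.* normsq s)))) *ᵢ A ∎
    where
    n = numer a x
    A = x *ᵢ conj s *ᵢ n *ᵢ (conj u *ᵢ conj u)
    B = -ᵢ τ *ᵢ ((conj f *ᵢ conj f) *ᵢ (conj s *ᵢ conj s))
    weight : c *ᵢ (((f *ᵢ conj f) *ᵢ (f *ᵢ conj f))
              *ᵢ ((s *ᵢ conj s) *ᵢ ((s *ᵢ conj s) *ᵢ (s *ᵢ conj s))))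
             ≡ ιᵢ ((1ℚ ℚ.+ a) ℚ.* ((normsq f ℚ.* normsq f)
                                   ℚ.* (normsq s ℚ.* (normsq s ℚ.* normsq s))))
    weight = trans (cong₂ (λ y z → c *ᵢ ((y *ᵢ y) *ᵢ (z *ᵢ (z *ᵢ z)))) (*-conj f) (*-conj s))
      (trans (cong₂ (λ y z → c *ᵢ (y *ᵢ (ιᵢ (normsq s) *ᵢ z)))
               (sym (ιᵢ-* (normsq f) (normsq f))) (sym (ιᵢ-* (normsq s) (normsq s))))
      (trans (cong (λ y → c *ᵢ (ιᵢ (normsq f ℚ.* normsq f) *ᵢ y))
               (sym (ιᵢ-* (normsq s) (normsq s ℚ.* normsq s))))
      (trans (cong (c *ᵢ_) (sym (ιᵢ-* (normsq f ℚ.* normsq f) (normsq s ℚ.* (normsq s ℚ.* normsq s)))))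
             (sym (ιᵢ-* (1ℚ ℚ.+ a) ((normsq f ℚ.* normsq f) ℚ.* (normsq s ℚ.* (normsq s ℚ.* normsq s))))))))

module _ (a : ℚ) (x f : ℚ[i]) (0≤a : 0ℚ ℚ.≤ a) (0≤x : 0ℚ ℚ.≤ real x) where
  open ℚ.≤-Reasoning
  private
    ρ = pairᵢ a x
    s = 1ᵢ +ᵢ x

  ratioBound-step : ∀ o → RatioBound x f o → RatioBound x (ρ *ᵢ f) (ρ *ᵢ o +ᵢ κᵢ a x *ᵢ f)
  ratioBound-step o hyp = begin
    normsq (ρ *ᵢ f) ℚ.* real x ≡⟨ cong (ℚ._* real x) (normsq-* ρ f) ⟩
    normsq ρ ℚ.* normsq f ℚ.* real x ≡⟨ ℚ.*-assoc (normsq ρ) (normsq f) (real x) ⟩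
    normsq ρ ℚ.* (normsq f ℚ.* real x)
      ≤⟨ ℚ.*-monoˡ-≤-nonNeg (normsq ρ) {{ℚ.nonNegative (0≤normsq ρ)}} hyp ⟩
    normsq ρ ℚ.* real A
      ≤⟨ ≤-from-diff refl ((0≤1 ⊞ 0≤a) ⊠ (0≤normsq f ⊠ (0≤normsq s ⊠ 0≤normsq s))
                           ⊠ 0≤real-x*conj a x 0≤a 0≤x) ⟩
    normsq ρ ℚ.* real A ℚ.+ w ℚ.* real B
      ≡⟨ cong₂ ℚ._+_ (real-ι* (normsq ρ) A) (real-ι* w B) ⟨
    real (ιᵢ (normsq ρ) *ᵢ A) ℚ.+ real (ιᵢ w *ᵢ B) ≡⟨ real-+ (ιᵢ (normsq ρ) *ᵢ A) (ιᵢ w *ᵢ B) ⟨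
    real (ιᵢ (normsq ρ) *ᵢ A +ᵢ ιᵢ w *ᵢ B) ≡⟨ cong real (ratio-pair a x f o) ⟨
    real ((ρ *ᵢ o +ᵢ κᵢ a x *ᵢ f) *ᵢ conj (s *ᵢ (ρ *ᵢ f))) ∎
    where
    A = o *ᵢ conj (s *ᵢ f)
    B = x *ᵢ conj (x +ᵢ ιᵢ a)
    w = (1ℚ ℚ.+ a) ℚ.* (normsq f ℚ.* (normsq s ℚ.* normsq s))

  turánBound-step : ∀ o₀ o₂ → 0ℚ ℚ.≤ 1ℚ ℚ.- a →
    TuránBound x f (o₀ *ᵢ o₀ +ᵢ -ᵢ (o₂ *ᵢ f)) →
    let O₀ = ρ *ᵢ o₀ +ᵢ κᵢ a x *ᵢ f
        O₂ = (ρ *ᵢ o₂ +ᵢ κᵢ a x *ᵢ o₀) +ᵢ (κᵢ a x *ᵢ o₀ +ᵢ κᵢ a x *ᵢ ((1ᵢ +ᵢ (x +ᵢ x)) *ᵢ f)) in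
    TuránBound x (ρ *ᵢ f) (O₀ *ᵢ O₀ +ᵢ -ᵢ (O₂ *ᵢ (ρ *ᵢ f)))
  turánBound-step o₀ o₂ a≤1 hyp = begin
    normsq s ℚ.* (normsq (ρ *ᵢ f) ℚ.* normsq (ρ *ᵢ f)) ℚ.* real x
      ≡⟨ cong (λ y → normsq s ℚ.* (y ℚ.* y) ℚ.* real x) (normsq-* ρ f) ⟩
    normsq s ℚ.* (normsq ρ ℚ.* normsq f ℚ.* (normsq ρ ℚ.* normsq f)) ℚ.* real x
      ≡⟨ solve 4 (λ s r f x → s :* (r :* f :* (r :* f)) :* x := (r :* r) :* (s :* (f :* f) :* x))
           refl (normsq s) (normsq ρ) (normsq f) (real x) ⟩
    r ℚ.* (normsq s ℚ.* (normsq f ℚ.* normsq f) ℚ.* real x)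
      ≤⟨ ℚ.*-monoˡ-≤-nonNeg r {{ℚ.nonNegative (0≤normsq ρ ⊠ 0≤normsq ρ)}} hyp ⟩
    r ℚ.* real B
      ≤⟨ ≤-from-diff refl ((0≤1 ⊞ 0≤a) ⊠ ((0≤normsq f ⊠ 0≤normsq f)
           ⊠ (0≤normsq s ⊠ (0≤normsq s ⊠ 0≤normsq s))) ⊠ 0≤core a x 0≤a a≤1 0≤x) ⟩
    r ℚ.* real B ℚ.+ w ℚ.* real A
      ≡⟨ cong₂ ℚ._+_ (real-ι* r B) (real-ι* w A) ⟨
    real (ιᵢ r *ᵢ B) ℚ.+ real (ιᵢ w *ᵢ A) ≡⟨ real-+ (ιᵢ r *ᵢ B) (ιᵢ w *ᵢ A) ⟨
    real (ιᵢ r *ᵢ B +ᵢ ιᵢ w *ᵢ A)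
      ≡⟨ cong real (trans
           (cong (_*ᵢ ((conj (ρ *ᵢ f) *ᵢ conj (ρ *ᵢ f)) *ᵢ (conj s *ᵢ conj s))) (turán-pair a x f o₀ o₂))
           (turánBound-pair a x f (o₀ *ᵢ o₀ +ᵢ -ᵢ (o₂ *ᵢ f)))) ⟨
    real (-ᵢ (O₀ *ᵢ O₀ +ᵢ -ᵢ (O₂ *ᵢ (ρ *ᵢ f)))
      *ᵢ ((conj (ρ *ᵢ f) *ᵢ conj (ρ *ᵢ f)) *ᵢ (conj s *ᵢ conj s))) ∎
    where
    open +-*-Solver
    O₀ = ρ *ᵢ o₀ +ᵢ κᵢ a x *ᵢ f
    O₂ = (ρ *ᵢ o₂ +ᵢ κᵢ a x *ᵢ o₀) +ᵢ (κᵢ a x *ᵢ o₀ +ᵢ κᵢ a x *ᵢ ((1ᵢ +ᵢ (x +ᵢ x)) *ᵢ f))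
    r = normsq ρ ℚ.* normsq ρ
    w = (1ℚ ℚ.+ a) ℚ.* ((normsq f ℚ.* normsq f) ℚ.* (normsq s ℚ.* (normsq s ℚ.* normsq s)))
    A = x *ᵢ conj s *ᵢ numer a x *ᵢ (conj (x +ᵢ ιᵢ a) *ᵢ conj (x +ᵢ ιᵢ a))
    B = -ᵢ (o₀ *ᵢ o₀ +ᵢ -ᵢ (o₂ *ᵢ f)) *ᵢ ((conj f *ᵢ conj f) *ᵢ (conj s *ᵢ conj s))

module _ where
  open +-*-Solver

  -- The even starting product, with H = x / (1 + x); the slack is |x|².
  ratioBound-1 : ∀ x → RatioBound x 1ᵢ x
  ratioBound-1 (p ⊹ q) = ≤-from-diff
    (solve 2 (λ p q →
      let x = p , q ; i = con 1ℚ , con 0ℚ ; y = (i ⊕ x) ⊗ i in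
      proj₁ (x ⊗ (proj₁ y , :- proj₂ y)) :=
      (con 1ℚ :* con 1ℚ :+ con 0ℚ :* con 0ℚ) :* p :+ (p :* p :+ q :* q)) refl p q)
    (0≤normsq (p ⊹ q))

  ratioBound-X : ∀ x → 0ℚ ℚ.≤ real x → RatioBound x x (x +ᵢ x *ᵢ x)
  ratioBound-X (p ⊹ q) 0≤p = ≤-from-diff
    (solve 2 (λ p q →
      let x = p , q ; i = con 1ℚ , con 0ℚ ; y = (i ⊕ x) ⊗ x in
      proj₁ ((x ⊕ (x ⊗ x)) ⊗ (proj₁ y , :- proj₂ y)) :=
      (p :* p :+ q :* q) :* p
      :+ (p :* p :+ q :* q) :* (con 1ℚ :+ p :+ (p :* p :+ q :* q))) refl p q)
    (0≤normsq (p ⊹ q) ⊠ (0≤1 ⊞ 0≤p ⊞ 0≤normsq (p ⊹ q)))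

  -- Here -τ = x, and the slack is 2 (Im x)².
  turánBound-1 : ∀ x → TuránBound x 1ᵢ (x *ᵢ x +ᵢ -ᵢ ((x +ᵢ x *ᵢ x) *ᵢ 1ᵢ))
  turánBound-1 (p ⊹ q) = ≤-from-diff
    (solve 2 (λ p q →
      let x = p , q ; i = con 1ℚ , con 0ℚ ; s = i ⊕ x ; S = proj₁ s , :- proj₂ s
          I = con 1ℚ , :- con 0ℚ
          w = (x ⊕ (x ⊗ x)) ⊗ i
          τ = (x ⊗ x) ⊕ ((:- proj₁ w) , (:- proj₂ w))
          n = con 1ℚ :* con 1ℚ :+ con 0ℚ :* con 0ℚ in
      proj₁ (((:- proj₁ τ) , (:- proj₂ τ)) ⊗ ((I ⊗ I) ⊗ (S ⊗ S))) :=
      (proj₁ s :* proj₁ s :+ proj₂ s :* proj₂ s) :* (n :* n) :* p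
      :+ (con 1ℚ :+ con 1ℚ) :* (q :* q)) refl p q)
    (0≤2 ⊠ 0≤x² q)

  -- Here H = 1, so -τ = x³ (1 + x), and the slack is |1 + x|² |x|⁶. The cubic is the value of
  -- `Op² 1ℚ X`.
  turánBound-X : ∀ x → 0ℚ ℚ.≤ real x → TuránBound x x
    ((x +ᵢ x *ᵢ x) *ᵢ (x +ᵢ x *ᵢ x)
     +ᵢ -ᵢ ((x +ᵢ (ιᵢ 2ℚ +ᵢ 1ᵢ) *ᵢ (x *ᵢ x) +ᵢ ιᵢ 2ℚ *ᵢ (x *ᵢ (x *ᵢ x))) *ᵢ x))
  turánBound-X (p ⊹ q) 0≤p = ≤-from-diff
    (solve 2 (λ p q →
      let x = p , q ; i = con 1ℚ , con 0ℚ ; s = i ⊕ x ; S = proj₁ s , :- proj₂ s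
          c2 = con 2ℚ , con 0ℚ
          Y = p , :- q
          o = x ⊕ (x ⊗ x)
          w = ((x ⊕ ((c2 ⊕ i) ⊗ (x ⊗ x))) ⊕ (c2 ⊗ (x ⊗ (x ⊗ x)))) ⊗ x
          τ = (o ⊗ o) ⊕ ((:- proj₁ w) , (:- proj₂ w))
          n = p :* p :+ q :* q
          m = proj₁ s :* proj₁ s :+ proj₂ s :* proj₂ s in
      proj₁ (((:- proj₁ τ) , (:- proj₂ τ)) ⊗ ((Y ⊗ Y) ⊗ (S ⊗ S))) :=
      m :* (n :* n) :* p :+ m :* (n :* n) :* n) refl p q)
    (0≤normsq (1ᵢ +ᵢ (p ⊹ q)) ⊠ (0≤normsq (p ⊹ q) ⊠ 0≤normsq (p ⊹ q)) ⊠ 0≤normsq (p ⊹ q))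

evᵢ-nat1 : ∀ x → evᵢ (nat 1) x ≡ 1ᵢ
evᵢ-nat1 = evᵢ-const 1ℚ

Op-even-base : Op 0ℚ (nat 1) ≋ X
Op-even-base = ≋-sym (t-suc 0)

Op-X : Op 1ℚ X ≋ X +ₚ X *ₚ X
Op-X = mk≋ λ { 0 → refl ; 1 → refl ; 2 → refl ; 3 → refl ; 4 → refl
             ; (suc (suc (suc (suc (suc i))))) → refl }

Op²-X : Op² 1ℚ X ≋ X +ₚ const (2ℚ ℚ.+ 1ℚ) *ₚ (X *ₚ X) +ₚ const 2ℚ *ₚ (X *ₚ (X *ₚ X))
Op²-X = ≋-trans (Op-cong 2ℚ Op-X) (mk≋ λ
  { 0 → refl ; 1 → refl ; 2 → refl ; 3 → refl ; 4 → refl ; 5 → refl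
  ; (suc (suc (suc (suc (suc (suc i)))))) → refl })

evᵢ-X*X : ∀ x → evᵢ (X *ₚ X) x ≡ x *ᵢ x
evᵢ-X*X x = trans (evᵢ-* X X x) (cong₂ _*ᵢ_ (evᵢ-X x) (evᵢ-X x))

evᵢ-Op-X : ∀ x → evᵢ (Op 1ℚ X) x ≡ x +ᵢ x *ᵢ x
evᵢ-Op-X x = trans (evᵢ-cong Op-X x)
  (trans (evᵢ-+ X (X *ₚ X) x) (cong₂ _+ᵢ_ (evᵢ-X x) (evᵢ-X*X x)))

evᵢ-Op²-X : ∀ x → evᵢ (Op² 1ℚ X) x ≡
  x +ᵢ (ιᵢ 2ℚ +ᵢ 1ᵢ) *ᵢ (x *ᵢ x) +ᵢ ιᵢ 2ℚ *ᵢ (x *ᵢ (x *ᵢ x))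
evᵢ-Op²-X x = trans (evᵢ-cong Op²-X x)
  (trans (evᵢ-+ (X +ₚ const (2ℚ ℚ.+ 1ℚ) *ₚ (X *ₚ X)) (const 2ℚ *ₚ (X *ₚ (X *ₚ X))) x)
  (cong₂ _+ᵢ_
    (trans (evᵢ-+ X (const (2ℚ ℚ.+ 1ℚ) *ₚ (X *ₚ X)) x)
      (cong₂ _+ᵢ_ (evᵢ-X x) (trans (evᵢ-* (const (2ℚ ℚ.+ 1ℚ)) (X *ₚ X) x)
        (cong₂ _*ᵢ_ (evᵢ-const (2ℚ ℚ.+ 1ℚ) x) (evᵢ-X*X x)))))
    (trans (evᵢ-* (const 2ℚ) (X *ₚ (X *ₚ X)) x)
      (cong₂ _*ᵢ_ (evᵢ-const 2ℚ x) (trans (evᵢ-* X (X *ₚ X) x) (cong₂ _*ᵢ_ (evᵢ-X x) (evᵢ-X*X x)))))))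

turánOf : ℚ → Poly → ℚ[i] → ℚ[i]
turánOf ν p x =
  evᵢ (Op ν p) x *ᵢ evᵢ (Op ν p) x +ᵢ -ᵢ (evᵢ (Op² ν p) x *ᵢ evᵢ p x)

InUnit : ℚ → Set
InUnit b = (0ℚ ℚ.≤ b) × (0ℚ ℚ.≤ 1ℚ ℚ.- b)

index-∷ : ∀ π b bs → index π (b ∷ bs) ≡ 1ℚ ℚ.+ (1ℚ ℚ.+ index π bs)
index-∷ even b bs = refl
index-∷ odd  b bs = refl

module _ (x : ℚ[i]) (0≤x : 0ℚ ℚ.≤ real x) where
  private
    evᵢ-pair* : ∀ b p → evᵢ (pair b *ₚ p) x ≡ pairᵢ b x *ᵢ evᵢ p x
    evᵢ-pair* b p = trans (evᵢ-* (pair b) p x) (cong (_*ᵢ evᵢ p x) (evᵢ-pair b x))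

    evᵢ-κ* : ∀ b p → evᵢ (κ b *ₚ p) x ≡ κᵢ b x *ᵢ evᵢ p x
    evᵢ-κ* b p = trans (evᵢ-* (κ b) p x) (cong (_*ᵢ evᵢ p x) (evᵢ-κ b x))

    evᵢ-Op-pair : ∀ ν b p → evᵢ (Op (1ℚ ℚ.+ (1ℚ ℚ.+ ν)) (pair b *ₚ p)) x ≡
      pairᵢ b x *ᵢ evᵢ (Op ν p) x +ᵢ κᵢ b x *ᵢ evᵢ p x
    evᵢ-Op-pair ν b p = trans (evᵢ-cong (Op-pair ν b p) x)
      (trans (evᵢ-+ (pair b *ₚ Op ν p) (κ b *ₚ p) x)
             (cong₂ _+ᵢ_ (evᵢ-pair* b (Op ν p)) (evᵢ-κ* b p)))

    evᵢ-Op²-pair : ∀ ν b p → evᵢ (Op² (1ℚ ℚ.+ (1ℚ ℚ.+ ν)) (pair b *ₚ p)) x ≡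
      (pairᵢ b x *ᵢ evᵢ (Op² ν p) x +ᵢ κᵢ b x *ᵢ evᵢ (Op ν p) x)
      +ᵢ (κᵢ b x *ᵢ evᵢ (Op ν p) x +ᵢ κᵢ b x *ᵢ ((1ᵢ +ᵢ (x +ᵢ x)) *ᵢ evᵢ p x))
    evᵢ-Op²-pair ν b p = trans (evᵢ-cong (Op²-pair ν b p) x)
      (trans (evᵢ-+ (pair b *ₚ Op² ν p +ₚ κ b *ₚ Op ν p) _ x)
      (cong₂ _+ᵢ_
        (trans (evᵢ-+ (pair b *ₚ Op² ν p) (κ b *ₚ Op ν p) x)
               (cong₂ _+ᵢ_ (evᵢ-pair* b (Op² ν p)) (evᵢ-κ* b (Op ν p))))
        (trans (evᵢ-+ (κ b *ₚ Op ν p) (κ b *ₚ ((nat 1 +ₚ (X +ₚ X)) *ₚ p)) x)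
               (cong₂ _+ᵢ_ (evᵢ-κ* b (Op ν p))
                 (trans (evᵢ-κ* b ((nat 1 +ₚ (X +ₚ X)) *ₚ p))
                   (cong (κᵢ b x *ᵢ_) (trans (evᵢ-* (nat 1 +ₚ (X +ₚ X)) p x)
                     (cong (_*ᵢ evᵢ p x) (trans (evᵢ-+ (nat 1) (X +ₚ X) x)
                       (cong₂ _+ᵢ_ (evᵢ-nat1 x)
                         (trans (evᵢ-+ X X x) (cong₂ _+ᵢ_ (evᵢ-X x) (evᵢ-X x)))))))))))))

  ratioBound-rooted : ∀ π bs → All InUnit bs →
    RatioBound x (evᵢ (rooted π bs) x) (evᵢ (Op (index π bs) (rooted π bs)) x)
  ratioBound-rooted even [] [] = subst₂ (RatioBound x) (sym (evᵢ-nat1 x))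
    (sym (trans (evᵢ-cong Op-even-base x) (evᵢ-X x))) (ratioBound-1 x)
  ratioBound-rooted odd [] [] = subst₂ (RatioBound x) (sym (evᵢ-X x))
    (sym (evᵢ-Op-X x)) (ratioBound-X x 0≤x)
  ratioBound-rooted π (b ∷ bs) ((0≤b , b≤1) ∷ hs) = subst₂ (RatioBound x)
    (sym (evᵢ-pair* b (rooted π bs)))
    (sym (trans (cong (λ ν → evᵢ (Op ν (pair b *ₚ rooted π bs)) x) (index-∷ π b bs))
                (evᵢ-Op-pair (index π bs) b (rooted π bs))))
    (ratioBound-step b x _ 0≤b 0≤x _ (ratioBound-rooted π bs hs))

  turánBound-rooted : ∀ π bs → All InUnit bs →
    TuránBound x (evᵢ (rooted π bs) x) (turánOf (index π bs) (rooted π bs) x)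
  turánBound-rooted even [] [] = subst₂ (TuránBound x) (sym f) (sym
    (cong₂ (λ y z → y *ᵢ y +ᵢ -ᵢ z) (trans (evᵢ-cong Op-even-base x) (evᵢ-X x))
      (cong₂ _*ᵢ_ (trans (evᵢ-cong (Op-cong 1ℚ Op-even-base) x) (evᵢ-Op-X x)) f)))
    (turánBound-1 x)
    where f = evᵢ-nat1 x
  turánBound-rooted odd [] [] = subst₂ (TuránBound x) (sym (evᵢ-X x)) (sym
    (cong₂ (λ y z → y *ᵢ y +ᵢ -ᵢ z) (evᵢ-Op-X x) (cong₂ _*ᵢ_ (evᵢ-Op²-X x) (evᵢ-X x))))
    (turánBound-X x 0≤x)
  turánBound-rooted π (b ∷ bs) ((0≤b , b≤1) ∷ hs) = subst₂ (TuránBound x)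
    (sym (evᵢ-pair* b (rooted π bs)))
    (sym (trans (cong (λ ν → turánOf ν (pair b *ₚ rooted π bs) x) (index-∷ π b bs))
      (cong₂ (λ y z → y *ᵢ y +ᵢ -ᵢ z) (evᵢ-Op-pair (index π bs) b (rooted π bs))
        (cong₂ _*ᵢ_ (evᵢ-Op²-pair (index π bs) b (rooted π bs)) (evᵢ-pair* b (rooted π bs))))))
    (turánBound-step b x _ 0≤b 0≤x _ _ b≤1 (turánBound-rooted π bs hs))

-- Sizes of polynomials and bisection

*-monoˡ : ∀ {a b c} → 0ℚ ℚ.≤ c → a ℚ.≤ b → c ℚ.* a ℚ.≤ c ℚ.* b
*-monoˡ {c = c} 0≤c = ℚ.*-monoˡ-≤-nonNeg c {{ℚ.nonNegative 0≤c}}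

*-monoʳ : ∀ {a b c} → 0ℚ ℚ.≤ c → a ℚ.≤ b → a ℚ.* c ℚ.≤ b ℚ.* c
*-monoʳ {c = c} 0≤c = ℚ.*-monoʳ-≤-nonNeg c {{ℚ.nonNegative 0≤c}}

*-pos : ∀ {a b} → 0ℚ ℚ.< a → 0ℚ ℚ.< b → 0ℚ ℚ.< a ℚ.* b
*-pos {a} {b} 0<a 0<b =
  ℚ.positive⁻¹ (a ℚ.* b) {{ℚ.pos*pos⇒pos a {{ℚ.positive 0<a}} b {{ℚ.positive 0<b}}}}

diff-pos : ∀ {a b} → a ℚ.< b → 0ℚ ℚ.< b ℚ.- a
diff-pos {a} {b} a<b = subst (ℚ._< b ℚ.- a) (ℚ.+-inverseʳ a) (ℚ.+-monoˡ-< (ℚ.- a) a<b)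

diff-neg : ∀ {a b} → a ℚ.< b → a ℚ.- b ℚ.< 0ℚ
diff-neg {a} {b} a<b = subst (a ℚ.- b ℚ.<_) (ℚ.+-inverseʳ b) (ℚ.+-monoˡ-< (ℚ.- b) a<b)

<-from-diff : ∀ {a b d} → b ≡ a ℚ.+ d → 0ℚ ℚ.< d → a ℚ.< b
<-from-diff {a} {b} {d} b≡a+d 0<d = subst₂ ℚ._<_ (ℚ.+-identityʳ a) (sym b≡a+d) (ℚ.+-monoʳ-< a 0<d)

0<1 : 0ℚ ℚ.< 1ℚ
0<1 = from-yes (0ℚ ℚ.<? 1ℚ)

0≤½ : 0ℚ ℚ.≤ ½
0≤½ = from-yes (0ℚ ℚ.≤? ½)

natℚ-upper : ∀ r → ∃[ k ] r ℚ.≤ natℚ (suc k)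
natℚ-upper r = k , ℚ.toℚᵘ-cancel-≤
  (ℚᵘ.≤-respʳ-≃ (ℚᵘ.≃-sym (ℚ.toℚᵘ-fromℚᵘ (ℚᵘ.mkℚᵘ (+ suc k) 0))) (ℚᵘ.*≤* (bound r)))
  where
  k = ℤ.∣ ℚ.↥ r ∣
  bound : ∀ r → ℚᵘ.↥ (ℚ.toℚᵘ r) ℤ.* + 1 ℤ.≤ + suc ℤ.∣ ℚ.↥ r ∣ ℤ.* ℚᵘ.↧ (ℚ.toℚᵘ r)
  bound (mkℚ (+ m) d _) = subst (ℤ._≤ + suc m ℤ.* + suc d) (sym (ℤ.*-identityʳ (+ m)))
    (ℤ.+≤+ (ℕ.≤-trans (ℕ.n≤1+n m) (ℕ.m≤m*n (suc m) (suc d))))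
  bound (mkℚ -[1+ m ] d _) = ℤ.-≤+

0≤natℚ : ∀ n → 0ℚ ℚ.≤ natℚ n
0≤natℚ zero    = ℚ.≤-refl
0≤natℚ (suc n) = subst (0ℚ ℚ.≤_) (sym (natℚ-suc n)) (0≤1 ⊞ 0≤natℚ n)

archimedean : ∀ A ε → 0ℚ ℚ.< ε → ∃[ k ] A ℚ.≤ ε ℚ.* natℚ (suc k)
archimedean A ε 0<ε = proj₁ up , (begin
  A ≡⟨ ℚ.*-identityˡ A ⟨
  1ℚ ℚ.* A ≡⟨ cong (ℚ._* A) (ℚ.*-inverseʳ ε) ⟨
  ε ℚ.* ℚ.1/ ε ℚ.* A ≡⟨ ℚ.*-assoc ε (ℚ.1/ ε) A ⟩
  ε ℚ.* (ℚ.1/ ε ℚ.* A) ≤⟨ *-monoˡ (ℚ.<⇒≤ 0<ε) (proj₂ up) ⟩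
  ε ℚ.* natℚ (suc (proj₁ up)) ∎)
  where
  open ℚ.≤-Reasoning
  instance
    ε≢0 = ℚ.pos⇒nonZero ε {{ℚ.positive 0<ε}}
  up = natℚ-upper (ℚ.1/ ε ℚ.* A)

½^ : ℕ → ℚ
½^ zero    = 1ℚ
½^ (suc k) = ½ ℚ.* ½^ k

0<½^ : ∀ k → 0ℚ ℚ.< ½^ k
0<½^ zero    = 0<1
0<½^ (suc k) = half-pos (0<½^ k)

-- This is k + 1 ≤ 2^k; combined with `archimedean` it shows that bisection converges.
½^-bound : ∀ k → ½^ k ℚ.* natℚ (suc k) ℚ.≤ 1ℚ
½^-bound zero    = ℚ.≤-refl
½^-bound (suc k) = ℚ.≤-trans (≤-from-diff identity
    (0≤½ ⊠ (ℚ.<⇒≤ (0<½^ k) ⊠ 0≤natℚ k))) (½^-bound k)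
  where
  open +-*-Solver
  identity : ½^ k ℚ.* natℚ (suc k)
    ≡ ½^ (suc k) ℚ.* natℚ (suc (suc k)) ℚ.+ ½ ℚ.* (½^ k ℚ.* natℚ k)
  identity = trans (cong (½^ k ℚ.*_) (natℚ-suc k)) (trans
    (solve 2 (λ d n → d :* (con 1ℚ :+ n) :=
      con ½ :* d :* (con 1ℚ :+ (con 1ℚ :+ n)) :+ con ½ :* (d :* n)) refl (½^ k) (natℚ k))
    (sym (cong (λ m → ½ ℚ.* ½^ k ℚ.* m ℚ.+ ½ ℚ.* (½^ k ℚ.* natℚ k))
      (trans (natℚ-suc (suc k)) (cong (1ℚ ℚ.+_) (natℚ-suc k))))))

½^-small : ∀ {A ε} → 0ℚ ℚ.≤ A → 0ℚ ℚ.< ε → ∃[ k ] A ℚ.* ½^ k ℚ.≤ ε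
½^-small {A} {ε} 0≤A 0<ε = let k , A≤ = archimedean A ε 0<ε in k , (begin
  A ℚ.* ½^ k ≤⟨ *-monoʳ (ℚ.<⇒≤ (0<½^ k)) A≤ ⟩
  ε ℚ.* natℚ (suc k) ℚ.* ½^ k ≡⟨ ℚ.*-assoc ε (natℚ (suc k)) (½^ k) ⟩
  ε ℚ.* (natℚ (suc k) ℚ.* ½^ k) ≡⟨ cong (ε ℚ.*_) (ℚ.*-comm (natℚ (suc k)) (½^ k)) ⟩
  ε ℚ.* (½^ k ℚ.* natℚ (suc k)) ≤⟨ *-monoˡ (ℚ.<⇒≤ 0<ε) (½^-bound k) ⟩
  ε ℚ.* 1ℚ ≡⟨ ℚ.*-identityʳ ε ⟩
  ε ∎)
  where open ℚ.≤-Reasoning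

-- A may be 0, so the division is by 1 + A.
scale-down : ∀ A {ε} → 0ℚ ℚ.≤ A → 0ℚ ℚ.< ε → ∃[ δ ] (0ℚ ℚ.< δ) × (A ℚ.* δ ℚ.≤ ε)
scale-down A {ε} 0≤A 0<ε = let δ , 0<δ , eq = shrink (1ℚ ℚ.+ A) ε (ℚ.+-mono-<-≤ {0ℚ} {1ℚ} {0ℚ} 0<1 0≤A) 0<ε in
  δ , 0<δ , ℚ.≤-trans
    (≤-from-diff (solve 2 (λ A δ → (con 1ℚ :+ A) :* δ := A :* δ :+ δ) refl A δ) (ℚ.<⇒≤ 0<δ))
    (ℚ.≤-reflexive eq)
  where open +-*-Solver

-- A weighted ℓ¹ norm of the coefficients: submultiplicative, and a bound for the values at points
-- of size at most r. Errors are measured by it, since it works at rational and Gaussian points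
-- alike.
normAt : ℚ → Poly → ℚ
normAt r []      = 0ℚ
normAt r (a ∷ p) = ∣ a ∣ ℚ.+ r ℚ.* normAt r p

module _ {r : ℚ} (0≤r : 0ℚ ℚ.≤ r) where
  open ℚ.≤-Reasoning
  open +-*-Solver hiding (Op)

  0≤normAt : ∀ p → 0ℚ ℚ.≤ normAt r p
  0≤normAt []      = ℚ.≤-refl
  0≤normAt (a ∷ p) = ℚ.0≤∣p∣ a ⊞ 0≤r ⊠ 0≤normAt p

  normAt-+ : ∀ p q → normAt r (p +ₚ q) ℚ.≤ normAt r p ℚ.+ normAt r q
  normAt-+ []      q       = ℚ.≤-reflexive (sym (ℚ.+-identityˡ (normAt r q)))
  normAt-+ (a ∷ p) []      = ℚ.≤-reflexive (sym (ℚ.+-identityʳ _))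
  normAt-+ (a ∷ p) (b ∷ q) = begin
    ∣ a ℚ.+ b ∣ ℚ.+ r ℚ.* normAt r (p +ₚ q)
      ≤⟨ ℚ.+-mono-≤ (ℚ.∣p+q∣≤∣p∣+∣q∣ a b) (*-monoˡ 0≤r (normAt-+ p q)) ⟩
    (∣ a ∣ ℚ.+ ∣ b ∣) ℚ.+ r ℚ.* (normAt r p ℚ.+ normAt r q)
      ≡⟨ solve 5 (λ a b r p q → (a :+ b) :+ r :* (p :+ q) := (a :+ r :* p) :+ (b :+ r :* q))
           refl (∣ a ∣) (∣ b ∣) r (normAt r p) (normAt r q) ⟩
    normAt r (a ∷ p) ℚ.+ normAt r (b ∷ q) ∎

  normAt-scale : ∀ c p → normAt r (map (c ℚ.*_) p) ≡ ∣ c ∣ ℚ.* normAt r p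
  normAt-scale c []      = sym (ℚ.*-zeroʳ ∣ c ∣)
  normAt-scale c (a ∷ p) = trans
    (cong₂ (λ x y → x ℚ.+ r ℚ.* y) (ℚ.∣p*q∣≡∣p∣*∣q∣ c a) (normAt-scale c p))
    (solve 4 (λ c a r n → c :* a :+ r :* (c :* n) := c :* (a :+ r :* n)) refl (∣ c ∣) (∣ a ∣) r (normAt r p))

  normAt-0∷ : ∀ p → normAt r (0ℚ ∷ p) ≡ r ℚ.* normAt r p
  normAt-0∷ p = ℚ.+-identityˡ _

  normAt-* : ∀ p q → normAt r (p *ₚ q) ℚ.≤ normAt r p ℚ.* normAt r q
  normAt-* []      q = ℚ.≤-reflexive (sym (ℚ.*-zeroˡ (normAt r q)))
  normAt-* (a ∷ p) q = begin
    normAt r (map (a ℚ.*_) q +ₚ (0ℚ ∷ p *ₚ q))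
      ≤⟨ normAt-+ (map (a ℚ.*_) q) (0ℚ ∷ p *ₚ q) ⟩
    normAt r (map (a ℚ.*_) q) ℚ.+ normAt r (0ℚ ∷ p *ₚ q)
      ≡⟨ cong₂ ℚ._+_ (normAt-scale a q) (normAt-0∷ (p *ₚ q)) ⟩
    ∣ a ∣ ℚ.* normAt r q ℚ.+ r ℚ.* normAt r (p *ₚ q)
      ≤⟨ ℚ.+-monoʳ-≤ (∣ a ∣ ℚ.* normAt r q) (*-monoˡ 0≤r (normAt-* p q)) ⟩
    ∣ a ∣ ℚ.* normAt r q ℚ.+ r ℚ.* (normAt r p ℚ.* normAt r q)
      ≡⟨ solve 4 (λ a r p q → a :* q :+ r :* (p :* q) := (a :+ r :* p) :* q)
           refl ∣ a ∣ r (normAt r p) (normAt r q) ⟩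
    normAt r (a ∷ p) ℚ.* normAt r q ∎

  normAt-mono : ∀ {s} → r ℚ.≤ s → ∀ p → normAt r p ℚ.≤ normAt s p
  normAt-mono {s} r≤s []      = ℚ.≤-refl
  normAt-mono {s} r≤s (a ∷ p) = ℚ.+-monoʳ-≤ ∣ a ∣
    (ℚ.≤-trans (*-monoʳ (0≤normAt p) r≤s) (*-monoˡ (ℚ.≤-trans 0≤r r≤s) (normAt-mono r≤s p)))

  -- Termwise this is k r^(k-1) ≤ (1 + r)^k. The price is one unit of radius and no constant
  -- depending on the degree, which is why the approximation statements range over all radii.
  normAt-deriv : ∀ p → normAt r (deriv p) ℚ.≤ normAt (1ℚ ℚ.+ r) p
  normAt-deriv []      = ℚ.≤-refl
  normAt-deriv (a ∷ p) = begin
    normAt r (p +ₚ (0ℚ ∷ deriv p)) ≤⟨ normAt-+ p (0ℚ ∷ deriv p) ⟩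
    normAt r p ℚ.+ normAt r (0ℚ ∷ deriv p)
      ≡⟨ cong (normAt r p ℚ.+_) (normAt-0∷ (deriv p)) ⟩
    normAt r p ℚ.+ r ℚ.* normAt r (deriv p)
      ≤⟨ ℚ.+-mono-≤ (normAt-mono r≤1+r p) (*-monoˡ 0≤r (normAt-deriv p)) ⟩
    n ℚ.+ r ℚ.* n
      ≤⟨ ≤-from-diff (solve 3 (λ a r n → a :+ (con 1ℚ :+ r) :* n := (n :+ r :* n) :+ a) refl ∣ a ∣ r n)
           (ℚ.0≤∣p∣ a) ⟩
    ∣ a ∣ ℚ.+ (1ℚ ℚ.+ r) ℚ.* n ∎
    where
    n = normAt (1ℚ ℚ.+ r) p
    r≤1+r : r ℚ.≤ 1ℚ ℚ.+ r
    r≤1+r = ≤-from-diff (ℚ.+-comm 1ℚ r) 0≤1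

  opNorm : ℚ → ℚ
  opNorm ν = normAt r (const ν *ₚ X *ₚ X +ₚ X) ℚ.+ normAt r (X *ₚ (nat 1 -ₚ X *ₚ X))

  0≤opNorm : ∀ ν → 0ℚ ℚ.≤ opNorm ν
  0≤opNorm ν = 0≤normAt (const ν *ₚ X *ₚ X +ₚ X) ⊞ 0≤normAt (X *ₚ (nat 1 -ₚ X *ₚ X))

  normAt-Op : ∀ ν p → normAt r (Op ν p) ℚ.≤ opNorm ν ℚ.* normAt (1ℚ ℚ.+ r) p
  normAt-Op ν p = begin
    normAt r (l *ₚ p +ₚ m *ₚ deriv p) ≤⟨ normAt-+ (l *ₚ p) (m *ₚ deriv p) ⟩
    normAt r (l *ₚ p) ℚ.+ normAt r (m *ₚ deriv p)
      ≤⟨ ℚ.+-mono-≤ (normAt-* l p) (normAt-* m (deriv p)) ⟩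
    normAt r l ℚ.* normAt r p ℚ.+ normAt r m ℚ.* normAt r (deriv p)
      ≤⟨ ℚ.+-mono-≤ (*-monoˡ (0≤normAt l) (normAt-mono (≤-from-diff (ℚ.+-comm 1ℚ r) 0≤1) p))
                    (*-monoˡ (0≤normAt m) (normAt-deriv p)) ⟩
    normAt r l ℚ.* n ℚ.+ normAt r m ℚ.* n ≡⟨ ℚ.*-distribʳ-+ n (normAt r l) (normAt r m) ⟨
    opNorm ν ℚ.* n ∎
    where
    l = const ν *ₚ X *ₚ X +ₚ X
    m = X *ₚ (nat 1 -ₚ X *ₚ X)
    n = normAt (1ℚ ℚ.+ r) p

open Evaluation ℚ-algebra public using () renaming
  ( ev to evℚ; ev-cong to evℚ-cong; ev-+ to evℚ-+; ev-* to evℚ-*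
  ; ev-const to evℚ-const; ev-X to evℚ-X )

module _ {r : ℚ} (0≤r : 0ℚ ℚ.≤ r) where
  open ℚ.≤-Reasoning
  open +-*-Solver

  ∣evℚ∣≤ : ∀ p {u} → ∣ u ∣ ℚ.≤ r → ∣ evℚ p u ∣ ℚ.≤ normAt r p
  ∣evℚ∣≤ []      ∣u∣≤r = ℚ.≤-refl
  ∣evℚ∣≤ (a ∷ p) {u} ∣u∣≤r = begin
    ∣ a ℚ.+ u ℚ.* evℚ p u ∣ ≤⟨ ℚ.∣p+q∣≤∣p∣+∣q∣ a (u ℚ.* evℚ p u) ⟩
    ∣ a ∣ ℚ.+ ∣ u ℚ.* evℚ p u ∣ ≡⟨ cong (∣ a ∣ ℚ.+_) (ℚ.∣p*q∣≡∣p∣*∣q∣ u (evℚ p u)) ⟩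
    ∣ a ∣ ℚ.+ ∣ u ∣ ℚ.* ∣ evℚ p u ∣
      ≤⟨ ℚ.+-monoʳ-≤ ∣ a ∣ (ℚ.≤-trans (*-monoʳ (ℚ.0≤∣p∣ _) ∣u∣≤r) (*-monoˡ 0≤r (∣evℚ∣≤ p ∣u∣≤r))) ⟩
    normAt r (a ∷ p) ∎

  lipschitz : Poly → ℚ
  lipschitz []      = 0ℚ
  lipschitz (a ∷ p) = normAt r p ℚ.+ r ℚ.* lipschitz p

  0≤lipschitz : ∀ p → 0ℚ ℚ.≤ lipschitz p
  0≤lipschitz []      = ℚ.≤-refl
  0≤lipschitz (a ∷ p) = 0≤normAt 0≤r p ⊞ 0≤r ⊠ 0≤lipschitz p

  evℚ-lipschitz : ∀ p {u v} → ∣ u ∣ ℚ.≤ r → ∣ v ∣ ℚ.≤ r →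
    ∣ evℚ p u ℚ.- evℚ p v ∣ ℚ.≤ lipschitz p ℚ.* ∣ u ℚ.- v ∣
  evℚ-lipschitz []      {u} {v} hu hv = ℚ.≤-reflexive (sym (ℚ.*-zeroˡ ∣ u ℚ.- v ∣))
  evℚ-lipschitz (a ∷ p) {u} {v} hu hv = begin
    ∣ (a ℚ.+ u ℚ.* y) ℚ.- (a ℚ.+ v ℚ.* z) ∣
      ≡⟨ cong ∣_∣ (solve 5 (λ a u v y z →
           (a :+ u :* y) :- (a :+ v :* z) := (u :- v) :* y :+ v :* (y :- z)) refl a u v y z) ⟩
    ∣ (u ℚ.- v) ℚ.* y ℚ.+ v ℚ.* (y ℚ.- z) ∣
      ≤⟨ ℚ.∣p+q∣≤∣p∣+∣q∣ ((u ℚ.- v) ℚ.* y) (v ℚ.* (y ℚ.- z)) ⟩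
    ∣ (u ℚ.- v) ℚ.* y ∣ ℚ.+ ∣ v ℚ.* (y ℚ.- z) ∣
      ≡⟨ cong₂ ℚ._+_ (ℚ.∣p*q∣≡∣p∣*∣q∣ (u ℚ.- v) y) (ℚ.∣p*q∣≡∣p∣*∣q∣ v (y ℚ.- z)) ⟩
    ∣ u ℚ.- v ∣ ℚ.* ∣ y ∣ ℚ.+ ∣ v ∣ ℚ.* ∣ y ℚ.- z ∣
      ≤⟨ ℚ.+-mono-≤ (*-monoˡ (ℚ.0≤∣p∣ (u ℚ.- v)) (∣evℚ∣≤ p hu))
           (ℚ.≤-trans (*-monoʳ (ℚ.0≤∣p∣ (y ℚ.- z)) hv) (*-monoˡ 0≤r (evℚ-lipschitz p hu hv))) ⟩
    d ℚ.* normAt r p ℚ.+ r ℚ.* (lipschitz p ℚ.* d)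
      ≡⟨ solve 4 (λ d n r l → d :* n :+ r :* (l :* d) := (n :+ r :* l) :* d)
           refl d (normAt r p) r (lipschitz p) ⟩
    lipschitz (a ∷ p) ℚ.* d ∎
    where
    y = evℚ p u
    z = evℚ p v
    d = ∣ u ℚ.- v ∣

-- The ℓ¹ norm stays rational, is submultiplicative and dominates both coordinates.
abs₁ : ℚ[i] → ℚ
abs₁ z = ∣ real z ∣ ℚ.+ ∣ imag z ∣

0≤abs₁ : ∀ z → 0ℚ ℚ.≤ abs₁ z
0≤abs₁ z = ℚ.0≤∣p∣ (real z) ⊞ ℚ.0≤∣p∣ (imag z)

abs₁-ι : ∀ a → abs₁ (ιᵢ a) ≡ ∣ a ∣
abs₁-ι a = ℚ.+-identityʳ ∣ a ∣

module _ where
  open ℚ.≤-Reasoning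
  open +-*-Solver

  abs₁-+ : ∀ z w → abs₁ (z +ᵢ w) ℚ.≤ abs₁ z ℚ.+ abs₁ w
  abs₁-+ (a ⊹ b) (c ⊹ d) = begin
    ∣ a ℚ.+ c ∣ ℚ.+ ∣ b ℚ.+ d ∣ ≤⟨ ℚ.+-mono-≤ (ℚ.∣p+q∣≤∣p∣+∣q∣ a c) (ℚ.∣p+q∣≤∣p∣+∣q∣ b d) ⟩
    (∣ a ∣ ℚ.+ ∣ c ∣) ℚ.+ (∣ b ∣ ℚ.+ ∣ d ∣)
      ≡⟨ solve 4 (λ a b c d → (a :+ c) :+ (b :+ d) := (a :+ b) :+ (c :+ d)) refl (∣ a ∣) (∣ b ∣) (∣ c ∣) (∣ d ∣) ⟩
    (∣ a ∣ ℚ.+ ∣ b ∣) ℚ.+ (∣ c ∣ ℚ.+ ∣ d ∣) ∎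

  abs₁-* : ∀ z w → abs₁ (z *ᵢ w) ℚ.≤ abs₁ z ℚ.* abs₁ w
  abs₁-* (a ⊹ b) (c ⊹ d) = begin
    ∣ a ℚ.* c ℚ.+ ℚ.- (b ℚ.* d) ∣ ℚ.+ ∣ a ℚ.* d ℚ.+ b ℚ.* c ∣
      ≤⟨ ℚ.+-mono-≤ (ℚ.∣p+q∣≤∣p∣+∣q∣ (a ℚ.* c) (ℚ.- (b ℚ.* d))) (ℚ.∣p+q∣≤∣p∣+∣q∣ (a ℚ.* d) (b ℚ.* c)) ⟩
    (∣ a ℚ.* c ∣ ℚ.+ ∣ ℚ.- (b ℚ.* d) ∣) ℚ.+ (∣ a ℚ.* d ∣ ℚ.+ ∣ b ℚ.* c ∣)
      ≡⟨ cong₂ ℚ._+_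
          (cong₂ ℚ._+_ (ℚ.∣p*q∣≡∣p∣*∣q∣ a c) (trans (ℚ.∣-p∣≡∣p∣ (b ℚ.* d)) (ℚ.∣p*q∣≡∣p∣*∣q∣ b d)))
          (cong₂ ℚ._+_ (ℚ.∣p*q∣≡∣p∣*∣q∣ a d) (ℚ.∣p*q∣≡∣p∣*∣q∣ b c)) ⟩
    (∣ a ∣ ℚ.* ∣ c ∣ ℚ.+ ∣ b ∣ ℚ.* ∣ d ∣) ℚ.+ (∣ a ∣ ℚ.* ∣ d ∣ ℚ.+ ∣ b ∣ ℚ.* ∣ c ∣)
      ≡⟨ solve 4 (λ a b c d → (a :* c :+ b :* d) :+ (a :* d :+ b :* c) := (a :+ b) :* (c :+ d))
           refl (∣ a ∣) (∣ b ∣) (∣ c ∣) (∣ d ∣) ⟩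
    (∣ a ∣ ℚ.+ ∣ b ∣) ℚ.* (∣ c ∣ ℚ.+ ∣ d ∣) ∎

  abs₁-evᵢ : ∀ p x {r} → abs₁ x ℚ.≤ r → abs₁ (evᵢ p x) ℚ.≤ normAt r p
  abs₁-evᵢ []      x       h = ℚ.≤-refl
  abs₁-evᵢ (a ∷ p) x {r} h = begin
    abs₁ (ιᵢ a +ᵢ x *ᵢ evᵢ p x) ≤⟨ abs₁-+ (ιᵢ a) (x *ᵢ evᵢ p x) ⟩
    abs₁ (ιᵢ a) ℚ.+ abs₁ (x *ᵢ evᵢ p x) ≡⟨ cong (ℚ._+ abs₁ (x *ᵢ evᵢ p x)) (abs₁-ι a) ⟩
    ∣ a ∣ ℚ.+ abs₁ (x *ᵢ evᵢ p x) ≤⟨ ℚ.+-monoʳ-≤ ∣ a ∣ (ℚ.≤-trans (abs₁-* x (evᵢ p x))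
      (ℚ.≤-trans (*-monoʳ (0≤abs₁ (evᵢ p x)) h) (*-monoˡ (ℚ.≤-trans (0≤abs₁ x) h) (abs₁-evᵢ p x h)))) ⟩
    normAt r (a ∷ p) ∎

valueAt : Poly → ℚ → ℚ
valueAt g b = evℚ g (ℚ.- b)

module _ where
  open +-*-Solver

  -- The left end keeps a strictly positive value and the right end a nonpositive one. This
  -- asymmetry gives the remainders of the later divisions a known sign.
  bisect : ∀ k g {c h} → c ℚ.< h → 0ℚ ℚ.< valueAt g c → valueAt g h ℚ.≤ 0ℚ →
    ∃[ c′ ] ∃[ h′ ] (c ℚ.≤ c′) × (c′ ℚ.< h′) × (h′ ℚ.≤ h) × (0ℚ ℚ.< valueAt g c′)
      × (valueAt g h′ ℚ.≤ 0ℚ) × (h′ ℚ.- c′ ≡ ½^ k ℚ.* (h ℚ.- c))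
  bisect zero g {c} {h} c<h gc gh =
    c , h , ℚ.≤-refl , c<h , ℚ.≤-refl , gc , gh , sym (ℚ.*-identityˡ (h ℚ.- c))
  bisect (suc k) g {c} {h} c<h gc gh =
    let c′ , h′ , c≤c′ , c′<h′ , h′≤h , gc′ , gh′ , width = bisect k g c<h gc gh
        m   = ½ ℚ.* (c′ ℚ.+ h′)
        gap = half-pos (diff-pos c′<h′)
        c′<m : c′ ℚ.< m
        c′<m = <-from-diff (solve 2 (λ c h → con ½ :* (c :+ h) := c :+ con ½ :* (h :- c)) refl c′ h′) gap
        m<h′ : m ℚ.< h′
        m<h′ = <-from-diff (solve 2 (λ c h → h := con ½ :* (c :+ h) :+ con ½ :* (h :- c)) refl c′ h′) gap
        half-width : ½ ℚ.* (h′ ℚ.- c′) ≡ ½^ (suc k) ℚ.* (h ℚ.- c)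
        half-width = trans (cong (½ ℚ.*_) width) (sym (ℚ.*-assoc ½ (½^ k) (h ℚ.- c)))
    in case-split c≤c′ h′≤h gc′ gh′ c′<m m<h′ half-width
    where
    case-split : ∀ {c′ h′} → let m = ½ ℚ.* (c′ ℚ.+ h′) in
      c ℚ.≤ c′ → h′ ℚ.≤ h → 0ℚ ℚ.< valueAt g c′ → valueAt g h′ ℚ.≤ 0ℚ →
      c′ ℚ.< m → m ℚ.< h′ → ½ ℚ.* (h′ ℚ.- c′) ≡ ½^ (suc k) ℚ.* (h ℚ.- c) →
      ∃[ c″ ] ∃[ h″ ] (c ℚ.≤ c″) × (c″ ℚ.< h″) × (h″ ℚ.≤ h) × (0ℚ ℚ.< valueAt g c″)
        × (valueAt g h″ ℚ.≤ 0ℚ) × (h″ ℚ.- c″ ≡ ½^ (suc k) ℚ.* (h ℚ.- c))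
    case-split {c′} {h′} c≤c′ h′≤h gc′ gh′ c′<m m<h′ width
      with 0ℚ ℚ.<? valueAt g (½ ℚ.* (c′ ℚ.+ h′))
    ... | yes gm = _ , h′ , ℚ.≤-trans c≤c′ (ℚ.<⇒≤ c′<m) , m<h′ , h′≤h , gm , gh′
                 , trans (solve 2 (λ c h → h :- con ½ :* (c :+ h) := con ½ :* (h :- c)) refl c′ h′) width
    ... | no ¬gm = c′ , _ , c≤c′ , c′<m , ℚ.≤-trans (ℚ.<⇒≤ m<h′) h′≤h , gc′ , ℚ.≮⇒≥ ¬gm
                 , trans (solve 2 (λ c h → con ½ :* (c :+ h) :- c := con ½ :* (h :- c)) refl c′ h′) width

  -- The value at the right end of the final interval is at most 0, so the value at the left end is
  -- at most the Lipschitz constant on [-1, 1] times the width. The number of halvings is chosen for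
  -- that product.
  small-value : ∀ g {c h η} → 0ℚ ℚ.≤ c → c ℚ.< h → h ℚ.≤ 1ℚ → 0ℚ ℚ.< valueAt g c →
    valueAt g h ℚ.≤ 0ℚ → 0ℚ ℚ.< η →
    ∃[ b ] (c ℚ.≤ b) × (b ℚ.< h) × (0ℚ ℚ.< valueAt g b) × (valueAt g b ℚ.≤ η)
  small-value g {c} {h} {η} 0≤c c<h h≤1 gc gh 0<η =
    let L = lipschitz 0≤1 g
        0≤L = 0≤lipschitz 0≤1 g
        k , small = ½^-small (0≤L ⊠ ℚ.<⇒≤ (diff-pos c<h)) 0<η
        c′ , h′ , c≤c′ , c′<h′ , h′≤h , gc′ , gh′ , width = bisect k g c<h gc gh
        0≤c′ = ℚ.≤-trans 0≤c c≤c′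
        h′≤1 = ℚ.≤-trans h′≤h h≤1
    in c′ , c≤c′ , ℚ.<-≤-trans c′<h′ h′≤h , gc′ , (begin
      valueAt g c′
        ≤⟨ ≤-from-diff (solve 2 (λ u v → u :- v := u :+ :- v) refl (valueAt g c′) (valueAt g h′))
             (ℚ.neg-antimono-≤ gh′) ⟩
      valueAt g c′ ℚ.- valueAt g h′ ≤⟨ p≤∣p∣ _ ⟩
      ∣ valueAt g c′ ℚ.- valueAt g h′ ∣
        ≤⟨ evℚ-lipschitz 0≤1 g (∣neg∣≤1 0≤c′ (ℚ.≤-trans (ℚ.<⇒≤ c′<h′) h′≤1))
             (∣neg∣≤1 (ℚ.≤-trans 0≤c′ (ℚ.<⇒≤ c′<h′)) h′≤1) ⟩
      L ℚ.* ∣ (ℚ.- c′) ℚ.- (ℚ.- h′) ∣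
        ≡⟨ cong (λ d → L ℚ.* ∣ d ∣) (solve 2 (λ c h → (:- c) :- (:- h) := h :- c) refl c′ h′) ⟩
      L ℚ.* ∣ h′ ℚ.- c′ ∣ ≡⟨ cong (L ℚ.*_) (ℚ.0≤p⇒∣p∣≡p (ℚ.<⇒≤ (diff-pos c′<h′))) ⟩
      L ℚ.* (h′ ℚ.- c′) ≡⟨ cong (L ℚ.*_) width ⟩
      L ℚ.* (½^ k ℚ.* (h ℚ.- c))
        ≡⟨ solve 3 (λ L d w → L :* (d :* w) := L :* w :* d) refl L (½^ k) (h ℚ.- c) ⟩
      L ℚ.* (h ℚ.- c) ℚ.* ½^ k ≤⟨ small ⟩
      η ∎)
    where
    open ℚ.≤-Reasoning
    p≤∣p∣ : ∀ p → p ℚ.≤ ∣ p ∣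
    p≤∣p∣ p with ℚ.≤-total 0ℚ p
    ... | inj₁ 0≤p = ℚ.≤-reflexive (sym (ℚ.0≤p⇒∣p∣≡p 0≤p))
    ... | inj₂ p≤0 = ℚ.≤-trans p≤0 (ℚ.0≤∣p∣ p)
    ∣neg∣≤1 : ∀ {b} → 0ℚ ℚ.≤ b → b ℚ.≤ 1ℚ → ∣ ℚ.- b ∣ ℚ.≤ 1ℚ
    ∣neg∣≤1 {b} 0≤b b≤1 = subst (ℚ._≤ 1ℚ) (sym (trans (ℚ.∣-p∣≡∣p∣ b) (ℚ.0≤p⇒∣p∣≡p 0≤b))) b≤1

-- Interlacing and approximation by polynomials with rational roots

-- Synthetic division by x + b: a + x p = (x + b) p + (a - b p), and p is divided in turn.
quot : ℚ → Poly → Poly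
quot b []      = []
quot b (a ∷ p) = p +ₚ map ((ℚ.- b) ℚ.*_) (quot b p)

∷-+X : ∀ a p → (a ∷ p) ≋ const a +ₚ X *ₚ p
∷-+X a p = ≋-trans (∷-split a p) (+ₚ-cong (≋-refl {const a}) (≋-sym
  (≋-trans (0∷-*ₚ (nat 1) p) (0∷-cong (*ₚ-identityˡ p)))))

const-*ₚ : ∀ c p → const c *ₚ p ≋ map (c ℚ.*_) p
const-*ₚ c p = ≋-trans (*ₚ-comm (const c) p) (*ₚ-const p c)

quot-correct : ∀ b p → p ≋ (X +ₚ const b) *ₚ quot b p +ₚ const (valueAt p b)
quot-correct b []      = ≋-sym (≋-trans
  (+ₚ-cong (*ₚ-[] (X +ₚ const b)) 0∷[]≋[]) ≋-refl)
quot-correct b (a ∷ p) = begin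
  a ∷ p ≈⟨ ∷-+X a p ⟩
  const a +ₚ X *ₚ p
    ≈⟨ solve 4 (λ a X p b → a :+ X :* p := ((X :+ b) :* p :- b :* p) :+ a) ≋-refl (const a) X p (const b) ⟩
  ((X +ₚ const b) *ₚ p -ₚ const b *ₚ p) +ₚ const a
    ≈⟨ +ₚ-cong (+ₚ-cong (≋-refl {(X +ₚ const b) *ₚ p})
         (-ₚ-cong (*ₚ-congʳ (const b) (quot-correct b p)))) (≋-refl {const a}) ⟩
  ((X +ₚ const b) *ₚ p -ₚ const b *ₚ ((X +ₚ const b) *ₚ q +ₚ const e)) +ₚ const a
    ≈⟨ solve 6 (λ a X p b q e →
         ((X :+ b) :* p :- b :* ((X :+ b) :* q :+ e)) :+ a :=
         (X :+ b) :* (p :+ (:- b) :* q) :+ (a :+ (:- b) :* e)) ≋-refl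
         (const a) X p (const b) q (const e) ⟩
  (X +ₚ const b) *ₚ (p +ₚ const (ℚ.- b) *ₚ q) +ₚ (const a +ₚ const (ℚ.- b) *ₚ const e)
    ≈⟨ +ₚ-cong (*ₚ-congʳ (X +ₚ const b) (+ₚ-cong (≋-refl {p}) (const-*ₚ (ℚ.- b) q)))
               (+ₚ-cong (≋-refl {const a}) (const-*ₚ (ℚ.- b) (const e))) ⟩
  (X +ₚ const b) *ₚ quot b (a ∷ p) +ₚ const (valueAt (a ∷ p) b) ∎
  where
  open ℚ[x]-Solver
  open ≋-Reasoning
  q = quot b p
  e = valueAt p b

length-+ₚ : ∀ p q → length (p +ₚ q) ≡ length p ℕ.⊔ length q
length-+ₚ []      q       = refl
length-+ₚ (a ∷ p) []      = refl
length-+ₚ (a ∷ p) (b ∷ q) = cong suc (length-+ₚ p q)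

length-quot : ∀ b p → length (quot b p) ≡ ℕ.pred (length p)
length-quot b []      = refl
length-quot b (a ∷ p) = begin
  length (p +ₚ map ((ℚ.- b) ℚ.*_) (quot b p)) ≡⟨ length-+ₚ p _ ⟩
  length p ℕ.⊔ length (map ((ℚ.- b) ℚ.*_) (quot b p))
    ≡⟨ cong (length p ℕ.⊔_) (trans (length-map _ (quot b p)) (length-quot b p)) ⟩
  length p ℕ.⊔ ℕ.pred (length p) ≡⟨ ℕ.m≥n⇒m⊔n≡m ℕ.pred[n]≤n ⟩
  length p ∎
  where open ≡-Reasoning

-- A list entry b stands for the point -b.
Alternates⁺ Alternates⁻ : ℚ → Poly → List ℚ → Set
Alternates⁺ μ g []       = ⊤
Alternates⁺ μ g (b ∷ bs) = (μ ℚ.< valueAt g b) × Alternates⁻ μ g bs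
Alternates⁻ μ g []       = ⊤
Alternates⁻ μ g (b ∷ bs) = (valueAt g b ℚ.< ℚ.- μ) × Alternates⁺ μ g bs

weaken⁺ : ∀ {μ ν g} → μ ℚ.≤ ν → ∀ bs → Alternates⁺ ν g bs → Alternates⁺ μ g bs
weaken⁻ : ∀ {μ ν g} → μ ℚ.≤ ν → ∀ bs → Alternates⁻ ν g bs → Alternates⁻ μ g bs
weaken⁺ h []       _        = tt
weaken⁺ h (b ∷ bs) (gb , r) = ℚ.≤-<-trans h gb , weaken⁻ h bs r
weaken⁻ h []       _        = tt
weaken⁻ h (b ∷ bs) (gb , r) = ℚ.<-≤-trans gb (ℚ.neg-antimono-≤ h) , weaken⁺ h bs r

halve : ∀ {a} → 0ℚ ℚ.< a → ½ ℚ.* a ℚ.< a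
halve {a} 0<a = <-from-diff (sym (half+half a)) (half-pos 0<a)

min-pos : ∀ {a b} → 0ℚ ℚ.< a → 0ℚ ℚ.< b → ∃[ c ] (0ℚ ℚ.< c) × (c ℚ.≤ a) × (c ℚ.≤ b)
min-pos {a} {b} 0<a 0<b with ℚ.≤-total a b
... | inj₁ a≤b = a , 0<a , ℚ.≤-refl , a≤b
... | inj₂ b≤a = b , 0<b , b≤a , ℚ.≤-refl

neg-involutive : ∀ a → ℚ.- (ℚ.- a) ≡ a
neg-involutive = solve 1 (λ a → :- (:- a) := a) refl
  where open +-*-Solver

-- Finitely many strict inequalities have a common margin; halving each value keeps them strict. The
-- margin limits the remainder that a division may leave without destroying the alternation.
margin⁺ : ∀ {g} bs → Alternates⁺ 0ℚ g bs → ∃[ μ ] (0ℚ ℚ.< μ) × Alternates⁺ μ g bs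
margin⁻ : ∀ {g} bs → Alternates⁻ 0ℚ g bs → ∃[ μ ] (0ℚ ℚ.< μ) × Alternates⁻ μ g bs
margin⁺ []       _ = 1ℚ , 0<1 , tt
margin⁺ {g} (b ∷ bs) (gb , r) =
  let μ , 0<μ , alt = margin⁻ bs r
      ν , 0<ν , ν≤ , ν≤μ = min-pos (half-pos gb) 0<μ
  in ν , 0<ν , ℚ.≤-<-trans ν≤ (halve gb) , weaken⁻ ν≤μ bs alt
margin⁻ []       _ = 1ℚ , 0<1 , tt
margin⁻ {g} (b ∷ bs) (gb , r) =
  let μ , 0<μ , alt = margin⁺ bs r
      0<-gb = ℚ.neg-antimono-< gb
      ν , 0<ν , ν≤ , ν≤μ = min-pos (half-pos 0<-gb) 0<μ
  in ν , 0<ν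
   , subst (ℚ._< ℚ.- ν) (neg-involutive (valueAt g b)) (ℚ.neg-antimono-< (ℚ.≤-<-trans ν≤ (halve 0<-gb)))
   , weaken⁺ ν≤μ bs alt

module _ where
  open +-*-Solver

  neg*neg⇒pos : ∀ {a b} → a ℚ.< 0ℚ → b ℚ.< 0ℚ → 0ℚ ℚ.< a ℚ.* b
  neg*neg⇒pos {a} {b} a<0 b<0 = subst (0ℚ ℚ.<_)
    (solve 2 (λ a b → :- a :* :- b := a :* b) refl a b)
    (*-pos (ℚ.neg-antimono-< a<0) (ℚ.neg-antimono-< b<0))

  neg*pos⇒neg : ∀ {a b} → a ℚ.< 0ℚ → 0ℚ ℚ.< b → a ℚ.* b ℚ.< 0ℚ
  neg*pos⇒neg {a} {b} a<0 0<b = subst (ℚ._< 0ℚ)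
    (solve 2 (λ a b → :- (:- a :* b) := a :* b) refl a b)
    (ℚ.neg-antimono-< (*-pos (ℚ.neg-antimono-< a<0) 0<b))

  pos-factor : ∀ {a b} → a ℚ.< 0ℚ → a ℚ.* b ℚ.< 0ℚ → 0ℚ ℚ.< b
  pos-factor {a} {b} a<0 ab<0 with 0ℚ ℚ.<? b
  ... | yes 0<b = 0<b
  ... | no ¬0<b = contradiction
    (ℚ.<-≤-trans ab<0 (subst (0ℚ ℚ.≤_) (solve 2 (λ a b → :- a :* :- b := a :* b) refl a b)
      (ℚ.neg-antimono-≤ (ℚ.<⇒≤ a<0) ⊠ ℚ.neg-antimono-≤ (ℚ.≮⇒≥ ¬0<b)))) (ℚ.<-irrefl refl)

  neg-factor : ∀ {a b} → a ℚ.< 0ℚ → 0ℚ ℚ.< a ℚ.* b → b ℚ.< 0ℚ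
  neg-factor {a} {b} a<0 0<ab = subst (ℚ._< 0ℚ) (neg-involutive b)
    (ℚ.neg-antimono-< (pos-factor {a} {ℚ.- b} a<0
      (subst (ℚ._< 0ℚ) (solve 2 (λ a b → :- (a :* b) := a :* :- b) refl a b) (ℚ.neg-antimono-< 0<ab))))

  valueAt-X+ : ∀ c b → valueAt (X +ₚ const c) b ≡ c ℚ.- b
  valueAt-X+ c b = solve 2 (λ c b →
    (con 0ℚ :+ c) :+ (:- b) :* (con 1ℚ :+ (:- b) :* con 0ℚ) := c :- b) refl c b

  valueAt-quot : ∀ c g b → (c ℚ.- b) ℚ.* valueAt (quot c g) b ≡ valueAt g b ℚ.- valueAt g c
  valueAt-quot c g b = begin
    (c ℚ.- b) ℚ.* v ≡⟨ solve 2 (λ x e → x := (x :+ e) :- e) refl ((c ℚ.- b) ℚ.* v) e ⟩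
    ((c ℚ.- b) ℚ.* v ℚ.+ e) ℚ.- e
      ≡⟨ cong (ℚ._- e) (cong₂ (λ y z → y ℚ.* v ℚ.+ z) (valueAt-X+ c b) (evℚ-const e (ℚ.- b))) ⟨
    (valueAt (X +ₚ const c) b ℚ.* v ℚ.+ valueAt (const e) b) ℚ.- e
      ≡⟨ cong (λ y → (y ℚ.+ valueAt (const e) b) ℚ.- e) (evℚ-* (X +ₚ const c) (quot c g) (ℚ.- b)) ⟨
    (valueAt ((X +ₚ const c) *ₚ quot c g) b ℚ.+ valueAt (const e) b) ℚ.- e
      ≡⟨ cong (ℚ._- e) (evℚ-+ ((X +ₚ const c) *ₚ quot c g) (const e) (ℚ.- b)) ⟨
    valueAt ((X +ₚ const c) *ₚ quot c g +ₚ const e) b ℚ.- e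
      ≡⟨ cong (ℚ._- e) (evℚ-cong (quot-correct c g) (ℚ.- b)) ⟨
    valueAt g b ℚ.- e ∎
    where
    open ≡-Reasoning
    v = valueAt (quot c g) b
    e = valueAt g c

  module _ {μ c : ℚ} {g : Poly} (0<gc : 0ℚ ℚ.< valueAt g c) (gc≤μ : valueAt g c ℚ.≤ μ) where
    -- By `valueAt-quot` and c < b, the quotient at -b has the sign opposite to g(-b) - g(-c).
    -- Subtracting the positive remainder leaves negative values negative, and values above μ stay
    -- positive because g(-c) ≤ μ.
    alternates-quot⁻ : ∀ bs → All (c ℚ.<_) bs → Alternates⁻ μ g bs → Alternates⁺ 0ℚ (quot c g) bs
    alternates-quot⁺ : ∀ bs → All (c ℚ.<_) bs → Alternates⁺ μ g bs → Alternates⁻ 0ℚ (quot c g) bs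
    alternates-quot⁻ []       _            _        = tt
    alternates-quot⁻ (b ∷ bs) (c<b ∷ c<bs) (gb , r) =
      pos-factor (diff-neg c<b) (subst (ℚ._< 0ℚ) (sym (valueAt-quot c g b))
        (ℚ.+-mono-< {_} {0ℚ} {_} {0ℚ}
          (ℚ.<-≤-trans gb (ℚ.neg-antimono-≤ (ℚ.≤-trans (ℚ.<⇒≤ 0<gc) gc≤μ)))
          (ℚ.neg-antimono-< 0<gc)))
      , alternates-quot⁺ bs c<bs r
    alternates-quot⁺ []       _            _        = tt
    alternates-quot⁺ (b ∷ bs) (c<b ∷ c<bs) (gb , r) =
      neg-factor (diff-neg c<b) (subst (0ℚ ℚ.<_) (sym (valueAt-quot c g b))
        (diff-pos (ℚ.≤-<-trans gc≤μ gb)))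
      , alternates-quot⁻ bs c<bs r

∏ : List ℚ → Poly
∏ []       = nat 1
∏ (b ∷ bs) = (X +ₚ const b) *ₚ ∏ bs

-- Bisection may return its left endpoint; comparing values excludes this, which keeps the
-- approximate roots strictly increasing.
≤∧value<⇒< : ∀ g {b c} → b ℚ.≤ c → valueAt g c ℚ.< valueAt g b → b ℚ.< c
≤∧value<⇒< g {b} {c} b≤c gc<gb with b ℚ.<? c
... | yes b<c = b<c
... | no ¬b<c = contradiction gc<gb
  (ℚ.<-irrefl (cong (valueAt g) (ℚ.≤-antisym (ℚ.≮⇒≥ ¬b<c) b≤c)))

-- The lower bound b is recorded so that a root found below b can be prepended to `points` in order.
record NearlySplit (r η : ℚ) (b : ℚ) (k : ℕ) (g : Poly) : Set where
  field
    scale    : ℚ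
    points   : List ℚ
    error    : Poly
    equation : g ≋ const scale *ₚ ∏ points +ₚ error
    small    : normAt r error ℚ.≤ η
    count    : length points ≡ k
    sorted   : AllPairs ℚ._<_ points
    bounds   : All (λ c → (b ℚ.< c) × (c ℚ.< 1ℚ)) points

normAt-const : ∀ r a → normAt r (const a) ≡ ∣ a ∣
normAt-const r a = trans (cong (∣ a ∣ ℚ.+_) (ℚ.*-zeroʳ r)) (ℚ.+-identityʳ ∣ a ∣)

normAt-X+ : ∀ r {c} → 0ℚ ℚ.≤ c → c ℚ.≤ 1ℚ → normAt r (X +ₚ const c) ℚ.≤ 1ℚ ℚ.+ r
normAt-X+ r {c} 0≤c c≤1 = begin
  ∣ 0ℚ ℚ.+ c ∣ ℚ.+ r ℚ.* (1ℚ ℚ.+ r ℚ.* 0ℚ)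
    ≡⟨ cong₂ ℚ._+_ (trans (cong ∣_∣ (ℚ.+-identityˡ c)) (ℚ.0≤p⇒∣p∣≡p 0≤c))
                   (trans (cong (λ y → r ℚ.* (1ℚ ℚ.+ y)) (ℚ.*-zeroʳ r)) (ℚ.*-identityʳ r)) ⟩
  c ℚ.+ r ≤⟨ ℚ.+-monoˡ-≤ r c≤1 ⟩
  1ℚ ℚ.+ r ∎
  where open ℚ.≤-Reasoning

-- An approximate intermediate value theorem with deflation. Between the first two sample points
-- there is c with g(-c) positive and tiny; dividing by x + c leaves g(-c) as remainder and a
-- quotient that alternates on the remaining samples, again starting with a positive value. There
-- are as many samples as coefficients, so the sign changes exhaust the degree.
split : ∀ {r} → 0ℚ ℚ.≤ r → ∀ {η} → 0ℚ ℚ.< η → ∀ g b bs →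
  length g ≡ suc (length bs) → Alternates⁺ 0ℚ g (b ∷ bs) → AllPairs ℚ._<_ (b ∷ bs) →
  All (λ c → (0ℚ ℚ.≤ c) × (c ℚ.≤ 1ℚ)) (b ∷ bs) → NearlySplit r η b (length bs) g
-- One sample left means one coefficient: g is constant and there is no error.
split 0≤r 0<η (a ∷ []) b [] len alt inc unit = record
  { scale = a ; points = [] ; error = []
  ; equation = ∷-cong (sym (trans (ℚ.+-identityʳ _) (ℚ.*-identityʳ a))) ≋-refl
  ; small = ℚ.<⇒≤ 0<η ; count = refl ; sorted = [] ; bounds = [] }
split {r} 0≤r {η} 0<η g b (b′ ∷ bs) len alt ((b<b′ ∷ b<bs) ∷ inc) ((0≤b , _) ∷ unit) =
  let μ , 0<μ , (gb , gb′ , alt′) = margin⁺ (b ∷ b′ ∷ bs) alt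
      -- The remainder has to fit into half of the error and below the margin of the alternation.
      η₁ , 0<η₁ , η₁≤ , η₁≤μ = min-pos (half-pos 0<η) 0<μ
      -- The error of the quotient is multiplied by x + c, whose norm is at most 1 + r as c lies in
      -- [0, 1].
      η₂ , 0<η₂ , η₂≤ = scale-down (1ℚ ℚ.+ r) (0≤1 ⊞ 0≤r) (half-pos 0<η)
      b′≤1 = proj₂ (All.head unit)
      c , b≤c , c<b′ , 0<gc , gc≤η₁ = small-value g 0≤b b<b′ b′≤1 (proj₁ alt)
        (ℚ.<⇒≤ (proj₁ (proj₂ alt))) 0<η₁
      gc≤μ = ℚ.≤-trans gc≤η₁ η₁≤μ
      b<c : b ℚ.< c
      b<c = ≤∧value<⇒< g b≤c (ℚ.≤-<-trans gc≤μ gb)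
      c<bs : All (c ℚ.<_) (b′ ∷ bs)
      c<bs = c<b′ ∷ All.map (ℚ.<-trans c<b′) (AllPairs.head inc)
      rec = split 0≤r 0<η₂ (quot c g) b′ bs
        (trans (length-quot c g) (cong ℕ.pred len))
        (alternates-quot⁻ 0<gc gc≤μ (b′ ∷ bs) c<bs (gb′ , alt′)) inc unit
  in assemble c b<c c<b′ b≤c 0<gc (ℚ.≤-trans gc≤η₁ η₁≤) η₂≤ b′≤1 rec
  where
  assemble : ∀ c → b ℚ.< c → c ℚ.< b′ → b ℚ.≤ c → 0ℚ ℚ.< valueAt g c → valueAt g c ℚ.≤ ½ ℚ.* η →
    ∀ {η₂} → (1ℚ ℚ.+ r) ℚ.* η₂ ℚ.≤ ½ ℚ.* η → b′ ℚ.≤ 1ℚ →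
    NearlySplit r η₂ b′ (length bs) (quot c g) → NearlySplit r η b (suc (length bs)) g
  assemble c b<c c<b′ b≤c 0<gc gc≤ {η₂} η₂≤ b′≤1 rec = record
    { scale = scale
    ; points = c ∷ points
    ; error = (X +ₚ const c) *ₚ error +ₚ const v
    ; equation = ≋-trans (quot-correct c g) (≋-trans
        (+ₚ-cong (*ₚ-congʳ (X +ₚ const c) equation) (≋-refl {const v}))
        (solve 5 (λ l s q e v → l :* (s :* q :+ e) :+ v := s :* (l :* q) :+ (l :* e :+ v))
          ≋-refl (X +ₚ const c) (const scale) (∏ points) error (const v)))
    ; small = begin
        normAt r ((X +ₚ const c) *ₚ error +ₚ const v)
          ≤⟨ normAt-+ 0≤r ((X +ₚ const c) *ₚ error) (const v) ⟩
        normAt r ((X +ₚ const c) *ₚ error) ℚ.+ normAt r (const v)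
          ≤⟨ ℚ.+-mono-≤ (normAt-* 0≤r (X +ₚ const c) error)
               (ℚ.≤-reflexive (trans (normAt-const r v) (ℚ.0≤p⇒∣p∣≡p (ℚ.<⇒≤ 0<gc)))) ⟩
        normAt r (X +ₚ const c) ℚ.* normAt r error ℚ.+ v
          ≤⟨ ℚ.+-mono-≤
               (ℚ.≤-trans (*-monoʳ (0≤normAt 0≤r error)
                            (normAt-X+ r (ℚ.≤-trans 0≤b b≤c) (ℚ.≤-trans (ℚ.<⇒≤ c<b′) b′≤1)))
                 (ℚ.≤-trans (*-monoˡ (0≤1 ⊞ 0≤r) small) η₂≤)) gc≤ ⟩
        ½ ℚ.* η ℚ.+ ½ ℚ.* η ≡⟨ half+half η ⟩
        η ∎
    ; count = cong suc count
    ; sorted = All.map (λ (b′<d , _) → ℚ.<-trans c<b′ b′<d) bounds ∷ sorted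
    ; bounds = (b<c , ℚ.<-≤-trans c<b′ b′≤1) ∷ All.map (λ (b′<d , d<1) → ℚ.<-trans b<b′ b′<d , d<1) bounds
    }
    where
    open NearlySplit rec
    open ℚ.≤-Reasoning
    open ℚ[x]-Solver
    v = valueAt g c

-- What remains of x (1 + x) times `base π` and the powers of 1 + x once the trivial factors `outer`
-- are removed. Its zero, -1 or 0, is the extra sample point: there the summand that carries it
-- drops out.
twist : Parity → Poly
twist even = nat 1 +ₚ X
twist odd  = X

-- The factor of Op (rooted π bs) that carries the new roots.
cofactor : Parity → List ℚ → Poly
cofactor π []       = nat 1
cofactor π (b ∷ bs) =
  (X +ₚ const b) *ₚ cofactor π bs +ₚ const (1ℚ ℚ.+ b) *ₚ (twist π *ₚ ∏ bs)

[1+X]^ : ℕ → Poly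
[1+X]^ zero    = nat 1
[1+X]^ (suc k) = (nat 1 +ₚ X) *ₚ [1+X]^ k

outer : Parity → ℕ → Poly
outer even k = X *ₚ [1+X]^ k
outer odd  k = X *ₚ [1+X]^ (suc k)

module _ where
  open ℚ[x]-Solver
  open ≋-Reasoning

  rooted-∏ : ∀ π bs → rooted π bs ≋ base π *ₚ ([1+X]^ (length bs) *ₚ ∏ bs)
  rooted-∏ π []       = solve 1 (λ B → B := B :* (con 1ℚ :* con 1ℚ)) ≋-refl (base π)
  rooted-∏ π (b ∷ bs) = begin
    pair b *ₚ rooted π bs ≈⟨ *ₚ-congʳ (pair b) (rooted-∏ π bs) ⟩
    pair b *ₚ (base π *ₚ (Y *ₚ ∏ bs))
      ≈⟨ solve 5 (λ X b B Y q → (con 1ℚ :+ X) :* (X :+ b) :* (B :* (Y :* q)) :=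
           B :* ((con 1ℚ :+ X) :* Y :* ((X :+ b) :* q))) ≋-refl X (const b) (base π) Y (∏ bs) ⟩
    base π *ₚ ([1+X]^ (suc (length bs)) *ₚ ∏ (b ∷ bs)) ∎
    where Y = [1+X]^ (length bs)

  twist-outer : ∀ π k → outer π k *ₚ twist π ≋ (nat 1 +ₚ X) *ₚ X *ₚ (base π *ₚ [1+X]^ k)
  twist-outer even k = solve 2 (λ X Y → X :* Y :* (con 1ℚ :+ X) :=
    (con 1ℚ :+ X) :* X :* (con 1ℚ :* Y)) ≋-refl X ([1+X]^ k)
  twist-outer odd k = solve 2 (λ X Y → X :* ((con 1ℚ :+ X) :* Y) :* X :=
    (con 1ℚ :+ X) :* X :* (X :* Y)) ≋-refl X ([1+X]^ k)

  outer-suc : ∀ π k → outer π (suc k) ≋ (nat 1 +ₚ X) *ₚ outer π k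
  outer-suc even k = solve 2 (λ X Y → X :* ((con 1ℚ :+ X) :* Y) :=
    (con 1ℚ :+ X) :* (X :* Y)) ≋-refl X ([1+X]^ k)
  outer-suc odd k = solve 2 (λ X Y → X :* ((con 1ℚ :+ X) :* Y) :=
    (con 1ℚ :+ X) :* (X :* Y)) ≋-refl X ([1+X]^ (suc k))

  Op-rooted : ∀ π bs →
    Op (index π bs) (rooted π bs) ≋ outer π (length bs) *ₚ cofactor π bs
  Op-rooted even [] = ≋-trans Op-even-base
    (solve 1 (λ X → X := X :* con 1ℚ :* con 1ℚ) ≋-refl X)
  Op-rooted odd [] = ≋-trans Op-X
    (solve 1 (λ X → X :+ X :* X := X :* ((con 1ℚ :+ X) :* con 1ℚ) :* con 1ℚ) ≋-refl X)
  Op-rooted π (b ∷ bs) = begin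
    Op (index π (b ∷ bs)) (pair b *ₚ p)
      ≡⟨ cong (λ ν → Op ν (pair b *ₚ p)) (index-∷ π b bs) ⟩
    Op (1ℚ ℚ.+ (1ℚ ℚ.+ index π bs)) (pair b *ₚ p) ≈⟨ Op-pair (index π bs) b p ⟩
    pair b *ₚ Op (index π bs) p +ₚ κ b *ₚ p
      ≈⟨ +ₚ-cong (*ₚ-congʳ (pair b) (Op-rooted π bs)) (*ₚ-congʳ (κ b) (rooted-∏ π bs)) ⟩
    pair b *ₚ (W *ₚ cofactor π bs) +ₚ κ b *ₚ (base π *ₚ (Y *ₚ ∏ bs))
      ≈⟨ solve 7 (λ X b W G B Y q →
           (con 1ℚ :+ X) :* (X :+ b) :* (W :* G)
           :+ (con 1ℚ :+ b) :* X :* ((con 1ℚ :+ X) :* (con 1ℚ :+ X)) :* (B :* (Y :* q)) :=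
           (con 1ℚ :+ X) :* ((X :+ b) :* G) :* W
           :+ ((con 1ℚ :+ b) :* q) :* ((con 1ℚ :+ X) :* ((con 1ℚ :+ X) :* X :* (B :* Y))))
           ≋-refl X (const b) W (cofactor π bs) (base π) Y (∏ bs) ⟩
    (nat 1 +ₚ X) *ₚ ((X +ₚ const b) *ₚ cofactor π bs) *ₚ W
      +ₚ (const (1ℚ ℚ.+ b) *ₚ ∏ bs) *ₚ ((nat 1 +ₚ X) *ₚ ((nat 1 +ₚ X) *ₚ X *ₚ (base π *ₚ Y)))
      ≈⟨ +ₚ-cong (≋-refl {(nat 1 +ₚ X) *ₚ ((X +ₚ const b) *ₚ cofactor π bs) *ₚ W})
           (*ₚ-congʳ (const (1ℚ ℚ.+ b) *ₚ ∏ bs) (*ₚ-congʳ (nat 1 +ₚ X) (twist-outer π (length bs)))) ⟨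
    (nat 1 +ₚ X) *ₚ ((X +ₚ const b) *ₚ cofactor π bs) *ₚ W
      +ₚ (const (1ℚ ℚ.+ b) *ₚ ∏ bs) *ₚ ((nat 1 +ₚ X) *ₚ (W *ₚ twist π))
      ≈⟨ solve 6 (λ s G W c q Z → s :* G :* W :+ (c :* q) :* (s :* (W :* Z)) :=
           (s :* W) :* (G :+ c :* (Z :* q)))
           ≋-refl (nat 1 +ₚ X) ((X +ₚ const b) *ₚ cofactor π bs) W (const (1ℚ ℚ.+ b)) (∏ bs) (twist π) ⟩
    ((nat 1 +ₚ X) *ₚ W) *ₚ cofactor π (b ∷ bs)
      ≈⟨ *ₚ-cong {q = cofactor π (b ∷ bs)} (outer-suc π (length bs)) ≋-refl ⟨
    outer π (suc (length bs)) *ₚ cofactor π (b ∷ bs) ∎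
    where
    p = rooted π bs
    W = outer π (length bs)
    Y = [1+X]^ (length bs)

-- `split` counts list entries, so lengths are computed exactly; nothing has to be known about
-- leading coefficients.
length-linear* : ∀ a b p {k} → length p ≡ suc k → length ((a ∷ b ∷ []) *ₚ p) ≡ suc (suc k)
length-linear* a b (c ∷ p) refl = begin
  suc (length (map (a ℚ.*_) p +ₚ (map (b ℚ.*_) (c ∷ p) +ₚ (0ℚ ∷ []))))
    ≡⟨ cong suc (length-+ₚ (map (a ℚ.*_) p) _) ⟩
  suc (length (map (a ℚ.*_) p) ℕ.⊔ length (map (b ℚ.*_) (c ∷ p) +ₚ (0ℚ ∷ [])))
    ≡⟨ cong₂ (λ m n → suc (m ℕ.⊔ n)) (length-map (a ℚ.*_) p) (length-+ₚ (map (b ℚ.*_) (c ∷ p)) (0ℚ ∷ [])) ⟩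
  suc (length p ℕ.⊔ suc (length (map (b ℚ.*_) p) ℕ.⊔ 0))
    ≡⟨ cong (λ m → suc (length p ℕ.⊔ suc m)) (trans (ℕ.⊔-identityʳ _) (length-map (b ℚ.*_) p)) ⟩
  suc (length p ℕ.⊔ suc (length p)) ≡⟨ cong suc (ℕ.m≤n⇒m⊔n≡n (ℕ.n≤1+n (length p))) ⟩
  suc (suc (length p)) ∎
  where open ≡-Reasoning

length-const* : ∀ c p {k} → length p ≡ suc k → length (const c *ₚ p) ≡ suc k
length-const* c (a ∷ p) refl = cong suc (begin
  length (map (c ℚ.*_) p +ₚ []) ≡⟨ length-+ₚ (map (c ℚ.*_) p) [] ⟩
  length (map (c ℚ.*_) p) ℕ.⊔ 0 ≡⟨ ℕ.⊔-identityʳ _ ⟩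
  length (map (c ℚ.*_) p) ≡⟨ length-map (c ℚ.*_) p ⟩
  length p ∎)
  where open ≡-Reasoning

length-∏ : ∀ bs → length (∏ bs) ≡ suc (length bs)
length-∏ []       = refl
length-∏ (b ∷ bs) = length-linear* (0ℚ ℚ.+ b) 1ℚ (∏ bs) (length-∏ bs)

length-twist* : ∀ π p {k} → length p ≡ suc k → length (twist π *ₚ p) ≡ suc (suc k)
length-twist* even = length-linear* (1ℚ ℚ.+ 0ℚ) 1ℚ
length-twist* odd  = length-linear* 0ℚ 1ℚ

length-cofactor : ∀ π bs → length (cofactor π bs) ≡ suc (length bs)
length-cofactor π []       = refl
length-cofactor π (b ∷ bs) = begin
  length ((X +ₚ const b) *ₚ cofactor π bs +ₚ q) ≡⟨ length-+ₚ ((X +ₚ const b) *ₚ cofactor π bs) q ⟩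
  length ((X +ₚ const b) *ₚ cofactor π bs) ℕ.⊔ length q
    ≡⟨ cong₂ ℕ._⊔_ (length-linear* (0ℚ ℚ.+ b) 1ℚ (cofactor π bs) (length-cofactor π bs))
         (length-const* (1ℚ ℚ.+ b) (twist π *ₚ ∏ bs) (length-twist* π (∏ bs) (length-∏ bs))) ⟩
  suc (suc (length bs)) ℕ.⊔ suc (suc (length bs)) ≡⟨ ℕ.⊔-idem _ ⟩
  suc (suc (length bs)) ∎
  where
  open ≡-Reasoning
  q = const (1ℚ ℚ.+ b) *ₚ (twist π *ₚ ∏ bs)

module _ where
  open +-*-Solver

  valueAt-∏-pos : ∀ {c} bs → All (c ℚ.<_) bs → 0ℚ ℚ.< valueAt (∏ bs) c
  valueAt-∏-pos {c} []       []           = subst (0ℚ ℚ.<_) (sym (evℚ-const 1ℚ (ℚ.- c))) 0<1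
  valueAt-∏-pos {c} (b ∷ bs) (c<b ∷ c<bs) =
    subst (0ℚ ℚ.<_) (sym (trans (evℚ-* (X +ₚ const b) (∏ bs) (ℚ.- c))
      (cong (ℚ._* valueAt (∏ bs) c) (valueAt-X+ b c))))
      (*-pos (diff-pos c<b) (valueAt-∏-pos bs c<bs))

  valueAt-∏-zero : ∀ bs → All (λ c → valueAt (∏ bs) c ≡ 0ℚ) bs
  valueAt-∏-zero []       = []
  valueAt-∏-zero (b ∷ bs) =
    trans (evℚ-* (X +ₚ const b) (∏ bs) (ℚ.- b))
      (trans (cong (ℚ._* valueAt (∏ bs) b) (trans (valueAt-X+ b b) (ℚ.+-inverseʳ b)))
             (ℚ.*-zeroˡ (valueAt (∏ bs) b)))
    ∷ All.map (λ {c} e → trans (evℚ-* (X +ₚ const b) (∏ bs) (ℚ.- c))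
        (trans (cong (valueAt (X +ₚ const b) c ℚ.*_) e) (ℚ.*-zeroʳ (valueAt (X +ₚ const b) c))))
        (valueAt-∏-zero bs)

  valueAt-cofactor : ∀ π b bs c → valueAt (cofactor π (b ∷ bs)) c ≡
    (b ℚ.- c) ℚ.* valueAt (cofactor π bs) c
    ℚ.+ (1ℚ ℚ.+ b) ℚ.* (valueAt (twist π) c ℚ.* valueAt (∏ bs) c)
  valueAt-cofactor π b bs c =
    trans (evℚ-+ ((X +ₚ const b) *ₚ cofactor π bs) _ (ℚ.- c)) (cong₂ ℚ._+_
      (trans (evℚ-* (X +ₚ const b) (cofactor π bs) (ℚ.- c))
        (cong (ℚ._* valueAt (cofactor π bs) c) (valueAt-X+ b c)))
      (trans (evℚ-* (const (1ℚ ℚ.+ b)) (twist π *ₚ ∏ bs) (ℚ.- c))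
        (cong₂ ℚ._*_ (evℚ-const (1ℚ ℚ.+ b) (ℚ.- c)) (evℚ-* (twist π) (∏ bs) (ℚ.- c)))))

  valueAt-twist-even : ∀ c → valueAt (twist even) c ≡ 1ℚ ℚ.- c
  valueAt-twist-even c = solve 1 (λ c →
    con 1ℚ :+ con 0ℚ :+ (:- c) :* (con 1ℚ :+ (:- c) :* con 0ℚ) := con 1ℚ :- c) refl c

  valueAt-twist-odd : ∀ c → valueAt (twist odd) c ≡ ℚ.- c
  valueAt-twist-odd c = solve 1 (λ c →
    con 0ℚ :+ (:- c) :* (con 1ℚ :+ (:- c) :* con 0ℚ) := :- c) refl c

  valueAt-cofactor-head : ∀ π b bs → valueAt (cofactor π (b ∷ bs)) b ≡
    (1ℚ ℚ.+ b) ℚ.* (valueAt (twist π) b ℚ.* valueAt (∏ bs) b)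
  valueAt-cofactor-head π b bs = trans (valueAt-cofactor π b bs b)
    (solve 3 (λ b g y → (b :- b) :* g :+ y := y) refl b (valueAt (cofactor π bs) b) _)

  Vanishes : Parity → List ℚ → ℚ → Set
  Vanishes π bs c = valueAt (twist π) c ℚ.* valueAt (∏ bs) c ≡ 0ℚ

  -- Only the first summand of `cofactor` survives at such a point. For c > b the factor b - c is
  -- negative, so prepending b flips the sign at every later sample.
  valueAt-cofactor-tail : ∀ π b bs {c} → Vanishes π bs c →
    (b ℚ.- c) ℚ.* valueAt (cofactor π bs) c ≡ valueAt (cofactor π (b ∷ bs)) c
  valueAt-cofactor-tail π b bs {c} v = sym (trans (valueAt-cofactor π b bs c)
    (trans (cong (λ y → (b ℚ.- c) ℚ.* valueAt (cofactor π bs) c ℚ.+ (1ℚ ℚ.+ b) ℚ.* y) v)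
      (solve 2 (λ b y → y :+ (con 1ℚ :+ b) :* con 0ℚ := y) refl b _)))

  module _ (π : Parity) (b : ℚ) (bs : List ℚ) where
    alternates-cofactor⁻ : ∀ cs → All (λ c → (b ℚ.< c) × Vanishes π bs c) cs →
      Alternates⁺ 0ℚ (cofactor π bs) cs → Alternates⁻ 0ℚ (cofactor π (b ∷ bs)) cs
    alternates-cofactor⁺ : ∀ cs → All (λ c → (b ℚ.< c) × Vanishes π bs c) cs →
      Alternates⁻ 0ℚ (cofactor π bs) cs → Alternates⁺ 0ℚ (cofactor π (b ∷ bs)) cs
    alternates-cofactor⁻ []       _                _        = tt
    alternates-cofactor⁻ (c ∷ cs) ((b<c , v) ∷ hs) (gc , r) =
      subst (ℚ._< 0ℚ) (valueAt-cofactor-tail π b bs v) (neg*pos⇒neg (diff-neg b<c) gc)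
      , alternates-cofactor⁺ cs hs r
    alternates-cofactor⁺ []       _                _        = tt
    alternates-cofactor⁺ (c ∷ cs) ((b<c , v) ∷ hs) (gc , r) =
      subst (0ℚ ℚ.<_) (valueAt-cofactor-tail π b bs v) (neg*neg⇒pos (diff-neg b<c) gc)
      , alternates-cofactor⁻ cs hs r

  vanishes-∏ : ∀ π bs → All (Vanishes π bs) bs
  vanishes-∏ π bs = All.map
    (λ {c} e → trans (cong (valueAt (twist π) c ℚ.*_) e) (ℚ.*-zeroʳ (valueAt (twist π) c)))
    (valueAt-∏-zero bs)

  vanishes-1 : ∀ bs → Vanishes even bs 1ℚ
  vanishes-1 bs = trans (cong (ℚ._* valueAt (∏ bs) 1ℚ) (valueAt-twist-even 1ℚ))
    (ℚ.*-zeroˡ (valueAt (∏ bs) 1ℚ))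

  -- At the new first root b only the second summand survives, with value (1 + b)(1 - b) times a
  -- product of positive differences; behind it all signs are flipped. The root -1 of `twist even`
  -- supplies the last sample.
  alternates-even : ∀ bs → AllPairs ℚ._<_ bs → All (λ b → (0ℚ ℚ.≤ b) × (b ℚ.< 1ℚ)) bs →
    Alternates⁺ 0ℚ (cofactor even bs) (bs ++ 1ℚ ∷ [])
  alternates-even []       _            _ =
    subst (0ℚ ℚ.<_) (sym (evℚ-const 1ℚ (ℚ.- 1ℚ))) 0<1 , tt
  alternates-even (b ∷ bs) (b<bs ∷ inc) ((0≤b , b<1) ∷ hs) =
    subst (0ℚ ℚ.<_) (sym (trans (valueAt-cofactor-head even b bs)
        (cong (λ y → (1ℚ ℚ.+ b) ℚ.* (y ℚ.* valueAt (∏ bs) b)) (valueAt-twist-even b))))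
      (*-pos (ℚ.+-mono-<-≤ {0ℚ} {1ℚ} {0ℚ} 0<1 0≤b) (*-pos (diff-pos b<1) (valueAt-∏-pos bs b<bs)))
    , alternates-cofactor⁻ even b bs (bs ++ 1ℚ ∷ [])
        (All.++⁺ (All.zip (b<bs , vanishes-∏ even bs)) ((b<1 , vanishes-1 bs) ∷ []))
        (alternates-even bs inc hs)

  -- As in the even case, but `twist odd` takes the value -b at the new root, so the alternation
  -- starts negative. This needs b > 0; the missing positive sample is 0, placed in front.
  alternates-odd⁻ : ∀ bs → AllPairs ℚ._<_ bs → All (λ b → (0ℚ ℚ.< b) × (b ℚ.< 1ℚ)) bs →
    Alternates⁻ 0ℚ (cofactor odd bs) bs
  alternates-odd⁻ []       _            _ = tt
  alternates-odd⁻ (b ∷ bs) (b<bs ∷ inc) ((0<b , b<1) ∷ hs) =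
    subst (ℚ._< 0ℚ) (sym (trans (valueAt-cofactor-head odd b bs)
        (trans (cong (λ y → (1ℚ ℚ.+ b) ℚ.* (y ℚ.* valueAt (∏ bs) b)) (valueAt-twist-odd b))
          (solve 2 (λ b y → (con 1ℚ :+ b) :* (:- b :* y) := :- ((con 1ℚ :+ b) :* (b :* y)))
            refl b (valueAt (∏ bs) b)))))
      (ℚ.neg-antimono-< (*-pos (ℚ.+-mono-<-≤ {0ℚ} {1ℚ} {0ℚ} 0<1 (ℚ.<⇒≤ 0<b))
        (*-pos 0<b (valueAt-∏-pos bs b<bs))))
    , alternates-cofactor⁺ odd b bs bs (All.zip (b<bs , vanishes-∏ odd bs))
        (alternates-odd⁻ bs inc hs)

  -- Since `twist odd` vanishes at 0, the value there is simply the product of the entries of bs.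
  cofactor-odd-at-0 : ∀ bs → All (λ b → (0ℚ ℚ.< b) × (b ℚ.< 1ℚ)) bs →
    0ℚ ℚ.< valueAt (cofactor odd bs) 0ℚ
  cofactor-odd-at-0 []       _              = subst (0ℚ ℚ.<_) (sym (evℚ-const 1ℚ (ℚ.- 0ℚ))) 0<1
  cofactor-odd-at-0 (b ∷ bs) ((0<b , _) ∷ hs) =
    subst (0ℚ ℚ.<_) (valueAt-cofactor-tail odd b bs {0ℚ}
        (trans (cong (ℚ._* valueAt (∏ bs) 0ℚ) (valueAt-twist-odd 0ℚ)) (ℚ.*-zeroˡ (valueAt (∏ bs) 0ℚ))))
      (*-pos (diff-pos 0<b) (cofactor-odd-at-0 bs hs))

-- An entry 0 occurs only in even degree. In odd degree the factor x sits in `base odd`, and 0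
-- serves as a sample strictly in front of the other entries.
Admissible : Parity → List ℚ → Set
Admissible even bs = AllPairs ℚ._<_ bs × All (λ b → (0ℚ ℚ.≤ b) × (b ℚ.< 1ℚ)) bs
Admissible odd  bs = AllPairs ℚ._<_ bs × All (λ b → (0ℚ ℚ.< b) × (b ℚ.< 1ℚ)) bs

admissible⇒inUnit : ∀ π {bs} → Admissible π bs → All InUnit bs
admissible⇒inUnit even (_ , h) = All.map (λ (0≤b , b<1) → 0≤b , diff-nonneg (ℚ.<⇒≤ b<1)) h
admissible⇒inUnit odd  (_ , h) =
  All.map (λ (0<b , b<1) → ℚ.<⇒≤ 0<b , diff-nonneg (ℚ.<⇒≤ b<1)) h

record Approximation (r η : ℚ) (n : ℕ) : Set where
  field
    parity     : Parity
    points     : List ℚ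
    scale      : ℚ
    error      : Poly
    degree     : index parity points ≡ natℚ n
    admissible : Admissible parity points
    equation   : t n ≋ const scale *ₚ rooted parity points +ₚ error
    small      : normAt r error ℚ.≤ η

lower-bound : ∀ {r η b k g} → 0ℚ ℚ.≤ b → NearlySplit r η b k g → NearlySplit r η 0ℚ k g
lower-bound 0≤b s = record
  { scale = scale ; points = points ; error = error ; equation = equation ; small = small
  ; count = count ; sorted = sorted
  ; bounds = All.map (λ (b<c , c<1) → ℚ.≤-<-trans 0≤b b<c , c<1) bounds }
  where open NearlySplit s

-- For k roots the cofactor has k + 1 coefficients, matched by k + 1 samples: the roots followed by
-- 1 in even degree, and 0 followed by the roots in odd degree.
cofactor-split : ∀ {r} → 0ℚ ℚ.≤ r → ∀ {η} → 0ℚ ℚ.< η → ∀ π bs → Admissible π bs →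
  NearlySplit r η 0ℚ (length bs) (cofactor π bs)
-- Here 1 is the only sample, so the lower bound from `split` has to be relaxed from 1 to 0.
cofactor-split 0≤r 0<η even [] adm =
  lower-bound 0≤1 (split 0≤r 0<η (nat 1) 1ℚ [] refl (alternates-even [] [] [])
    ([] ∷ []) ((0≤1 , ℚ.≤-refl) ∷ []))
cofactor-split {r} 0≤r {η} 0<η even bs@(b ∷ bs′) (inc , hs@((0≤b , _) ∷ _)) =
  subst (λ k → NearlySplit r η 0ℚ k (cofactor even bs)) len
  (lower-bound 0≤b (split 0≤r 0<η (cofactor even bs) b (bs′ ++ 1ℚ ∷ [])
    (trans (length-cofactor even bs) (cong suc (sym len)))
    (alternates-even bs inc hs)
    (AllPairs.++⁺ inc ([] ∷ []) (All.map (λ (_ , b<1) → b<1 ∷ []) hs))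
    (All.++⁺ (All.map (λ (0≤b , b<1) → 0≤b , ℚ.<⇒≤ b<1) hs) ((0≤1 , ℚ.≤-refl) ∷ []))))
  where
  len : length (bs′ ++ 1ℚ ∷ []) ≡ suc (length bs′)
  len = trans (length-++ bs′) (ℕ.+-comm (length bs′) 1)
cofactor-split 0≤r 0<η odd bs (inc , hs) =
  split 0≤r 0<η (cofactor odd bs) 0ℚ bs (length-cofactor odd bs)
    (cofactor-odd-at-0 bs hs , alternates-odd⁻ bs inc hs)
    (All.map proj₁ hs ∷ inc)
    ((ℚ.≤-refl , 0≤1) ∷ All.map (λ (0<b , b<1) → ℚ.<⇒≤ 0<b , ℚ.<⇒≤ b<1) hs)

flip : Parity → Parity
flip even = odd
flip odd  = even

-- After a step from odd degree the trivial factors are x (1 + x)^(k+1): the surplus 1 + x is paired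
-- with x, the factor of the entry 0. After a step from even degree x becomes `base odd`.
newRoots : Parity → List ℚ → List ℚ
newRoots even cs = cs
newRoots odd  cs = 0ℚ ∷ cs

admissible-newRoots : ∀ π {cs} → AllPairs ℚ._<_ cs → All (λ b → (0ℚ ℚ.< b) × (b ℚ.< 1ℚ)) cs →
  Admissible (flip π) (newRoots π cs)
admissible-newRoots even inc hs = inc , hs
admissible-newRoots odd  inc hs = All.map proj₁ hs ∷ inc
  , (ℚ.≤-refl , 0<1) ∷ All.map (λ (0<b , b<1) → ℚ.<⇒≤ 0<b , b<1) hs

index-length : ∀ π bs cs → length bs ≡ length cs → index π bs ≡ index π cs
index-length π []       []       e = refl
index-length π (b ∷ bs) (c ∷ cs) e = trans (index-∷ π b bs)
  (trans (cong (λ i → 1ℚ ℚ.+ (1ℚ ℚ.+ i)) (index-length π bs cs (ℕ.suc-injective e)))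
         (sym (index-∷ π c cs)))

index-odd : ∀ bs → index odd bs ≡ 1ℚ ℚ.+ index even bs
index-odd []       = refl
index-odd (b ∷ bs) = cong (λ i → 1ℚ ℚ.+ (1ℚ ℚ.+ i)) (index-odd bs)

index-newRoots : ∀ π bs cs → length cs ≡ length bs → index (flip π) (newRoots π cs) ≡ 1ℚ ℚ.+ index π bs
index-newRoots even bs cs e = trans (index-odd cs) (cong (1ℚ ℚ.+_) (index-length even cs bs e))
index-newRoots odd  bs cs e =
  cong (1ℚ ℚ.+_) (trans (sym (index-odd cs)) (index-length odd cs bs e))

rooted-newRoots : ∀ π cs → outer π (length cs) *ₚ ∏ cs ≋ rooted (flip π) (newRoots π cs)
rooted-newRoots even cs = ≋-trans
  (solve 3 (λ X Y q → X :* Y :* q := X :* (Y :* q)) ≋-refl X ([1+X]^ (length cs)) (∏ cs))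
  (≋-sym (rooted-∏ odd cs))
  where open ℚ[x]-Solver
rooted-newRoots odd cs = ≋-trans
  (solve 3 (λ X Y q → X :* ((con 1ℚ :+ X) :* Y) :* q :=
      con 1ℚ :* ((con 1ℚ :+ X) :* Y :* ((X :+ con 0ℚ) :* q))) ≋-refl X ([1+X]^ (length cs)) (∏ cs))
  (≋-sym (rooted-∏ even (0ℚ ∷ cs)))
  where open ℚ[x]-Solver

-- `Op` sends the old product to trivial factors times `cofactor`, which is split anew. It sends the
-- old error, controlled at radius 1 + r, to one controlled at radius r; hence the induction treats
-- all radii at once.
approximate : ∀ n {r} → 0ℚ ℚ.≤ r → ∀ {η} → 0ℚ ℚ.< η → Approximation r η n
approximate zero 0≤r 0<η = record
  { parity = even ; points = [] ; scale = 1ℚ ; error = []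
  ; degree = refl ; admissible = [] , []
  ; equation = ≋-sym (≋-trans (+ₚ-identityʳ _) (*ₚ-identityˡ (nat 1)))
  ; small = ℚ.<⇒≤ 0<η }
approximate (suc n) {r} 0≤r {η} 0<η =
  let η₁ , 0<η₁ , η₁≤ = scale-down (opNorm 0≤r (natℚ n)) (0≤opNorm 0≤r (natℚ n)) (half-pos 0<η)
      old = approximate n (0≤1 ⊞ 0≤r) 0<η₁
      open Approximation old renaming (points to bs; scale to c; error to e)
      W = outer parity (length bs)
      -- The old scale and roots are fixed by now, so the tolerance of the new splitting can absorb
      -- the factor they put in front of its error.
      η₂ , 0<η₂ , η₂≤ = scale-down (∣ c ∣ ℚ.* normAt r W) (ℚ.0≤∣p∣ c ⊠ 0≤normAt 0≤r W) (half-pos 0<η)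
  in assemble η₁≤ old η₂≤ (cofactor-split 0≤r 0<η₂ parity bs admissible)
  where
  assemble : ∀ {η₁} → opNorm 0≤r (natℚ n) ℚ.* η₁ ℚ.≤ ½ ℚ.* η → (old : Approximation (1ℚ ℚ.+ r) η₁ n) →
    let open Approximation old in
    ∀ {η₂} → ∣ scale ∣ ℚ.* normAt r (outer parity (length points)) ℚ.* η₂ ℚ.≤ ½ ℚ.* η →
    NearlySplit r η₂ 0ℚ (length points) (cofactor parity points) → Approximation r η (suc n)
  assemble {η₁} η₁≤ old {η₂} η₂≤ new = record
    { parity = flip parity
    ; points = newRoots parity cs
    ; scale = c ℚ.* d
    ; error = const c *ₚ (W *ₚ e′) +ₚ Op ν e
    ; degree = trans (index-newRoots parity bs cs count)
        (trans (cong (1ℚ ℚ.+_) degree) (sym (natℚ-suc n)))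
    ; admissible = admissible-newRoots parity sorted bounds
    ; equation = begin
        t (suc n) ≈⟨ t-suc n ⟩
        Op ν (t n) ≈⟨ Op-cong ν equation ⟩
        Op ν (const c *ₚ p +ₚ e) ≈⟨ Op-+ₚ ν (const c *ₚ p) e ⟩
        Op ν (const c *ₚ p) +ₚ Op ν e
          ≈⟨ +ₚ-cong (Op-const* ν c p) (≋-refl {Op ν e}) ⟩
        const c *ₚ Op ν p +ₚ Op ν e
          ≡⟨ cong (λ i → const c *ₚ Op i p +ₚ Op ν e) (sym degree) ⟩
        const c *ₚ Op (index parity bs) p +ₚ Op ν e
          ≈⟨ +ₚ-cong (*ₚ-congʳ (const c) (≋-trans (Op-rooted parity bs)
               (*ₚ-congʳ W (NearlySplit.equation new)))) (≋-refl {Op ν e}) ⟩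
        const c *ₚ (W *ₚ (const d *ₚ ∏ cs +ₚ e′)) +ₚ Op ν e
          ≈⟨ solve 6 (λ c W d q e′ o → c :* (W :* (d :* q :+ e′)) :+ o :=
               (c :* d) :* (W :* q) :+ (c :* (W :* e′) :+ o))
               ≋-refl (const c) W (const d) (∏ cs) e′ (Op ν e) ⟩
        (const c *ₚ const d) *ₚ (W *ₚ ∏ cs) +ₚ (const c *ₚ (W *ₚ e′) +ₚ Op ν e)
          ≈⟨ +ₚ-cong (*ₚ-cong (≋-sym (Algebra.ι-* ℚ[x]-algebra c d)) roots)
               (≋-refl {const c *ₚ (W *ₚ e′) +ₚ Op ν e}) ⟩
        const (c ℚ.* d) *ₚ rooted (flip parity) (newRoots parity cs)
          +ₚ (const c *ₚ (W *ₚ e′) +ₚ Op ν e) ∎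
    ; small = ≤.begin
        normAt r (const c *ₚ (W *ₚ e′) +ₚ Op ν e)
          ≤.≤⟨ normAt-+ 0≤r (const c *ₚ (W *ₚ e′)) (Op ν e) ⟩
        normAt r (const c *ₚ (W *ₚ e′)) ℚ.+ normAt r (Op ν e)
          ≤.≤⟨ ℚ.+-mono-≤ inner (ℚ.≤-trans (normAt-Op 0≤r ν e)
                 (ℚ.≤-trans (*-monoˡ (0≤opNorm 0≤r ν) small) η₁≤)) ⟩
        ½ ℚ.* η ℚ.+ ½ ℚ.* η ≤.≡⟨ half+half η ⟩
        η ≤.∎
    }
    where
    open Approximation old renaming (points to bs; scale to c; error to e)
    open NearlySplit new using (count; sorted; bounds)
      renaming (points to cs; scale to d; error to e′; small to small′)
    open ≋-Reasoning
    open ℚ[x]-Solver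
    module ≤ = ℚ.≤-Reasoning
    ν = natℚ n
    p = rooted parity bs
    W = outer parity (length bs)
    roots : W *ₚ ∏ cs ≋ rooted (flip parity) (newRoots parity cs)
    roots = subst (λ k → outer parity k *ₚ ∏ cs ≋ rooted (flip parity) (newRoots parity cs)) count
      (rooted-newRoots parity cs)
    inner : normAt r (const c *ₚ (W *ₚ e′)) ℚ.≤ ½ ℚ.* η
    inner = ℚ.≤-trans (normAt-* 0≤r (const c) (W *ₚ e′)) (ℚ.≤-trans
      (*-monoˡ (0≤normAt 0≤r (const c)) (ℚ.≤-trans (normAt-* 0≤r W e′) (*-monoˡ (0≤normAt 0≤r W) small′)))
      (ℚ.≤-trans (ℚ.≤-reflexive (trans (cong (ℚ._* (normAt r W ℚ.* η₂)) (normAt-const r c))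
        (sym (ℚ.*-assoc ∣ c ∣ (normAt r W) η₂)))) η₂≤))

-- Limits

-- Both sides are multiplied by c², so the sign of the scale does not matter.
ratioBound-scale : ∀ c x f o → RatioBound x f o → RatioBound x (ιᵢ c *ᵢ f) (ιᵢ c *ᵢ o)
ratioBound-scale c x f o hyp = begin
  normsq (ιᵢ c *ᵢ f) ℚ.* real x
    ≡⟨ cong (ℚ._* real x) (trans (normsq-* (ιᵢ c) f) (cong (ℚ._* normsq f) normsq-ι)) ⟩
  c ℚ.* c ℚ.* normsq f ℚ.* real x ≡⟨ ℚ.*-assoc (c ℚ.* c) (normsq f) (real x) ⟩
  c ℚ.* c ℚ.* (normsq f ℚ.* real x) ≤⟨ *-monoˡ (0≤x² c) hyp ⟩
  c ℚ.* c ℚ.* real (o *ᵢ conj (s *ᵢ f)) ≡⟨ real-ι* (c ℚ.* c) (o *ᵢ conj (s *ᵢ f)) ⟨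
  real (ιᵢ (c ℚ.* c) *ᵢ (o *ᵢ conj (s *ᵢ f)))
    ≡⟨ cong real (trans (cong₂ (λ y z → y *ᵢ (o *ᵢ z)) (ιᵢ-* c c) (conj-* s f))
         (trans (solve 4 (λ c o S F → c :* c :* (o :* (S :* F)) := c :* o :* (S :* (c :* F)))
                   refl (ιᵢ c) o (conj s) (conj f))
                (cong (ιᵢ c *ᵢ o *ᵢ_) (sym (trans (conj-* s (ιᵢ c *ᵢ f))
                  (cong (conj s *ᵢ_) (conj-* (ιᵢ c) f))))))) ⟩
  real (ιᵢ c *ᵢ o *ᵢ conj (s *ᵢ (ιᵢ c *ᵢ f))) ∎
  where
  open ℚ.≤-Reasoning
  open ℚ[i]-Solver
  s = 1ᵢ +ᵢ x
  normsq-ι : normsq (ιᵢ c) ≡ c ℚ.* c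
  normsq-ι = ℚ.+-identityʳ (c ℚ.* c)

-- Both sides are homogeneous of degree four in the scale.
turánBound-scale : ∀ c x f o₀ o₂ → TuránBound x f (o₀ *ᵢ o₀ +ᵢ -ᵢ (o₂ *ᵢ f)) →
  TuránBound x (ιᵢ c *ᵢ f)
    (ιᵢ c *ᵢ o₀ *ᵢ (ιᵢ c *ᵢ o₀) +ᵢ -ᵢ (ιᵢ c *ᵢ o₂ *ᵢ (ιᵢ c *ᵢ f)))
turánBound-scale c x f o₀ o₂ hyp = begin
  normsq s ℚ.* (normsq (ιᵢ c *ᵢ f) ℚ.* normsq (ιᵢ c *ᵢ f)) ℚ.* real x
    ≡⟨ cong (λ y → normsq s ℚ.* (y ℚ.* y) ℚ.* real x)
         (trans (normsq-* (ιᵢ c) f) (cong (ℚ._* normsq f) (ℚ.+-identityʳ (c ℚ.* c)))) ⟩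
  normsq s ℚ.* (c ℚ.* c ℚ.* normsq f ℚ.* (c ℚ.* c ℚ.* normsq f)) ℚ.* real x
    ≡⟨ factor-c⁴ (normsq s) (normsq f) (real x) ⟩
  c⁴ ℚ.* (normsq s ℚ.* (normsq f ℚ.* normsq f) ℚ.* real x)
    ≤⟨ *-monoˡ (0≤x² c ⊠ 0≤x² c) hyp ⟩
  c⁴ ℚ.* real B ≡⟨ real-ι* c⁴ B ⟨
  real (ιᵢ c⁴ *ᵢ B)
    ≡⟨ cong (λ y → real (y *ᵢ B))
         (trans (ιᵢ-* (c ℚ.* c) (c ℚ.* c)) (cong (λ y → y *ᵢ y) (ιᵢ-* c c))) ⟩
  real (ιᵢ c *ᵢ ιᵢ c *ᵢ (ιᵢ c *ᵢ ιᵢ c) *ᵢ B)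
    ≡⟨ cong real (trans
         (solve 6 (λ c o₀ o₂ f F S → c :* c :* (c :* c)
            :* (:- (o₀ :* o₀ :+ :- (o₂ :* f)) :* ((F :* F) :* (S :* S))) :=
            :- (c :* o₀ :* (c :* o₀) :+ :- (c :* o₂ :* (c :* f)))
            :* ((c :* F :* (c :* F)) :* (S :* S))) refl (ιᵢ c) o₀ o₂ f (conj f) (conj s))
         (cong (λ y → -ᵢ τ′ *ᵢ (y *ᵢ y *ᵢ (conj s *ᵢ conj s))) (sym (conj-* (ιᵢ c) f)))) ⟩
  real (-ᵢ τ′ *ᵢ ((conj (ιᵢ c *ᵢ f) *ᵢ conj (ιᵢ c *ᵢ f)) *ᵢ (conj s *ᵢ conj s))) ∎
  where
  open ℚ.≤-Reasoning
  open ℚ[i]-Solver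
  s = 1ᵢ +ᵢ x
  c⁴ = c ℚ.* c ℚ.* (c ℚ.* c)
  factor-c⁴ : ∀ s n x → s ℚ.* (c ℚ.* c ℚ.* n ℚ.* (c ℚ.* c ℚ.* n)) ℚ.* x ≡ c⁴ ℚ.* (s ℚ.* (n ℚ.* n) ℚ.* x)
  factor-c⁴ = +-*-Solver.solve 4
    (λ c s n x → s · (c · c · n · (c · c · n)) · x +-*-Solver.:= c · c · (c · c) · (s · (n · n) · x)) refl c
    where
    infixl 8 _·_
    _·_ : ∀ {k} → +-*-Solver.Polynomial k → +-*-Solver.Polynomial k → +-*-Solver.Polynomial k
    _·_ = +-*-Solver._:*_
  τ′ = ιᵢ c *ᵢ o₀ *ᵢ (ιᵢ c *ᵢ o₀) +ᵢ -ᵢ (ιᵢ c *ᵢ o₂ *ᵢ (ιᵢ c *ᵢ f))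
  B = -ᵢ (o₀ *ᵢ o₀ +ᵢ -ᵢ (o₂ *ᵢ f)) *ᵢ ((conj f *ᵢ conj f) *ᵢ (conj s *ᵢ conj s))

-- The triple f, o₀, o₂ comes from one rational-rooted product and its images under `Op` and `Op²`,
-- so it satisfies the bounds exactly. Only its distance to the values of t is approximate.
record Nearby (n : ℕ) (x : ℚ[i]) (ε : ℚ) : Set where
  field
    f o₀ o₂ d d₀ d₂ : ℚ[i]
    f-close  : evᵢ (t n) x ≡ f +ᵢ d
    o₀-close : evᵢ (t (suc n)) x ≡ o₀ +ᵢ d₀
    o₂-close : evᵢ (t (suc (suc n))) x ≡ o₂ +ᵢ d₂
    d-small  : abs₁ d ℚ.≤ ε
    d₀-small : abs₁ d₀ ℚ.≤ ε
    d₂-small : abs₁ d₂ ℚ.≤ ε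
    ratio    : 0ℚ ℚ.≤ real x → RatioBound x f o₀
    turán-≤  : 0ℚ ℚ.≤ real x → TuránBound x f (o₀ *ᵢ o₀ +ᵢ -ᵢ (o₂ *ᵢ f))

nearby : ∀ n x {ε} → 0ℚ ℚ.< ε → Nearby n x ε
nearby n x {ε} 0<ε = let η , 0<η , η≤ = scale-down K 0≤K 0<ε in
  build η≤ (approximate n (0≤1 ⊞ (0≤1 ⊞ 0≤r)) 0<η)
  where
  ν = natℚ n
  r = abs₁ x
  0≤r = 0≤abs₁ x
  k₀ = opNorm 0≤r ν
  k₂ = opNorm 0≤r (1ℚ ℚ.+ ν) ℚ.* opNorm (0≤1 ⊞ 0≤r) ν
  0≤k₀ = 0≤opNorm 0≤r ν
  0≤k₂ = 0≤opNorm 0≤r (1ℚ ℚ.+ ν) ⊠ 0≤opNorm (0≤1 ⊞ 0≤r) ν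
  -- A single tolerance serves three errors, amplified by 1, k₀ and k₂ under zero, one and two
  -- applications of `Op`.
  K = 1ℚ ℚ.+ k₀ ℚ.+ k₂
  0≤K = 0≤1 ⊞ 0≤k₀ ⊞ 0≤k₂
  -- Two applications of `Op` cost two units of radius.
  R₂ = 1ℚ ℚ.+ (1ℚ ℚ.+ r)
  ≤1+ : ∀ s → s ℚ.≤ 1ℚ ℚ.+ s
  ≤1+ s = ≤-from-diff (ℚ.+-comm 1ℚ s) 0≤1
  build : ∀ {η} → K ℚ.* η ℚ.≤ ε → Approximation R₂ η n → Nearby n x ε
  build {η} Kη≤ε A = record
    { f = ιᵢ c *ᵢ evᵢ p x ; o₀ = ιᵢ c *ᵢ evᵢ (Op μ p) x ; o₂ = ιᵢ c *ᵢ evᵢ (Op² μ p) x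
    ; d = evᵢ e x ; d₀ = evᵢ (Op ν e) x ; d₂ = evᵢ (Op² ν e) x
    ; f-close = value p e equation
    ; o₀-close = subst (λ i → evᵢ (t (suc n)) x ≡ ιᵢ c *ᵢ evᵢ (Op i p) x +ᵢ evᵢ (Op ν e) x)
        (sym degree) (value (Op ν p) (Op ν e) equation₀)
    ; o₂-close = subst (λ i → evᵢ (t (suc (suc n))) x ≡ ιᵢ c *ᵢ evᵢ (Op² i p) x +ᵢ evᵢ (Op² ν e) x)
        (sym degree) (value (Op² ν p) (Op² ν e) equation₂)
    ; d-small = bound e (≤-from-diff (solve 3 (λ k k′ n → (con 1ℚ :+ k :+ k′) :* n := n :+ (k :+ k′) :* n)
          refl k₀ k₂ N) ((0≤k₀ ⊞ 0≤k₂) ⊠ 0≤N))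
        (ℚ.≤-trans (normAt-mono 0≤r (≤1+ r) e) (normAt-mono (0≤1 ⊞ 0≤r) (≤1+ (1ℚ ℚ.+ r)) e))
    ; d₀-small = bound (Op ν e) (≤-from-diff
          (solve 3 (λ k k′ n → (con 1ℚ :+ k :+ k′) :* n := k :* n :+ (con 1ℚ :+ k′) :* n)
          refl k₀ k₂ N) ((0≤1 ⊞ 0≤k₂) ⊠ 0≤N))
        (ℚ.≤-trans (normAt-Op 0≤r ν e)
          (*-monoˡ 0≤k₀ (normAt-mono (0≤1 ⊞ 0≤r) (≤1+ (1ℚ ℚ.+ r)) e)))
    ; d₂-small = bound (Op² ν e) (≤-from-diff
          (solve 3 (λ k k′ n → (con 1ℚ :+ k :+ k′) :* n := k′ :* n :+ (con 1ℚ :+ k) :* n)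
          refl k₀ k₂ N) ((0≤1 ⊞ 0≤k₀) ⊠ 0≤N))
        (ℚ.≤-trans (normAt-Op 0≤r (1ℚ ℚ.+ ν) (Op ν e))
          (ℚ.≤-trans (*-monoˡ (0≤opNorm 0≤r (1ℚ ℚ.+ ν)) (normAt-Op (0≤1 ⊞ 0≤r) ν e))
            (ℚ.≤-reflexive (sym (ℚ.*-assoc (opNorm 0≤r (1ℚ ℚ.+ ν)) (opNorm (0≤1 ⊞ 0≤r) ν) N)))))
    ; ratio = λ 0≤x → ratioBound-scale c x (evᵢ p x) (evᵢ (Op μ p) x)
        (ratioBound-rooted x 0≤x parity bs (admissible⇒inUnit parity admissible))
    ; turán-≤ = λ 0≤x → turánBound-scale c x (evᵢ p x) (evᵢ (Op μ p) x) (evᵢ (Op² μ p) x)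
        (turánBound-rooted x 0≤x parity bs (admissible⇒inUnit parity admissible))
    }
    where
    open Approximation A renaming (points to bs; scale to c; error to e)
    open +-*-Solver using (solve; _:=_; _:+_; _:*_; con)
    p = rooted parity bs
    μ = index parity bs
    N = normAt R₂ e
    0≤N = 0≤normAt (0≤1 ⊞ (0≤1 ⊞ 0≤r)) e
    bound : ∀ q {m} → m ℚ.≤ K ℚ.* N → normAt r q ℚ.≤ m → abs₁ (evᵢ q x) ℚ.≤ ε
    bound q m≤ q≤m = ℚ.≤-trans (abs₁-evᵢ q x ℚ.≤-refl) (ℚ.≤-trans q≤m
      (ℚ.≤-trans m≤ (ℚ.≤-trans (*-monoˡ 0≤K small) Kη≤ε)))
    value : ∀ {p} q e → p ≋ const c *ₚ q +ₚ e → evᵢ p x ≡ ιᵢ c *ᵢ evᵢ q x +ᵢ evᵢ e x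
    value q e eq = trans (evᵢ-cong eq x) (trans (evᵢ-+ (const c *ₚ q) e x)
      (cong (_+ᵢ evᵢ e x) (trans (evᵢ-* (const c) q x) (cong (_*ᵢ evᵢ q x) (evᵢ-const c x)))))
    Op-equation : ∀ i {p} q e → p ≋ const c *ₚ q +ₚ e → Op i p ≋ const c *ₚ Op i q +ₚ Op i e
    Op-equation i q e eq = ≋-trans (Op-cong i eq) (≋-trans (Op-+ₚ i (const c *ₚ q) e)
      (+ₚ-cong (Op-const* i c q) (≋-refl {Op i e})))
    equation₀ : t (suc n) ≋ const c *ₚ Op ν p +ₚ Op ν e
    equation₀ = ≋-trans (t-suc n) (Op-equation ν p e equation)
    equation₂ : t (suc (suc n)) ≋ const c *ₚ Op² ν p +ₚ Op² ν e
    equation₂ = ≋-trans (t-suc (suc n)) (subst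
      (λ i → Op i (t (suc n)) ≋ const c *ₚ Op² ν p +ₚ Op² ν e) (sym (natℚ-suc n))
      (Op-equation (1ℚ ℚ.+ ν) (Op ν p) (Op ν e) equation₀))

-- Eventual bounds and null sequences

Eventually : (ℕ → Set) → Set
Eventually P = ∃[ N ] (∀ k → N ≤ k → P k)

infixr 4 _∧ₑ_
_∧ₑ_ : ∀ {P Q} → Eventually P → Eventually Q → Eventually (λ k → P k × Q k)
(M , p) ∧ₑ (N , q) = M ℕ.⊔ N , λ k h →
  p k (ℕ.m⊔n≤o⇒m≤o M N h) , q k (ℕ.m⊔n≤o⇒n≤o M N h)

mapₑ : ∀ {P Q : ℕ → Set} → (∀ {k} → P k → Q k) → Eventually P → Eventually Q
mapₑ f (N , p) = N , λ k h → f (p k h)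

Null : (ℕ → ℚ) → Set
Null a = ∀ ε → 0ℚ ℚ.< ε → Eventually (λ k → ∣ a k ∣ ℚ.< ε)

Bounded : (ℕ → ℚ) → Set
Bounded a = ∃[ B ] (0ℚ ℚ.< B) × Eventually (λ k → ∣ a k ∣ ℚ.≤ B)

null-≤ : ∀ {a b} → Eventually (λ k → ∣ a k ∣ ℚ.≤ ∣ b k ∣) → Null b → Null a
null-≤ h nb ε 0<ε = mapₑ (λ (a≤b , b<ε) → ℚ.≤-<-trans a≤b b<ε) (h ∧ₑ nb ε 0<ε)

null-≡ : ∀ {a b} → (∀ k → a k ≡ b k) → Null b → Null a
null-≡ e = null-≤ (0 , λ k _ → ℚ.≤-reflexive (cong ∣_∣ (e k)))

null-+ : ∀ {a b} → Null a → Null b → Null (λ k → a k ℚ.+ b k)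
null-+ {a} {b} na nb ε 0<ε = mapₑ
  (λ {k} (a<ε , b<ε) → ℚ.≤-<-trans (ℚ.∣p+q∣≤∣p∣+∣q∣ (a k) (b k))
    (subst (∣ a k ∣ ℚ.+ ∣ b k ∣ ℚ.<_) (half+half ε) (ℚ.+-mono-< a<ε b<ε)))
  (na (½ ℚ.* ε) (half-pos 0<ε) ∧ₑ nb (½ ℚ.* ε) (half-pos 0<ε))

null-* : ∀ {a b} → Bounded a → Null b → Null (λ k → a k ℚ.* b k)
null-* {a} {b} (B , 0<B , a≤B) nb ε 0<ε =
  let δ , 0<δ , Bδ≡ε = shrink B ε 0<B 0<ε in
  mapₑ (λ {k} (ak≤B , bk<δ) → subst (∣ a k ℚ.* b k ∣ ℚ.<_) Bδ≡ε (*-mono-< (a k) (b k) 0<B ak≤B bk<δ))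
       (a≤B ∧ₑ nb δ 0<δ)

null-neg : ∀ {a} → Null a → Null (λ k → ℚ.- a k)
null-neg {a} = null-≤ (0 , λ k _ → ℚ.≤-reflexive (ℚ.∣-p∣≡∣p∣ (a k)))

bounded-+ : ∀ {a b} → Bounded a → Bounded b → Bounded (λ k → a k ℚ.+ b k)
bounded-+ {a} {b} (A , 0<A , a≤) (B , 0<B , b≤) = A ℚ.+ B , ℚ.+-mono-< {0ℚ} {_} {0ℚ} 0<A 0<B ,
  mapₑ (λ {k} (ak≤ , bk≤) → ℚ.≤-trans (ℚ.∣p+q∣≤∣p∣+∣q∣ (a k) (b k)) (ℚ.+-mono-≤ ak≤ bk≤)) (a≤ ∧ₑ b≤)

bounded-* : ∀ {a b} → Bounded a → Bounded b → Bounded (λ k → a k ℚ.* b k)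
bounded-* {a} {b} (A , 0<A , a≤) (B , 0<B , b≤) = A ℚ.* B , *-pos 0<A 0<B ,
  mapₑ (λ {k} (ak≤ , bk≤) → ℚ.≤-trans (ℚ.≤-reflexive (ℚ.∣p*q∣≡∣p∣*∣q∣ (a k) (b k)))
         (ℚ.≤-trans (*-monoʳ (ℚ.0≤∣p∣ (b k)) ak≤) (*-monoˡ (ℚ.<⇒≤ 0<A) bk≤))) (a≤ ∧ₑ b≤)

bounded-neg : ∀ {a} → Bounded a → Bounded (λ k → ℚ.- a k)
bounded-neg {a} (A , 0<A , a≤) = A , 0<A ,
  mapₑ (λ {k} → ℚ.≤-trans (ℚ.≤-reflexive (ℚ.∣-p∣≡∣p∣ (a k)))) a≤

null⇒bounded : ∀ {a} → Null a → Bounded a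
null⇒bounded na = 1ℚ , 0<1 , mapₑ ℚ.<⇒≤ (na 1ℚ 0<1)

bounded-≡ : ∀ {a b} → (∀ k → a k ≡ b k) → Bounded b → Bounded a
bounded-≡ e (B , 0<B , b≤) = B , 0<B , mapₑ (λ {k} → subst (λ y → ∣ y ∣ ℚ.≤ B) (sym (e k))) b≤

-- Equality modulo null sequences.  Boundedness is included so that products need no side
-- condition.
infix 4 _∼_ _∼ᵢ_
record _∼_ (a b : ℕ → ℚ) : Set where
  constructor mk∼
  field
    boundedˡ   : Bounded a
    boundedʳ   : Bounded b
    difference : Null (λ k → a k ℚ.- b k)
open _∼_

module _ where
  open +-*-Solver

  ∼-refl : ∀ {a} → Bounded a → a ∼ a
  ∼-refl {a} ba = mk∼ ba ba λ ε 0<ε → 0 , λ k _ →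
    subst (ℚ._< ε) (sym (cong ∣_∣ (ℚ.+-inverseʳ (a k)))) 0<ε

  ∼-sym : ∀ {a b} → a ∼ b → b ∼ a
  ∼-sym {a} {b} (mk∼ p q d) = mk∼ q p (null-≡
    (λ k → solve 2 (λ a b → b :- a := :- (a :- b)) refl (a k) (b k)) (null-neg d))

  ∼-trans : ∀ {a b c} → a ∼ b → b ∼ c → a ∼ c
  ∼-trans {a} {b} {c} (mk∼ p _ d) (mk∼ _ q e) = mk∼ p q (null-≡
    (λ k → solve 3 (λ a b c → a :- c := (a :- b) :+ (b :- c)) refl (a k) (b k) (c k)) (null-+ d e))

  ∼-+ : ∀ {a b c d} → a ∼ b → c ∼ d → (λ k → a k ℚ.+ c k) ∼ (λ k → b k ℚ.+ d k)
  ∼-+ {a} {b} {c} {d} (mk∼ p q e) (mk∼ p′ q′ e′) = mk∼ (bounded-+ p p′) (bounded-+ q q′) (null-≡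
    (λ k → solve 4 (λ a b c d → (a :+ c) :- (b :+ d) := (a :- b) :+ (c :- d)) refl (a k) (b k) (c k) (d k))
    (null-+ e e′))

  ∼-* : ∀ {a b c d} → a ∼ b → c ∼ d → (λ k → a k ℚ.* c k) ∼ (λ k → b k ℚ.* d k)
  ∼-* {a} {b} {c} {d} (mk∼ p q e) (mk∼ p′ q′ e′) = mk∼ (bounded-* p p′) (bounded-* q q′) (null-≡
    (λ k → solve 4 (λ a b c d → a :* c :- b :* d := a :* (c :- d) :+ d :* (a :- b)) refl (a k) (b k) (c k) (d k))
    (null-+ (null-* p e′) (null-* q′ e)))

  ∼-neg : ∀ {a b} → a ∼ b → (λ k → ℚ.- a k) ∼ (λ k → ℚ.- b k)
  ∼-neg {a} {b} (mk∼ p q e) = mk∼ (bounded-neg p) (bounded-neg q) (null-≡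
    (λ k → solve 2 (λ a b → :- a :- :- b := :- (a :- b)) refl (a k) (b k)) (null-neg e))

  ∼-≡ : ∀ {a b c d} → (∀ k → a k ≡ b k) → (∀ k → c k ≡ d k) → b ∼ d → a ∼ c
  ∼-≡ e f (mk∼ p q n) = mk∼ (bounded-≡ e p) (bounded-≡ f q) (null-≡ (λ k → cong₂ ℚ._-_ (e k) (f k)) n)

  null⇒∼0 : ∀ {a} → Null a → a ∼ (λ _ → 0ℚ)
  null⇒∼0 {a} na = mk∼ (null⇒bounded na) (null⇒bounded {λ _ → 0ℚ} (λ ε 0<ε → 0 , λ k _ → 0<ε))
    (null-≡ (λ k → ℚ.+-identityʳ (a k)) na)

  ∼0⇒null : ∀ {a} → a ∼ (λ _ → 0ℚ) → Null a
  ∼0⇒null {a} (mk∼ _ _ d) = null-≡ (λ k → sym (ℚ.+-identityʳ (a k))) d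

record _∼ᵢ_ (z w : ℕ → ℚ[i]) : Set where
  constructor mk∼ᵢ
  field
    real-∼ : (λ k → real (z k)) ∼ (λ k → real (w k))
    imag-∼ : (λ k → imag (z k)) ∼ (λ k → imag (w k))
open _∼ᵢ_

imag-+ : ∀ z w → imag (z +ᵢ w) ≡ imag z ℚ.+ imag w
imag-+ (a ⊹ b) (c ⊹ d) = refl

real-* : ∀ z w → real (z *ᵢ w) ≡ real z ℚ.* real w ℚ.+ ℚ.- (imag z ℚ.* imag w)
real-* (a ⊹ b) (c ⊹ d) = refl

imag-* : ∀ z w → imag (z *ᵢ w) ≡ real z ℚ.* imag w ℚ.+ imag z ℚ.* real w
imag-* (a ⊹ b) (c ⊹ d) = refl

real-neg : ∀ z → real (-ᵢ z) ≡ ℚ.- real z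
real-neg (a ⊹ b) = refl

imag-neg : ∀ z → imag (-ᵢ z) ≡ ℚ.- imag z
imag-neg (a ⊹ b) = refl

real-conj : ∀ z → real (conj z) ≡ real z
real-conj (a ⊹ b) = refl

imag-conj : ∀ z → imag (conj z) ≡ ℚ.- imag z
imag-conj (a ⊹ b) = refl

∼ᵢ-sym : ∀ {z w} → z ∼ᵢ w → w ∼ᵢ z
∼ᵢ-sym (mk∼ᵢ p q) = mk∼ᵢ (∼-sym p) (∼-sym q)

∼ᵢ-trans : ∀ {z w u} → z ∼ᵢ w → w ∼ᵢ u → z ∼ᵢ u
∼ᵢ-trans (mk∼ᵢ p q) (mk∼ᵢ p′ q′) = mk∼ᵢ (∼-trans p p′) (∼-trans q q′)

∼ᵢ-≡ : ∀ {z z′ w w′} → (∀ k → z k ≡ z′ k) → (∀ k → w k ≡ w′ k) → z′ ∼ᵢ w′ → z ∼ᵢ w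
∼ᵢ-≡ e f (mk∼ᵢ p q) = mk∼ᵢ (∼-≡ (λ k → cong real (e k)) (λ k → cong real (f k)) p)
                           (∼-≡ (λ k → cong imag (e k)) (λ k → cong imag (f k)) q)

∼ᵢ-+ : ∀ {z z′ w w′} → z ∼ᵢ z′ → w ∼ᵢ w′ → (λ k → z k +ᵢ w k) ∼ᵢ (λ k → z′ k +ᵢ w′ k)
∼ᵢ-+ {z} {z′} {w} {w′} (mk∼ᵢ p q) (mk∼ᵢ p′ q′) = mk∼ᵢ
  (∼-≡ (λ k → real-+ (z k) (w k)) (λ k → real-+ (z′ k) (w′ k)) (∼-+ p p′))
  (∼-≡ (λ k → imag-+ (z k) (w k)) (λ k → imag-+ (z′ k) (w′ k)) (∼-+ q q′))

∼ᵢ-* : ∀ {z z′ w w′} → z ∼ᵢ z′ → w ∼ᵢ w′ → (λ k → z k *ᵢ w k) ∼ᵢ (λ k → z′ k *ᵢ w′ k)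
∼ᵢ-* {z} {z′} {w} {w′} (mk∼ᵢ p q) (mk∼ᵢ p′ q′) = mk∼ᵢ
  (∼-≡ (λ k → real-* (z k) (w k)) (λ k → real-* (z′ k) (w′ k)) (∼-+ (∼-* p p′) (∼-neg (∼-* q q′))))
  (∼-≡ (λ k → imag-* (z k) (w k)) (λ k → imag-* (z′ k) (w′ k)) (∼-+ (∼-* p q′) (∼-* q p′)))

∼ᵢ-neg : ∀ {z w} → z ∼ᵢ w → (λ k → -ᵢ z k) ∼ᵢ (λ k → -ᵢ w k)
∼ᵢ-neg {z} {w} (mk∼ᵢ p q) = mk∼ᵢ
  (∼-≡ (λ k → real-neg (z k)) (λ k → real-neg (w k)) (∼-neg p))
  (∼-≡ (λ k → imag-neg (z k)) (λ k → imag-neg (w k)) (∼-neg q))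

∼ᵢ-conj : ∀ {z w} → z ∼ᵢ w → (λ k → conj (z k)) ∼ᵢ (λ k → conj (w k))
∼ᵢ-conj {z} {w} (mk∼ᵢ p q) = mk∼ᵢ
  (∼-≡ (λ k → real-conj (z k)) (λ k → real-conj (w k)) p)
  (∼-≡ (λ k → imag-conj (z k)) (λ k → imag-conj (w k)) (∼-neg q))

bounded-const : ∀ c → Bounded (λ _ → c)
bounded-const c = 1ℚ ℚ.+ ∣ c ∣ , ℚ.+-mono-<-≤ {0ℚ} {1ℚ} {0ℚ} 0<1 (ℚ.0≤∣p∣ c) , 0 ,
  λ _ _ → ≤-from-diff (ℚ.+-comm 1ℚ ∣ c ∣) 0≤1

∼ᵢ-const : ∀ c → (λ _ → c) ∼ᵢ (λ _ → c)
∼ᵢ-const c = mk∼ᵢ (∼-refl (bounded-const (real c))) (∼-refl (bounded-const (imag c)))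

-- As a sequence always differs from itself by 0, `z ∼ᵢ z` expresses that z is bounded; polynomials
-- preserve this.
∼ᵢ-ev : ∀ {z} p → z ∼ᵢ z → (λ k → evᵢ p (z k)) ∼ᵢ (λ k → evᵢ p (z k))
∼ᵢ-ev []      zz = ∼ᵢ-const (ιᵢ 0ℚ)
∼ᵢ-ev (a ∷ p) zz = ∼ᵢ-+ (∼ᵢ-const (ιᵢ a)) (∼ᵢ-* zz (∼ᵢ-ev p zz))

Nullᵢ : (ℕ → ℚ[i]) → Set
Nullᵢ z = z ∼ᵢ (λ _ → ιᵢ 0ℚ)

0*ᵢ : ∀ z → ιᵢ 0ℚ *ᵢ z ≡ ιᵢ 0ℚ
0*ᵢ = Algebra.zeroˡ ℚ[i]-algebra

nullᵢ-*ˡ : ∀ {z w} → Nullᵢ z → w ∼ᵢ w → Nullᵢ (λ k → z k *ᵢ w k)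
nullᵢ-*ˡ {z} {w} nz ww = ∼ᵢ-≡ (λ k → refl) (λ k → sym (0*ᵢ (w k))) (∼ᵢ-* nz ww)

nullᵢ-neg : ∀ {z} → Nullᵢ z → Nullᵢ (λ k → -ᵢ z k)
nullᵢ-neg nz = ∼ᵢ-≡ (λ k → refl) (λ k → refl) (∼ᵢ-neg nz)

½^-antitone : ∀ m j → ½^ (j ℕ.+ m) ℚ.≤ ½^ m
½^-antitone m zero    = ℚ.≤-refl
½^-antitone m (suc j) = ℚ.≤-trans (ℚ.<⇒≤ (halve (0<½^ (j ℕ.+ m)))) (½^-antitone m j)

null-½^ : Null ½^
null-½^ ε 0<ε = let N , small = ½^-small 0≤1 (half-pos 0<ε) in N , λ k N≤k → begin-strict
  ∣ ½^ k ∣ ≡⟨ ℚ.0≤p⇒∣p∣≡p (ℚ.<⇒≤ (0<½^ k)) ⟩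
  ½^ k ≡⟨ cong ½^ (ℕ.m∸n+n≡m N≤k) ⟨
  ½^ (k ℕ.∸ N ℕ.+ N) ≤⟨ ½^-antitone N (k ℕ.∸ N) ⟩
  ½^ N ≡⟨ ℚ.*-identityˡ (½^ N) ⟨
  1ℚ ℚ.* ½^ N ≤⟨ small ⟩
  ½ ℚ.* ε <⟨ halve 0<ε ⟩
  ε ∎
  where open ℚ.≤-Reasoning

small⇒nullᵢ : ∀ {d} → (∀ k → abs₁ (d k) ℚ.≤ ½^ k) → Nullᵢ d
small⇒nullᵢ {d} h = mk∼ᵢ
  (null⇒∼0 (null-≤ (0 , λ k _ → ℚ.≤-trans (≤-from-diff refl (ℚ.0≤∣p∣ (imag (d k)))) (bound k)) null-½^))
  (null⇒∼0 (null-≤ (0 , λ k _ → ℚ.≤-trans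
    (≤-from-diff (ℚ.+-comm ∣ real (d k) ∣ ∣ imag (d k) ∣) (ℚ.0≤∣p∣ (real (d k)))) (bound k)) null-½^))
  where
  bound : ∀ k → abs₁ (d k) ℚ.≤ ∣ ½^ k ∣
  bound k = ℚ.≤-trans (h k) (ℚ.≤-reflexive (sym (ℚ.0≤p⇒∣p∣≡p (ℚ.<⇒≤ (0<½^ k)))))

-- Writing f = v - d also transfers boundedness from v to the auxiliary sequence f.
close⇒∼ᵢ : ∀ {v f d} → (∀ k → v k ≡ f k +ᵢ d k) → Nullᵢ d → v ∼ᵢ v → f ∼ᵢ v
close⇒∼ᵢ {v} {f} {d} e nd vv = ∼ᵢ-≡ (λ k → f≡ k) (λ k → v≡ k) (∼ᵢ-+ vv (∼ᵢ-neg nd))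
  where
  open ℚ[i]-Solver
  f≡ : ∀ k → f k ≡ v k +ᵢ -ᵢ d k
  f≡ k = trans (solve 2 (λ f d → f := (f :+ d) :+ :- d) refl (f k) (d k)) (cong (_+ᵢ -ᵢ d k) (sym (e k)))
  v≡ : ∀ k → v k ≡ v k +ᵢ -ᵢ (ιᵢ 0ℚ)
  v≡ k = solve 1 (λ v → v := v :+ :- con 0ℚ) refl (v k)

null-sqrt : ∀ {a} → Null (λ k → a k ℚ.* a k) → Null a
null-sqrt {a} n ε 0<ε = mapₑ (λ {k} h → reflect k h) (n (ε ℚ.* ε) (*-pos 0<ε 0<ε))
  where
  reflect : ∀ k → ∣ a k ℚ.* a k ∣ ℚ.< ε ℚ.* ε → ∣ a k ∣ ℚ.< ε
  reflect k h with ∣ a k ∣ ℚ.<? ε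
  ... | yes a<ε = a<ε
  ... | no ¬a<ε = contradiction (ℚ.<-≤-trans h (begin
    ε ℚ.* ε ≤⟨ *-monoˡ (ℚ.<⇒≤ 0<ε) (ℚ.≮⇒≥ ¬a<ε) ⟩
    ε ℚ.* ∣ a k ∣ ≤⟨ *-monoʳ (ℚ.0≤∣p∣ (a k)) (ℚ.≮⇒≥ ¬a<ε) ⟩
    ∣ a k ∣ ℚ.* ∣ a k ∣ ≡⟨ ℚ.∣p*q∣≡∣p∣*∣q∣ (a k) (a k) ⟨
    ∣ a k ℚ.* a k ∣ ∎)) (ℚ.<-irrefl refl)
    where open ℚ.≤-Reasoning

null-squeeze : ∀ {a b ε} → 0ℚ ℚ.< ε →
  Eventually (λ k → (0ℚ ℚ.≤ a k) × (ε ℚ.* a k ℚ.≤ b k)) → Null b → Null a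
null-squeeze {a} {b} {ε} 0<ε h nb δ 0<δ = mapₑ (λ {k} hk → bound k hk) (h ∧ₑ nb (ε ℚ.* δ) (*-pos 0<ε 0<δ))
  where
  bound : ∀ k → ((0ℚ ℚ.≤ a k) × (ε ℚ.* a k ℚ.≤ b k)) × (∣ b k ∣ ℚ.< ε ℚ.* δ) → ∣ a k ∣ ℚ.< δ
  bound k ((0≤a , εa≤b) , b<) = subst (ℚ._< δ) (sym (ℚ.0≤p⇒∣p∣≡p 0≤a))
    (ℚ.*-cancelˡ-<-nonNeg ε {{ℚ.nonNegative (ℚ.<⇒≤ 0<ε)}} (begin-strict
      ε ℚ.* a k ≤⟨ εa≤b ⟩
      b k ≡⟨ ℚ.0≤p⇒∣p∣≡p (ℚ.≤-trans (ℚ.<⇒≤ 0<ε ⊠ 0≤a) εa≤b) ⟨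
      ∣ b k ∣ <⟨ b< ⟩
      ε ℚ.* δ ∎))
    where open ℚ.≤-Reasoning

null-normsq : ∀ {f} → Null (λ k → normsq (f k)) → Nullᵢ f
null-normsq {f} n = mk∼ᵢ
  (null⇒∼0 (null-sqrt (null-squeeze 0<1 (0 , λ k _ → 0≤x² (x k) ,
    ≤-from-diff (solve 2 (λ x y → x :* x :+ y :* y := con 1ℚ :* (x :* x) :+ y :* y) refl (x k) (y k))
      (0≤x² (y k))) n)))
  (null⇒∼0 (null-sqrt (null-squeeze 0<1 (0 , λ k _ → 0≤x² (y k) ,
    ≤-from-diff (solve 2 (λ x y → x :* x :+ y :* y := con 1ℚ :* (y :* y) :+ x :* x) refl (x k) (y k))
      (0≤x² (x k))) n)))
  where
  open +-*-Solver
  x y : ℕ → ℚ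
  x k = real (f k)
  y k = imag (f k)

1≤normsq-1+ : ∀ x → 0ℚ ℚ.≤ real x → 1ℚ ℚ.≤ normsq (1ᵢ +ᵢ x)
1≤normsq-1+ (p ⊹ q) 0≤p = ≤-from-diff
  (solve 2 (λ p q → (con 1ℚ :+ p) :* (con 1ℚ :+ p) :+ (con 0ℚ :+ q) :* (con 0ℚ :+ q) :=
     con 1ℚ :+ (p :+ p :+ (p :* p :+ q :* q))) refl p q)
  (0≤p ⊞ 0≤p ⊞ 0≤normsq (p ⊹ q))
  where open +-*-Solver

-- Nonvanishing along sequences of Gaussian rationals

turánᵢ : (ℕ → Poly) → ℕ → ℚ[i] → ℚ[i]
turánᵢ p n x = evᵢ (p (suc n)) x *ᵢ evᵢ (p (suc n)) x +ᵢ -ᵢ (evᵢ (p (suc (suc n))) x *ᵢ evᵢ (p n) x)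

module _ (z : ℕ → ℚ[i]) (zz : z ∼ᵢ z) (ε : ℚ) (0<ε : 0ℚ ℚ.< ε)
         (Re>ε : Eventually (λ k → ε ℚ.< real (z k))) where

  private
    0≤Re : ∀ {k} → ε ℚ.< real (z k) → 0ℚ ℚ.≤ real (z k)
    0≤Re h = ℚ.<⇒≤ (ℚ.<-trans 0<ε h)

    ss : (λ k → 1ᵢ +ᵢ z k) ∼ᵢ (λ k → 1ᵢ +ᵢ z k)
    ss = ∼ᵢ-+ (∼ᵢ-const 1ᵢ) zz

    module Near {n : ℕ} (near : ∀ k → Nearby n (z k) (½^ k)) where
      f o₀ o₂ : ℕ → ℚ[i]
      f k = Nearby.f (near k)
      o₀ k = Nearby.o₀ (near k)
      o₂ k = Nearby.o₂ (near k)
      f∼ : f ∼ᵢ (λ k → evᵢ (t n) (z k))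
      f∼ = close⇒∼ᵢ (λ k → Nearby.f-close (near k))
        (small⇒nullᵢ (λ k → Nearby.d-small (near k))) (∼ᵢ-ev (t n) zz)
      o₀∼ : o₀ ∼ᵢ (λ k → evᵢ (t (suc n)) (z k))
      o₀∼ = close⇒∼ᵢ (λ k → Nearby.o₀-close (near k))
        (small⇒nullᵢ (λ k → Nearby.d₀-small (near k))) (∼ᵢ-ev (t (suc n)) zz)
      o₂∼ : o₂ ∼ᵢ (λ k → evᵢ (t (suc (suc n))) (z k))
      o₂∼ = close⇒∼ᵢ (λ k → Nearby.o₂-close (near k))
        (small⇒nullᵢ (λ k → Nearby.d₂-small (near k))) (∼ᵢ-ev (t (suc (suc n))) zz)
      ff : f ∼ᵢ f
      ff = ∼ᵢ-trans f∼ (∼ᵢ-sym f∼)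

  -- The ratio bound gives ε |f|² ≤ Re (o₀ conj ((1 + z) f)), where o₀ is null and the other factor
  -- bounded. So |f|² is null, without any lower bound on |f|.
  null-descends : ∀ n → (∀ k → Nearby n (z k) (½^ k)) →
    Nullᵢ (λ k → evᵢ (t (suc n)) (z k)) → Nullᵢ (λ k → evᵢ (t n) (z k))
  null-descends n near nt = ∼ᵢ-trans (∼ᵢ-sym f∼) (null-normsq (null-squeeze 0<ε
    (mapₑ (λ {k} h → 0≤normsq (f k) , ℚ.≤-trans
        (ℚ.≤-trans (*-monoʳ (0≤normsq (f k)) (ℚ.<⇒≤ h)) (ℚ.≤-reflexive (ℚ.*-comm (real (z k)) (normsq (f k)))))
        (Nearby.ratio (near k) (0≤Re h))) Re>ε)
    (∼0⇒null (real-∼ (nullᵢ-*ˡ (∼ᵢ-trans o₀∼ nt) (∼ᵢ-conj (∼ᵢ-* ss ff)))))))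
    where open Near near

  -- With |1 + z| ≥ 1 the Turán bound gives ε |f|⁴ ≤ Re (-τ times a bounded sequence), and τ is
  -- null; two square roots then give f.
  turán-null⇒null : ∀ n → (∀ k → Nearby n (z k) (½^ k)) →
    Nullᵢ (λ k → turánᵢ t n (z k)) → Nullᵢ (λ k → evᵢ (t n) (z k))
  turán-null⇒null n near nτ = ∼ᵢ-trans (∼ᵢ-sym f∼) (null-normsq (null-sqrt (null-squeeze 0<ε
    (mapₑ (λ {k} h → 0≤x² (normsq (f k)) , ℚ.≤-trans (lower k h) (Nearby.turán-≤ (near k) (0≤Re h))) Re>ε)
    (∼0⇒null (real-∼ (nullᵢ-*ˡ (nullᵢ-neg (∼ᵢ-trans τ∼ nτ))
      (∼ᵢ-* (∼ᵢ-* (∼ᵢ-conj ff) (∼ᵢ-conj ff)) (∼ᵢ-* (∼ᵢ-conj ss) (∼ᵢ-conj ss)))))))))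
    where
    open Near near
    τ∼ : (λ k → o₀ k *ᵢ o₀ k +ᵢ -ᵢ (o₂ k *ᵢ f k)) ∼ᵢ (λ k → turánᵢ t n (z k))
    τ∼ = ∼ᵢ-+ (∼ᵢ-* o₀∼ o₀∼) (∼ᵢ-neg (∼ᵢ-* o₂∼ f∼))
    lower : ∀ k → ε ℚ.< real (z k) → let N = normsq (f k) in
      ε ℚ.* (N ℚ.* N) ℚ.≤ normsq (1ᵢ +ᵢ z k) ℚ.* (N ℚ.* N) ℚ.* real (z k)
    lower k h = begin
      ε ℚ.* (N ℚ.* N) ≤⟨ *-monoʳ (0≤x² N) (ℚ.<⇒≤ h) ⟩
      real (z k) ℚ.* (N ℚ.* N) ≡⟨ ℚ.*-identityˡ _ ⟨
      1ℚ ℚ.* (real (z k) ℚ.* (N ℚ.* N))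
        ≤⟨ *-monoʳ (0≤Re h ⊠ 0≤x² N) (1≤normsq-1+ (z k) (0≤Re h)) ⟩
      normsq (1ᵢ +ᵢ z k) ℚ.* (real (z k) ℚ.* (N ℚ.* N))
        ≡⟨ solve 3 (λ s x n → s :* (x :* n) := s :* n :* x) refl (normsq (1ᵢ +ᵢ z k)) (real (z k)) (N ℚ.* N) ⟩
      normsq (1ᵢ +ᵢ z k) ℚ.* (N ℚ.* N) ℚ.* real (z k) ∎
      where
      open ℚ.≤-Reasoning
      open +-*-Solver
      N = normsq (f k)

  t-not-null : ∀ n → ¬ Nullᵢ (λ k → evᵢ (t n) (z k))
  -- The constant 1 would have to be smaller than 1 in absolute value from some term on.
  t-not-null zero nt with ∼0⇒null (real-∼ (∼ᵢ-≡ (λ k → sym (evᵢ-nat1 (z k))) (λ k → refl) nt)) 1ℚ 0<1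
  ... | N , h = ℚ.<-irrefl refl (h N ℕ.≤-refl)
  t-not-null (suc n) nt = t-not-null n (null-descends n (λ k → nearby n (z k) (0<½^ k)) nt)

  turán-t-not-null : ∀ n → ¬ Nullᵢ (λ k → turánᵢ t n (z k))
  turán-t-not-null n nτ = t-not-null n
    (turán-null⇒null n (λ k → nearby n (z k) (0<½^ k)) nτ)

  turán-M-not-null : ∀ n → ¬ Nullᵢ (λ k → turánᵢ M (suc n) (z k))
  turán-M-not-null n nτ = turán-t-not-null (suc n) (mk∼ᵢ
    (null⇒∼0 (null-≤ (mapₑ (λ {k} → real-bound k) Re>ε) (∼0⇒null (real-∼ scaled))))
    (null⇒∼0 (null-≤ (mapₑ (λ {k} → imag-bound k) Re>ε) (∼0⇒null (imag-∼ scaled)))))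
    where
    open ℚ[i]-Solver
    s : ℕ → ℚ[i]
    s k = 1ᵢ +ᵢ z k
    τ : ℕ → ℚ[i]
    τ k = turánᵢ t (suc n) (z k)
    w : ℕ → ℚ
    w k = normsq (s k) ℚ.* normsq (s k)
    relate : ∀ m k → s k *ᵢ evᵢ (t (suc m)) (z k) ≡ z k *ᵢ evᵢ (M (suc m)) (z k)
    relate m k = trans (sym (trans (evᵢ-* (nat 1 +ₚ X) (t (suc m)) (z k))
        (cong (_*ᵢ evᵢ (t (suc m)) (z k)) (evᵢ-1+X (z k)))))
      (trans (evᵢ-cong (X*M m) (z k)) (trans (evᵢ-* X (M (suc m)) (z k))
        (cong (_*ᵢ evᵢ (M (suc m)) (z k)) (evᵢ-X (z k)))))
    identity : ∀ k → ιᵢ (w k) *ᵢ τ k ≡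
      turánᵢ M (suc n) (z k) *ᵢ (z k *ᵢ z k *ᵢ (conj (s k) *ᵢ conj (s k)))
    identity k = begin
      ιᵢ (w k) *ᵢ τ k
        ≡⟨ cong (_*ᵢ τ k) (trans (ιᵢ-* (normsq (s k)) (normsq (s k)))
             (cong (λ y → y *ᵢ y) (sym (*-conj (s k))))) ⟩
      s k *ᵢ conj (s k) *ᵢ (s k *ᵢ conj (s k)) *ᵢ (b *ᵢ b +ᵢ -ᵢ (c *ᵢ a))
        ≡⟨ solve 5 (λ s S a b c → s :* S :* (s :* S) :* (b :* b :+ :- (c :* a)) :=
             (s :* b :* (s :* b) :+ :- (s :* c :* (s :* a))) :* (S :* S))
             refl (s k) (conj (s k)) a b c ⟩
      (s k *ᵢ b *ᵢ (s k *ᵢ b) +ᵢ -ᵢ (s k *ᵢ c *ᵢ (s k *ᵢ a))) *ᵢ (conj (s k) *ᵢ conj (s k))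
        ≡⟨ cong₂ (λ y y′ → (y *ᵢ y +ᵢ -ᵢ y′) *ᵢ (conj (s k) *ᵢ conj (s k)))
             (relate (suc n) k) (cong₂ _*ᵢ_ (relate (suc (suc n)) k) (relate n k)) ⟩
      (z k *ᵢ b′ *ᵢ (z k *ᵢ b′) +ᵢ -ᵢ (z k *ᵢ c′ *ᵢ (z k *ᵢ a′))) *ᵢ (conj (s k) *ᵢ conj (s k))
        ≡⟨ solve 5 (λ z S a b c → (z :* b :* (z :* b) :+ :- (z :* c :* (z :* a))) :* (S :* S) :=
             (b :* b :+ :- (c :* a)) :* (z :* z :* (S :* S)))
             refl (z k) (conj (s k)) a′ b′ c′ ⟩
      turánᵢ M (suc n) (z k) *ᵢ (z k *ᵢ z k *ᵢ (conj (s k) *ᵢ conj (s k))) ∎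
      where
      open ≡-Reasoning
      a = evᵢ (t (suc n)) (z k)
      b = evᵢ (t (suc (suc n))) (z k)
      c = evᵢ (t (suc (suc (suc n)))) (z k)
      a′ = evᵢ (M (suc n)) (z k)
      b′ = evᵢ (M (suc (suc n))) (z k)
      c′ = evᵢ (M (suc (suc (suc n)))) (z k)
    scaled : Nullᵢ (λ k → ιᵢ (w k) *ᵢ τ k)
    scaled = ∼ᵢ-≡ identity (λ k → refl)
      (nullᵢ-*ˡ nτ (∼ᵢ-* (∼ᵢ-* zz zz) (∼ᵢ-* (∼ᵢ-conj ss) (∼ᵢ-conj ss))))
    imag-ι* : ∀ r y → imag (ιᵢ r *ᵢ y) ≡ r ℚ.* imag y
    imag-ι* r (a ⊹ b) = trans (cong (r ℚ.* b ℚ.+_) (ℚ.*-zeroˡ a)) (ℚ.+-identityʳ (r ℚ.* b))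
    enlarge : ∀ {r} a → 1ℚ ℚ.≤ r → ∣ a ∣ ℚ.≤ ∣ r ℚ.* a ∣
    enlarge {r} a 1≤r = ≤.begin
      ∣ a ∣ ≤.≡⟨ ℚ.*-identityˡ ∣ a ∣ ⟨
      1ℚ ℚ.* ∣ a ∣ ≤.≤⟨ *-monoʳ (ℚ.0≤∣p∣ a) 1≤r ⟩
      r ℚ.* ∣ a ∣ ≤.≡⟨ cong (ℚ._* ∣ a ∣) (ℚ.0≤p⇒∣p∣≡p (ℚ.≤-trans 0≤1 1≤r)) ⟨
      ∣ r ∣ ℚ.* ∣ a ∣ ≤.≡⟨ ℚ.∣p*q∣≡∣p∣*∣q∣ r a ⟨
      ∣ r ℚ.* a ∣ ≤.∎
      where module ≤ = ℚ.≤-Reasoning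
    1≤w : ∀ k → ε ℚ.< real (z k) → 1ℚ ℚ.≤ w k
    1≤w k h = ℚ.≤-trans 1≤s (ℚ.≤-trans (ℚ.≤-reflexive (sym (ℚ.*-identityˡ (normsq (s k)))))
                (*-monoʳ (0≤normsq (s k)) 1≤s))
      where 1≤s = 1≤normsq-1+ (z k) (0≤Re h)
    real-bound : ∀ k → ε ℚ.< real (z k) → ∣ real (τ k) ∣ ℚ.≤ ∣ real (ιᵢ (w k) *ᵢ τ k) ∣
    real-bound k h = ℚ.≤-trans (enlarge (real (τ k)) (1≤w k h))
      (ℚ.≤-reflexive (cong ∣_∣ (sym (real-ι* (w k) (τ k)))))
    imag-bound : ∀ k → ε ℚ.< real (z k) → ∣ imag (τ k) ∣ ℚ.≤ ∣ imag (ιᵢ (w k) *ᵢ τ k) ∣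
    imag-bound k h = ℚ.≤-trans (enlarge (imag (τ k)) (1≤w k h))
      (ℚ.≤-reflexive (cong ∣_∣ (sym (imag-ι* (w k) (τ k)))))

-- Passage to complex points

atIndex : ℂ → ℕ → ℚ[i]
atIndex z k = seq (re z) k ⊹ seq (im z) k

-- Arithmetic on Cauchy sequences is termwise, so evaluation commutes exactly with taking the k-th
-- approximation.
eval-atIndex : ∀ p z k → evᵢ p (atIndex z k) ≡ atIndex (ℂ[x].eval (complexify p) z) k
eval-atIndex []      z k = refl
eval-atIndex (a ∷ p) z k = cong (λ y → ιᵢ a +ᵢ atIndex z k *ᵢ y) (eval-atIndex p z k)

evᵢ-turán : ∀ p n x → evᵢ (turán p n) x ≡ turánᵢ p n x
evᵢ-turán p n x =
  trans (evᵢ-+ (p (suc n) *ₚ p (suc n)) (-ₚ (p (suc (suc n)) *ₚ p n)) x)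
  (cong₂ _+ᵢ_ (evᵢ-* (p (suc n)) (p (suc n)) x)
    (trans (evᵢ-neg (p (suc (suc n)) *ₚ p n) x) (cong -ᵢ_ (evᵢ-* (p (suc (suc n))) (p n) x))))

-- A zero at z says precisely that the values at the approximations of z form a null sequence, and
-- positivity of Re z provides the uniform ε.
hurwitz-from-values : ∀ p n →
  (∀ z → z ∼ᵢ z → ∀ ε → 0ℚ ℚ.< ε → Eventually (λ k → ε ℚ.< real (z k)) →
     ¬ Nullᵢ (λ k → turánᵢ p n (z k))) →
  HurwitzStable (complexify (turán p n))
hurwitz-from-values p n h = inj₂ λ z (ε , 0<ε , Re>ε) (re≈0 , im≈0) →
  h (atIndex z)
    (mk∼ᵢ (∼-refl (eventually-bounded (cauchy (re z)))) (∼-refl (eventually-bounded (cauchy (im z)))))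
    ε 0<ε Re>ε
    (∼ᵢ-≡ (λ k → trans (sym (evᵢ-turán p n (atIndex z k))) (eval-atIndex (turán p n) z k)) (λ k → refl)
      (mk∼ᵢ (null⇒∼0 (null-≡ (λ k → sym (ℚ.+-identityʳ _)) re≈0))
            (null⇒∼0 (null-≡ (λ k → sym (ℚ.+-identityʳ _)) im≈0))))

proposition3p9 : (∀ (n : ℕ) → HurwitzStable (complexify (turán t n)))
    × (∀ (n : ℕ) → 1 ≤ n → HurwitzStable (complexify (turán M n)))
proposition3p9 = (λ n → hurwitz-from-values t n (λ z zz ε 0<ε h → turán-t-not-null z zz ε 0<ε h n))
  , λ { (suc n) _ → hurwitz-from-values M (suc n) (λ z zz ε 0<ε h → turán-M-not-null z zz ε 0<ε h n) }
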